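{- Let $n<m$ be positive integers. The set of $n\times m$ rectangular unimodular matrices over $\mathbb{Z}$, viewed as a subset of $\mathbb{Z}^{nm}$, has a density, and this density is equal to $$\prod_{i=0}^{n-1}\frac{1}{\zeta(m-i)},$$ where $\zeta$ is the Riemann zeta function.
   Context: A matrix $M\in\mathrm{Mat}_{n\times m}(\mathbb{Z})$ with $n<m$ is rectangular unimodular if there exist $m-n$ rows in $\mathbb{Z}^m$ such that adjoining these rows to $M$ gives an $m\times m$ matrix whose determinant is a unit of $\mathbb{Z}$ (i.e. $\pm1$). The density of a set $S\subseteq\mathbb{Z}^d$ is $$\rho(S)=\lim_{B\to\infty}\frac{|S\cap[-B,B)^d|}{(2B)^d}$$ if the limit exists, with $B$ ranging over the positive integers. $\mathrm{Mat}_{n\times m}(\mathbb{Z})$ is identified entrywise with $\mathbb{Z}^{nm}$. -}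

module Defs where

open import Algebra.Definitions using (Invertible)
open import Algebra.Properties.Semiring.Sum using (sum)
open import Data.Empty using (⊥-elim)
open import Data.Fin.Base using (Fin; toℕ)
open import Data.Fin.Properties using (toℕ<n)
open import Data.Integer.Base as ℤ using (ℤ; +_; 1ℤ; -1ℤ)
import Data.Integer.Properties as ℤ
open import Data.List.Base using (List; length)
open import Data.List.Membership.Propositional using (_∈_)
open import Data.List.Relation.Unary.Unique.Propositional using (Unique)
open import Data.Nat.Base as ℕ using (ℕ; zero; suc; _∸_; _^_)
import Data.Nat.Properties as ℕ
open import Data.Product.Base using (Σ-syntax; ∃-syntax; _×_; _,_; proj₁; proj₂)
open import Data.Rational.Base as ℚ using (ℚ; 0ℚ; 1ℚ; ½; mkℚ)
import Data.Rational.Properties as ℚ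
import Data.Rational.Solver as ℚSolver
import Data.Rational.Unnormalised.Base as ℚᵘ
import Data.Rational.Unnormalised.Properties as ℚᵘ
open import Data.Sum.Base using (inj₁; inj₂)
open import Data.Vec.Base using (Vec; []; _∷_; _++_; cast; concat; lookup; map; removeAt)
import Data.Vec.Functional as Vector
open import Data.Vec.Relation.Unary.All using (All)
open import Function.Bundles using (_⇔_)
open import Level using (0ℓ)
open import Relation.Binary.PropositionalEquality
  using (_≡_; _≢_; refl; sym; trans; cong; cong₂; subst)
open import Relation.Nullary using (yes; no)
open import Relation.Unary using (Pred; _∩_)

Cauchy : (ℕ → ℚ) → Set
Cauchy x = ∀ ε → 0ℚ ℚ.< ε →
  ∃[ N ] (∀ i j → N ℕ.≤ i → N ℕ.≤ j → ℚ.∣ x i ℚ.- x j ∣ ℚ.< ε)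

record ℝ : Set where
  constructor mkℝ
  field
    approx : ℕ → ℚ
    cauchy : Cauchy approx

open ℝ public

infix 4 _<ℝ_

_<ℝ_ : ℝ → ℝ → Set
x <ℝ y = ∃[ δ ] (0ℚ ℚ.< δ) ×
  ∃[ N ] (∀ k → N ℕ.≤ k → approx x k ℚ.+ δ ℚ.≤ approx y k)

private
  0<½* : ∀ {ε} → 0ℚ ℚ.< ε → 0ℚ ℚ.< ½ ℚ.* ε
  0<½* {ε} 0<ε = subst (ℚ._< ½ ℚ.* ε) (ℚ.*-zeroʳ ½) (ℚ.*-monoʳ-<-pos ½ 0<ε)

  ½+½ : ∀ ε → ½ ℚ.* ε ℚ.+ ½ ℚ.* ε ≡ ε
  ½+½ ε = trans (sym (ℚ.*-distribʳ-+ ε ½ ½)) (ℚ.*-identityˡ ε)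

  0<+ : ∀ {p q} → 0ℚ ℚ.< p → 0ℚ ℚ.< q → 0ℚ ℚ.< p ℚ.+ q
  0<+ = ℚ.+-mono-<

  0<* : ∀ {p q} → 0ℚ ℚ.< p → 0ℚ ℚ.< q → 0ℚ ℚ.< p ℚ.* q
  0<* {p} {q} 0<p 0<q =
    subst (ℚ._< p ℚ.* q) (ℚ.*-zeroʳ p) (ℚ.*-monoʳ-<-pos p ⦃ ℚ.positive 0<p ⦄ 0<q)

  *-mono-≤ : ∀ {p q r s} → 0ℚ ℚ.≤ r → 0ℚ ℚ.≤ q → p ℚ.≤ q → r ℚ.≤ s → p ℚ.* r ℚ.≤ q ℚ.* s
  *-mono-≤ {p} {q} {r} {s} 0≤r 0≤q p≤q r≤s = ℚ.≤-trans
    (ℚ.*-monoʳ-≤-nonNeg r ⦃ ℚ.nonNegative 0≤r ⦄ p≤q)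
    (ℚ.*-monoˡ-≤-nonNeg q ⦃ ℚ.nonNegative 0≤q ⦄ r≤s)

  ∣p-q∣≡∣q-p∣ : ∀ p q → ℚ.∣ p ℚ.- q ∣ ≡ ℚ.∣ q ℚ.- p ∣
  ∣p-q∣≡∣q-p∣ p q = trans (sym (ℚ.∣-p∣≡∣p∣ (p ℚ.- q))) (cong ℚ.∣_∣ (identity p q))
    where
    open ℚSolver.+-*-Solver
    identity : ∀ p q → ℚ.- (p ℚ.- q) ≡ q ℚ.- p
    identity = solve 2 (λ p q → :- (p :- q) := q :- p) refl

  ∣p∣≤∣p-q∣+∣q∣ : ∀ p q → ℚ.∣ p ∣ ℚ.≤ ℚ.∣ p ℚ.- q ∣ ℚ.+ ℚ.∣ q ∣
  ∣p∣≤∣p-q∣+∣q∣ p q = subst (λ r → ℚ.∣ r ∣ ℚ.≤ ℚ.∣ p ℚ.- q ∣ ℚ.+ ℚ.∣ q ∣)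
    (identity p q) (ℚ.∣p+q∣≤∣p∣+∣q∣ (p ℚ.- q) q)
    where
    open ℚSolver.+-*-Solver
    identity : ∀ p q → (p ℚ.- q) ℚ.+ q ≡ p
    identity = solve 2 (λ p q → (p :- q) :+ q := p) refl

  p≤q+r⇒p-r≤q : ∀ {p q r} → p ℚ.≤ q ℚ.+ r → p ℚ.- r ℚ.≤ q
  p≤q+r⇒p-r≤q {p} {q} {r} p≤q+r =
    subst (p ℚ.- r ℚ.≤_) (identity q r) (ℚ.+-monoˡ-≤ (ℚ.- r) p≤q+r)
    where
    open ℚSolver.+-*-Solver
    identity : ∀ q r → (q ℚ.+ r) ℚ.- r ≡ q
    identity = solve 2 (λ q r → (q :+ r) :- r := q) refl

  ∣-∣-lipschitz : ∀ p q → ℚ.∣ ℚ.∣ p ∣ ℚ.- ℚ.∣ q ∣ ∣ ℚ.≤ ℚ.∣ p ℚ.- q ∣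
  ∣-∣-lipschitz p q with ℚ.∣p∣≡p∨∣p∣≡-p (ℚ.∣ p ∣ ℚ.- ℚ.∣ q ∣)
  ... | inj₁ eq = subst (ℚ._≤ ℚ.∣ p ℚ.- q ∣) (sym eq) (p≤q+r⇒p-r≤q (∣p∣≤∣p-q∣+∣q∣ p q))
  ... | inj₂ eq = subst (ℚ._≤ ℚ.∣ p ℚ.- q ∣) (sym (trans eq (identity ℚ.∣ p ∣ ℚ.∣ q ∣)))
      (subst (ℚ.∣ q ∣ ℚ.- ℚ.∣ p ∣ ℚ.≤_) (∣p-q∣≡∣q-p∣ q p) (p≤q+r⇒p-r≤q (∣p∣≤∣p-q∣+∣q∣ q p)))
    where
    open ℚSolver.+-*-Solver
    identity : ∀ p q → ℚ.- (p ℚ.- q) ≡ q ℚ.- p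
    identity = solve 2 (λ p q → :- (p :- q) := q :- p) refl

fromℚ : ℚ → ℝ
fromℚ q = mkℝ (λ _ → q) λ ε 0<ε →
  0 , λ _ _ _ _ → subst (λ r → ℚ.∣ r ∣ ℚ.< ε) (sym (ℚ.+-inverseʳ q)) 0<ε

0ℝ 1ℝ : ℝ
0ℝ = fromℚ 0ℚ
1ℝ = fromℚ 1ℚ

∣_∣ℝ : ℝ → ℝ
∣ mkℝ x cx ∣ℝ = mkℝ (λ k → ℚ.∣ x k ∣) λ ε 0<ε → let N , bound = cx ε 0<ε in
  N , λ i j N≤i N≤j → ℚ.≤-<-trans (∣-∣-lipschitz (x i) (x j)) (bound i j N≤i N≤j)

infixl 6 _-ℝ_

_-ℝ_ : ℝ → ℝ → ℝ
mkℝ x cx -ℝ mkℝ y cy = mkℝ (λ k → x k ℚ.- y k) difference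
  where
  open ℚSolver.+-*-Solver
  identity : ∀ p q r s → (p ℚ.- r) ℚ.- (q ℚ.- s) ≡ (p ℚ.- q) ℚ.- (r ℚ.- s)
  identity = solve 4 (λ p q r s → (p :- r) :- (q :- s) := (p :- q) :- (r :- s)) refl

  difference : Cauchy (λ k → x k ℚ.- y k)
  difference ε 0<ε with cx (½ ℚ.* ε) (0<½* 0<ε) | cy (½ ℚ.* ε) (0<½* 0<ε)
  ... | M , boundx | N , boundy = M ℕ.⊔ N , λ i j ≤i ≤j → begin-strict
    ℚ.∣ (x i ℚ.- y i) ℚ.- (x j ℚ.- y j) ∣
      ≡⟨ cong ℚ.∣_∣ (identity (x i) (x j) (y i) (y j)) ⟩
    ℚ.∣ (x i ℚ.- x j) ℚ.- (y i ℚ.- y j) ∣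
      ≤⟨ ℚ.∣p-q∣≤∣p∣+∣q∣ (x i ℚ.- x j) (y i ℚ.- y j) ⟩
    ℚ.∣ x i ℚ.- x j ∣ ℚ.+ ℚ.∣ y i ℚ.- y j ∣
      <⟨ ℚ.+-mono-< (boundx i j (ℕ.m⊔n≤o⇒m≤o M N ≤i) (ℕ.m⊔n≤o⇒m≤o M N ≤j))
                    (boundy i j (ℕ.m⊔n≤o⇒n≤o M N ≤i) (ℕ.m⊔n≤o⇒n≤o M N ≤j)) ⟩
    ½ ℚ.* ε ℚ.+ ½ ℚ.* ε
      ≡⟨ ½+½ ε ⟩
    ε ∎
    where open ℚ.≤-Reasoning

private
  eventuallyBounded : ∀ {x} → Cauchy x →
    ∃[ C ] (0ℚ ℚ.< C) × ∃[ N ] (∀ k → N ℕ.≤ k → ℚ.∣ x k ∣ ℚ.≤ C)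
  eventuallyBounded {x} cx with cx 1ℚ (ℚ.positive⁻¹ 1ℚ)
  ... | N , bound = 1ℚ ℚ.+ ℚ.∣ x N ∣
      , ℚ.+-mono-<-≤ (ℚ.positive⁻¹ 1ℚ) (ℚ.0≤∣p∣ (x N))
      , N , λ k N≤k → ℚ.≤-trans (∣p∣≤∣p-q∣+∣q∣ (x k) (x N))
          (ℚ.+-monoˡ-≤ ℚ.∣ x N ∣ (ℚ.<⇒≤ (bound k N N≤k ℕ.≤-refl)))

  divide : ∀ c ε → 0ℚ ℚ.< c → 0ℚ ℚ.< ε → ∃[ η ] (0ℚ ℚ.< η) × (c ℚ.* η ≡ ε)
  divide c ε 0<c 0<ε = d ℚ.* ε , 0<* 0<d 0<ε ,
    trans (sym (ℚ.*-assoc c d ε))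
      (trans (cong (ℚ._* ε) (ℚ.*-inverseʳ c ⦃ ℚ.>-nonZero 0<c ⦄)) (ℚ.*-identityˡ ε))
    where
    d = (ℚ.1/ c) ⦃ ℚ.>-nonZero 0<c ⦄
    0<d : 0ℚ ℚ.< d
    0<d = ℚ.positive⁻¹ d ⦃ ℚ.1/pos⇒pos c ⦃ ℚ.positive 0<c ⦄ ⦄

  *-estimate : ∀ {C D η ε} p q r s → 0ℚ ℚ.< C → 0ℚ ℚ.< η → (C ℚ.+ D) ℚ.* η ≡ ε →
    ℚ.∣ p ∣ ℚ.≤ C → ℚ.∣ s ∣ ℚ.≤ D → ℚ.∣ p ℚ.- q ∣ ℚ.< η → ℚ.∣ r ℚ.- s ∣ ℚ.< η →
    ℚ.∣ p ℚ.* r ℚ.- q ℚ.* s ∣ ℚ.< ε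
  *-estimate {C} {D} {η} {ε} p q r s 0<C 0<η eq ∣p∣≤C ∣s∣≤D ∣p-q∣<η ∣r-s∣<η = begin-strict
    ℚ.∣ p ℚ.* r ℚ.- q ℚ.* s ∣
      ≡⟨ cong ℚ.∣_∣ (identity p q r s) ⟩
    ℚ.∣ p ℚ.* (r ℚ.- s) ℚ.+ (p ℚ.- q) ℚ.* s ∣
      ≤⟨ ℚ.∣p+q∣≤∣p∣+∣q∣ (p ℚ.* (r ℚ.- s)) ((p ℚ.- q) ℚ.* s) ⟩
    ℚ.∣ p ℚ.* (r ℚ.- s) ∣ ℚ.+ ℚ.∣ (p ℚ.- q) ℚ.* s ∣
      ≡⟨ cong₂ ℚ._+_ (ℚ.∣p*q∣≡∣p∣*∣q∣ p (r ℚ.- s)) (ℚ.∣p*q∣≡∣p∣*∣q∣ (p ℚ.- q) s) ⟩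
    ℚ.∣ p ∣ ℚ.* ℚ.∣ r ℚ.- s ∣ ℚ.+ ℚ.∣ p ℚ.- q ∣ ℚ.* ℚ.∣ s ∣
      ≤⟨ ℚ.+-mono-≤
           (*-mono-≤ (ℚ.0≤∣p∣ (r ℚ.- s)) (ℚ.<⇒≤ 0<C) ∣p∣≤C ℚ.≤-refl)
           (*-mono-≤ (ℚ.0≤∣p∣ s) (ℚ.<⇒≤ 0<η) (ℚ.<⇒≤ ∣p-q∣<η) ∣s∣≤D) ⟩
    C ℚ.* ℚ.∣ r ℚ.- s ∣ ℚ.+ η ℚ.* D
      <⟨ ℚ.+-monoˡ-< (η ℚ.* D) (ℚ.*-monoʳ-<-pos C ⦃ ℚ.positive 0<C ⦄ ∣r-s∣<η) ⟩
    C ℚ.* η ℚ.+ η ℚ.* D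
      ≡⟨ rescale C D η ⟩
    (C ℚ.+ D) ℚ.* η
      ≡⟨ eq ⟩
    ε ∎
    where
    open ℚ.≤-Reasoning
    open ℚSolver.+-*-Solver
    identity : ∀ p q r s → p ℚ.* r ℚ.- q ℚ.* s ≡ p ℚ.* (r ℚ.- s) ℚ.+ (p ℚ.- q) ℚ.* s
    identity = solve 4 (λ p q r s →
      p :* r :- q :* s := p :* (r :- s) :+ (p :- q) :* s) refl

    rescale : ∀ C D η → C ℚ.* η ℚ.+ η ℚ.* D ≡ (C ℚ.+ D) ℚ.* η
    rescale = solve 3 (λ C D η → C :* η :+ η :* D := (C :+ D) :* η) refl

infixl 7 _*ℝ_

_*ℝ_ : ℝ → ℝ → ℝ
mkℝ x cx *ℝ mkℝ y cy = mkℝ (λ k → x k ℚ.* y k) product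
  where
  conclude : ∀ {C D K L ε} → 0ℚ ℚ.< C →
    (∀ k → K ℕ.≤ k → ℚ.∣ x k ∣ ℚ.≤ C) → (∀ k → L ℕ.≤ k → ℚ.∣ y k ∣ ℚ.≤ D) →
    ∃[ η ] (0ℚ ℚ.< η) × ((C ℚ.+ D) ℚ.* η ≡ ε) →
    ∃[ N ] (∀ i j → N ℕ.≤ i → N ℕ.≤ j → ℚ.∣ x i ℚ.* y i ℚ.- x j ℚ.* y j ∣ ℚ.< ε)
  conclude {C} {D} {K} {L} {ε} 0<C boundC boundD (η , 0<η , eq) =
    N , λ i j N≤i N≤j →
      *-estimate (x i) (x j) (y i) (y j) 0<C 0<η eq
        (boundC i (ℕ.≤-trans K≤N N≤i)) (boundD j (ℕ.≤-trans L≤N N≤j))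
        (proj₂ (cx η 0<η) i j (ℕ.≤-trans M₁≤N N≤i) (ℕ.≤-trans M₁≤N N≤j))
        (proj₂ (cy η 0<η) i j (ℕ.≤-trans M₂≤N N≤i) (ℕ.≤-trans M₂≤N N≤j))
    where
    M₁ = proj₁ (cx η 0<η)
    M₂ = proj₁ (cy η 0<η)
    N = (K ℕ.⊔ L) ℕ.⊔ (M₁ ℕ.⊔ M₂)
    K≤N : K ℕ.≤ N
    K≤N = ℕ.m≤n⇒m≤n⊔o (M₁ ℕ.⊔ M₂) (ℕ.m≤m⊔n K L)
    L≤N : L ℕ.≤ N
    L≤N = ℕ.m≤n⇒m≤n⊔o (M₁ ℕ.⊔ M₂) (ℕ.m≤n⊔m K L)
    M₁≤N : M₁ ℕ.≤ N
    M₁≤N = ℕ.m≤n⇒m≤o⊔n (K ℕ.⊔ L) (ℕ.m≤m⊔n M₁ M₂)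
    M₂≤N : M₂ ℕ.≤ N
    M₂≤N = ℕ.m≤n⇒m≤o⊔n (K ℕ.⊔ L) (ℕ.m≤n⊔m M₁ M₂)

  product : Cauchy (λ k → x k ℚ.* y k)
  product ε 0<ε =
    let C , 0<C , _ , boundC = eventuallyBounded cx
        D , 0<D , _ , boundD = eventuallyBounded cy
    in conclude 0<C boundC boundD (divide (C ℚ.+ D) ε (0<+ 0<C 0<D) 0<ε)

-- Reciprocal extended to all of ℚ; the junk value at 0 occurs at only finitely
-- many terms of a real that is apart from 0.
reciprocal : ℚ → ℚ
reciprocal p with p ℚ.≟ 0ℚ
... | yes _   = 0ℚ
... | no  p≢0 = (ℚ.1/ p) ⦃ ℚ.≢-nonZero p≢0 ⦄

private
  reciprocal-inverse : ∀ p → p ≢ 0ℚ → reciprocal p ℚ.* p ≡ 1ℚ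
  reciprocal-inverse p p≢0 with p ℚ.≟ 0ℚ
  ... | yes p≡0  = ⊥-elim (p≢0 p≡0)
  ... | no  p≢0′ = ℚ.*-inverseˡ p ⦃ ℚ.≢-nonZero p≢0′ ⦄

  0<∣p∣⇒p≢0 : ∀ {p} → 0ℚ ℚ.< ℚ.∣ p ∣ → p ≢ 0ℚ
  0<∣p∣⇒p≢0 0<∣p∣ refl = ℚ.<-irrefl refl 0<∣p∣

private
  0<δ≤∣p∣⇒unit : ∀ {δ} p → 0ℚ ℚ.< δ → δ ℚ.≤ ℚ.∣ p ∣ → reciprocal p ℚ.* p ≡ 1ℚ
  0<δ≤∣p∣⇒unit p 0<δ δ≤∣p∣ = reciprocal-inverse p (0<∣p∣⇒p≢0 (ℚ.<-≤-trans 0<δ δ≤∣p∣))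

  bounded : ∀ {d δ} r p → 0ℚ ℚ.< δ → δ ℚ.* d ≡ 1ℚ → r ℚ.* p ≡ 1ℚ → δ ℚ.≤ ℚ.∣ p ∣ →
    ℚ.∣ r ∣ ℚ.≤ d
  bounded {d} {δ} r p 0<δ δd rp δ≤∣p∣ = ℚ.*-cancelʳ-≤-pos δ ⦃ ℚ.positive 0<δ ⦄ (begin
    ℚ.∣ r ∣ ℚ.* δ         ≤⟨ *-mono-≤ (ℚ.<⇒≤ 0<δ) (ℚ.0≤∣p∣ r) ℚ.≤-refl δ≤∣p∣ ⟩
    ℚ.∣ r ∣ ℚ.* ℚ.∣ p ∣    ≡⟨ sym (ℚ.∣p*q∣≡∣p∣*∣q∣ r p) ⟩
    ℚ.∣ r ℚ.* p ∣         ≡⟨ cong ℚ.∣_∣ rp ⟩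
    1ℚ                    ≡⟨ sym δd ⟩
    δ ℚ.* d               ≡⟨ ℚ.*-comm δ d ⟩
    d ℚ.* δ               ∎)
    where open ℚ.≤-Reasoning

  ⁻¹-estimate : ∀ {d η ε} r s p q → 0ℚ ℚ.< d → (d ℚ.* d) ℚ.* η ≡ ε →
    r ℚ.* p ≡ 1ℚ → s ℚ.* q ≡ 1ℚ → ℚ.∣ r ∣ ℚ.≤ d → ℚ.∣ s ∣ ℚ.≤ d → ℚ.∣ q ℚ.- p ∣ ℚ.< η →
    ℚ.∣ r ℚ.- s ∣ ℚ.< ε
  ⁻¹-estimate {d} {η} {ε} r s p q 0<d eq rp sq ∣r∣≤d ∣s∣≤d ∣q-p∣<η = begin-strict
    ℚ.∣ r ℚ.- s ∣
      ≡⟨ cong ℚ.∣_∣ difference ⟩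
    ℚ.∣ (r ℚ.* s) ℚ.* (q ℚ.- p) ∣
      ≡⟨ ℚ.∣p*q∣≡∣p∣*∣q∣ (r ℚ.* s) (q ℚ.- p) ⟩
    ℚ.∣ r ℚ.* s ∣ ℚ.* ℚ.∣ q ℚ.- p ∣
      ≡⟨ cong (ℚ._* ℚ.∣ q ℚ.- p ∣) (ℚ.∣p*q∣≡∣p∣*∣q∣ r s) ⟩
    (ℚ.∣ r ∣ ℚ.* ℚ.∣ s ∣) ℚ.* ℚ.∣ q ℚ.- p ∣
      ≤⟨ *-mono-≤ (ℚ.0≤∣p∣ (q ℚ.- p)) (ℚ.<⇒≤ 0<dd)
           (*-mono-≤ (ℚ.0≤∣p∣ s) (ℚ.<⇒≤ 0<d) ∣r∣≤d ∣s∣≤d) ℚ.≤-refl ⟩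
    (d ℚ.* d) ℚ.* ℚ.∣ q ℚ.- p ∣
      <⟨ ℚ.*-monoʳ-<-pos (d ℚ.* d) ⦃ ℚ.positive 0<dd ⦄ ∣q-p∣<η ⟩
    (d ℚ.* d) ℚ.* η
      ≡⟨ eq ⟩
    ε ∎
    where
    open ℚ.≤-Reasoning
    open ℚSolver.+-*-Solver
    0<dd : 0ℚ ℚ.< d ℚ.* d
    0<dd = 0<* 0<d 0<d

    factor : ∀ r s p q → r ℚ.* (s ℚ.* q) ℚ.- s ℚ.* (r ℚ.* p) ≡ (r ℚ.* s) ℚ.* (q ℚ.- p)
    factor = solve 4 (λ r s p q →
      r :* (s :* q) :- s :* (r :* p) := (r :* s) :* (q :- p)) refl

    difference : r ℚ.- s ≡ (r ℚ.* s) ℚ.* (q ℚ.- p)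
    difference = trans
      (cong₂ ℚ._-_ (sym (trans (cong (r ℚ.*_) sq) (ℚ.*-identityʳ r)))
                   (sym (trans (cong (s ℚ.*_) rp) (ℚ.*-identityʳ s))))
      (factor r s p q)

_⁻¹[_] : (x : ℝ) → 0ℝ <ℝ ∣ x ∣ℝ → ℝ
mkℝ x cx ⁻¹[ δ , 0<δ , K , away ] = mkℝ (λ k → reciprocal (x k)) inverse
  where
  δ≤∣x∣ : ∀ k → K ℕ.≤ k → δ ℚ.≤ ℚ.∣ x k ∣
  δ≤∣x∣ k K≤k = subst (ℚ._≤ ℚ.∣ x k ∣) (ℚ.+-identityˡ δ) (away k K≤k)

  unit : ∀ k → K ℕ.≤ k → reciprocal (x k) ℚ.* x k ≡ 1ℚ
  unit k K≤k = 0<δ≤∣p∣⇒unit (x k) 0<δ (δ≤∣x∣ k K≤k)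

  conclude : ∀ {d ε} → 0ℚ ℚ.< d → δ ℚ.* d ≡ 1ℚ →
    ∃[ η ] (0ℚ ℚ.< η) × ((d ℚ.* d) ℚ.* η ≡ ε) →
    ∃[ N ] (∀ i j → N ℕ.≤ i → N ℕ.≤ j →
      ℚ.∣ reciprocal (x i) ℚ.- reciprocal (x j) ∣ ℚ.< ε)
  conclude {d} {ε} 0<d δd (η , 0<η , eq) = K ℕ.⊔ L , λ i j ≤i ≤j →
    let K≤i = ℕ.m⊔n≤o⇒m≤o K L ≤i
        K≤j = ℕ.m⊔n≤o⇒m≤o K L ≤j
    in ⁻¹-estimate (reciprocal (x i)) (reciprocal (x j)) (x i) (x j) 0<d eq
      (unit i K≤i) (unit j K≤j)
      (bounded (reciprocal (x i)) (x i) 0<δ δd (unit i K≤i) (δ≤∣x∣ i K≤i))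
      (bounded (reciprocal (x j)) (x j) 0<δ δd (unit j K≤j) (δ≤∣x∣ j K≤j))
      (proj₂ (cx η 0<η) j i (ℕ.m⊔n≤o⇒n≤o K L ≤j) (ℕ.m⊔n≤o⇒n≤o K L ≤i))
    where
    L = proj₁ (cx η 0<η)

  inverse : Cauchy (λ k → reciprocal (x k))
  inverse ε 0<ε =
    let d , 0<d , δd = divide δ 1ℚ 0<δ (ℚ.positive⁻¹ 1ℚ)
    in conclude 0<d δd (divide (d ℚ.* d) ε (0<* 0<d 0<d) 0<ε)

∏ : ∀ {n} → (Fin n → ℝ) → ℝ
∏ = Vector.foldr _*ℝ_ 1ℝ

infix 4 _⟶_

_⟶_ : (ℕ → ℝ) → ℝ → Set
x ⟶ l = ∀ ε → 0ℚ ℚ.< ε → ∃[ N ] (∀ k → N ℕ.≤ k → ∣ x k -ℝ l ∣ℝ <ℝ fromℚ ε)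

ζ-term : ℕ → ℕ → ℚ
ζ-term s k = (+ 1 ℚ./ suc k ^ s) ⦃ ℕ.m^n≢0 (suc k) s ⦄

-- ζ-partial s K = Σ_{k=1}^{K} 1/kˢ
ζ-partial : ℕ → ℕ → ℚ
ζ-partial s zero    = 0ℚ
ζ-partial s (suc k) = ζ-partial s k ℚ.+ ζ-term s k

private
  1/_ : (n : ℕ) .⦃ _ : ℕ.NonZero n ⦄ → ℚ
  1/ n = + 1 ℚ./ n

  0<1/ : ∀ n .⦃ _ : ℕ.NonZero n ⦄ → 0ℚ ℚ.< 1/ n
  0<1/ n = ℚ.positive⁻¹ (1/ n) ⦃ ℚ.normalize-pos 1 n ⦄

  unitFractions : ∀ a b c .⦃ _ : ℕ.NonZero a ⦄ .⦃ _ : ℕ.NonZero b ⦄ .⦃ _ : ℕ.NonZero c ⦄ →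
    (b ℕ.+ a) ℕ.* c ℕ.≤ a ℕ.* b → 1/ a ℚ.+ 1/ b ℚ.≤ 1/ c
  unitFractions a@(suc a′) b@(suc b′) c@(suc c′) le = ℚ.toℚᵘ-cancel-≤ (begin
    ℚ.toℚᵘ (1/ a ℚ.+ 1/ b)
      ≃⟨ ℚ.toℚᵘ-homo-+ (1/ a) (1/ b) ⟩
    ℚ.toℚᵘ (1/ a) ℚᵘ.+ ℚ.toℚᵘ (1/ b)
      ≃⟨ ℚᵘ.+-cong (ℚ.toℚᵘ-fromℚᵘ (ℚᵘ.mkℚᵘ (+ 1) a′)) (ℚ.toℚᵘ-fromℚᵘ (ℚᵘ.mkℚᵘ (+ 1) b′)) ⟩
    ℚᵘ.mkℚᵘ (+ 1) a′ ℚᵘ.+ ℚᵘ.mkℚᵘ (+ 1) b′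
      ≤⟨ ℚᵘ.*≤* (ℤ.+≤+ cross) ⟩
    ℚᵘ.mkℚᵘ (+ 1) c′
      ≃⟨ ℚᵘ.≃-sym (ℚ.toℚᵘ-fromℚᵘ (ℚᵘ.mkℚᵘ (+ 1) c′)) ⟩
    ℚ.toℚᵘ (1/ c) ∎)
    where
    open ℚᵘ.≤-Reasoning
    cross : (1 ℕ.* b ℕ.+ 1 ℕ.* a) ℕ.* c ℕ.≤ 1 ℕ.* (a ℕ.* b)
    cross = ℕ.≤-trans
      (ℕ.≤-reflexive (cong (ℕ._* c) (cong₂ ℕ._+_ (ℕ.*-identityˡ b) (ℕ.*-identityˡ a))))
      (ℕ.≤-trans le (ℕ.≤-reflexive (sym (ℕ.*-identityˡ (a ℕ.* b)))))

  telescope : ∀ s k → 1 ℕ.< s → ζ-term s (suc k) ℚ.+ 1/ suc (suc k) ℚ.≤ 1/ suc k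
  telescope s k 1<s =
    unitFractions a (suc (suc k)) (suc k) ⦃ ℕ.m^n≢0 (suc (suc k)) s ⦄ (begin
      (suc (suc k) ℕ.+ a) ℕ.* suc k
        ≡⟨ ℕ.*-distribʳ-+ (suc k) (suc (suc k)) a ⟩
      suc (suc k) ℕ.* suc k ℕ.+ a ℕ.* suc k
        ≤⟨ ℕ.+-monoˡ-≤ (a ℕ.* suc k) (ℕ.≤-trans square (ℕ.^-monoʳ-≤ (suc (suc k)) 1<s)) ⟩
      a ℕ.+ a ℕ.* suc k
        ≡⟨ sym (ℕ.*-suc a (suc k)) ⟩
      a ℕ.* suc (suc k) ∎)
    where
    open ℕ.≤-Reasoning
    a = suc (suc k) ^ s
    square : suc (suc k) ℕ.* suc k ℕ.≤ suc (suc k) ^ 2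
    square = subst (suc (suc k) ℕ.* suc k ℕ.≤_)
      (cong (suc (suc k) ℕ.*_) (sym (ℕ.*-identityʳ (suc (suc k)))))
      (ℕ.*-monoʳ-≤ (suc (suc k)) (ℕ.n≤1+n (suc k)))

  increasing : ∀ s {i j} → i ℕ.≤′ j → ζ-partial s i ℚ.≤ ζ-partial s j
  increasing s ℕ.≤′-refl = ℚ.≤-refl
  increasing s {i} {suc j} (ℕ.≤′-step i≤j) = ℚ.≤-trans (increasing s i≤j)
    (subst (ℚ._≤ ζ-partial s (suc j)) (ℚ.+-identityʳ (ζ-partial s j))
      (ℚ.+-monoʳ-≤ (ζ-partial s j)
        (ℚ.<⇒≤ (0<1/ (suc j ^ s) ⦃ ℕ.m^n≢0 (suc j) s ⦄))))

  decreasing : ∀ s {i j} → 1 ℕ.< s → i ℕ.≤′ j →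
    ζ-partial s (suc j) ℚ.+ 1/ suc j ℚ.≤ ζ-partial s (suc i) ℚ.+ 1/ suc i
  decreasing s 1<s ℕ.≤′-refl = ℚ.≤-refl
  decreasing s {i} {suc j} 1<s (ℕ.≤′-step i≤j) = ℚ.≤-trans
    (subst (ℚ._≤ ζ-partial s (suc j) ℚ.+ 1/ suc j)
      (sym (ℚ.+-assoc (ζ-partial s (suc j)) (ζ-term s (suc j)) (1/ suc (suc j))))
      (ℚ.+-monoʳ-≤ (ζ-partial s (suc j)) (telescope s j 1<s)))
    (decreasing s 1<s i≤j)

  archimedean : ∀ ε → 0ℚ ℚ.< ε → ∃[ N ] (1/ suc N ℚ.< ε)
  archimedean ε@(mkℚ (+ zero) d cop) 0<ε =
    ⊥-elim (ℤ.<-irrefl refl (ℚ.drop-*<* 0<ε))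
  archimedean ε@(mkℚ (+ suc n) d cop) 0<ε = suc d , ℚ.toℚᵘ-cancel-< (begin-strict
    ℚ.toℚᵘ (1/ suc (suc d))     ≃⟨ ℚ.toℚᵘ-fromℚᵘ (ℚᵘ.mkℚᵘ (+ 1) (suc d)) ⟩
    ℚᵘ.mkℚᵘ (+ 1) (suc d)       <⟨ ℚᵘ.*<* (ℤ.+<+ cross) ⟩
    ℚ.toℚᵘ ε                    ∎)
    where
    open ℚᵘ.≤-Reasoning
    cross : 1 ℕ.* suc d ℕ.< suc n ℕ.* suc (suc d)
    cross = ℕ.≤-trans
      (ℕ.s≤s (ℕ.≤-reflexive (ℕ.*-identityˡ (suc d))))
      (ℕ.m≤m+n (suc (suc d)) (n ℕ.* suc (suc d)))
  archimedean (mkℚ (ℤ.-[1+ n ]) d cop) (ℚ.*<* ())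

  ζ-tail : ∀ s {i j} → 1 ℕ.< s → i ℕ.≤ j →
    ℚ.∣ ζ-partial s (suc j) ℚ.- ζ-partial s (suc i) ∣ ℚ.≤ 1/ suc i
  ζ-tail s {i} {j} 1<s i≤j = subst (ℚ._≤ 1/ suc i) (sym (ℚ.0≤p⇒∣p∣≡p 0≤Δ))
    (p≤q+r⇒p-r≤q (begin
      b                 ≡⟨ sym (ℚ.+-identityʳ b) ⟩
      b ℚ.+ 0ℚ          ≤⟨ ℚ.+-monoʳ-≤ b (ℚ.<⇒≤ (0<1/ (suc j))) ⟩
      b ℚ.+ 1/ suc j    ≤⟨ decreasing s 1<s (ℕ.≤⇒≤′ i≤j) ⟩
      a ℚ.+ 1/ suc i    ≡⟨ ℚ.+-comm a (1/ suc i) ⟩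
      1/ suc i ℚ.+ a    ∎))
    where
    open ℚ.≤-Reasoning
    a = ζ-partial s (suc i)
    b = ζ-partial s (suc j)
    0≤Δ : 0ℚ ℚ.≤ b ℚ.- a
    0≤Δ = subst (ℚ._≤ b ℚ.- a) (ℚ.+-inverseʳ a)
      (ℚ.+-monoˡ-≤ (ℚ.- a) (increasing s (ℕ.≤⇒≤′ (ℕ.s≤s i≤j))))

  1/-antimono : ∀ {m n} → m ℕ.≤ n → 1/ suc n ℚ.≤ 1/ suc m
  1/-antimono {m} {n} m≤n = ℚ.toℚᵘ-cancel-≤ (begin
    ℚ.toℚᵘ (1/ suc n)   ≃⟨ ℚ.toℚᵘ-fromℚᵘ (ℚᵘ.mkℚᵘ (+ 1) n) ⟩
    ℚᵘ.mkℚᵘ (+ 1) n     ≤⟨ ℚᵘ.*≤* (ℤ.+≤+ (ℕ.*-monoʳ-≤ 1 (ℕ.s≤s m≤n))) ⟩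
    ℚᵘ.mkℚᵘ (+ 1) m     ≃⟨ ℚᵘ.≃-sym (ℚ.toℚᵘ-fromℚᵘ (ℚᵘ.mkℚᵘ (+ 1) m)) ⟩
    ℚ.toℚᵘ (1/ suc m)   ∎)
    where open ℚᵘ.≤-Reasoning

  ζ-cauchy : ∀ s → 1 ℕ.< s → Cauchy (ζ-partial s)
  ζ-cauchy s 1<s ε 0<ε with archimedean ε 0<ε
  ... | N , small = suc N , estimate
    where
    estimate : ∀ i j → suc N ℕ.≤ i → suc N ℕ.≤ j →
      ℚ.∣ ζ-partial s i ℚ.- ζ-partial s j ∣ ℚ.< ε
    estimate (suc i) (suc j) (ℕ.s≤s N≤i) (ℕ.s≤s N≤j) with ℕ.≤-total i j
    ... | inj₁ i≤j = subst (ℚ._< ε)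
      (∣p-q∣≡∣q-p∣ (ζ-partial s (suc j)) (ζ-partial s (suc i)))
      (ℚ.≤-<-trans (ℚ.≤-trans (ζ-tail s 1<s i≤j) (1/-antimono N≤i)) small)
    ... | inj₂ j≤i =
      ℚ.≤-<-trans (ℚ.≤-trans (ζ-tail s 1<s j≤i) (1/-antimono N≤j)) small

ζ : (s : ℕ) → 1 ℕ.< s → ℝ
ζ s 1<s = mkℝ (ζ-partial s) (ζ-cauchy s 1<s)

0<∣ζ∣ : ∀ s (1<s : 1 ℕ.< s) → 0ℝ <ℝ ∣ ζ s 1<s ∣ℝ
0<∣ζ∣ s 1<s = δ , 0<δ , 1 , λ k 1≤k → begin
  0ℚ ℚ.+ δ              ≤⟨ increasing s (ℕ.≤⇒≤′ 1≤k) ⟩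
  ζ-partial s k         ≡⟨ sym (ℚ.0≤p⇒∣p∣≡p (increasing s (ℕ.≤⇒≤′ (ℕ.z≤n {k})))) ⟩
  ℚ.∣ ζ-partial s k ∣   ∎
  where
  open ℚ.≤-Reasoning
  δ = ζ-term s 0
  0<δ : 0ℚ ℚ.< δ
  0<δ = 0<1/ (1 ^ s) ⦃ ℕ.m^n≢0 1 s ⦄

1/ζ : (s : ℕ) → 1 ℕ.< s → ℝ
1/ζ s 1<s = ζ s 1<s ⁻¹[ 0<∣ζ∣ s 1<s ]

1<m∸i : ∀ {n m} → n ℕ.< m → (i : Fin n) → 1 ℕ.< m ∸ toℕ i
1<m∸i n<m i = ℕ.m+n≤o⇒m≤o∸n 2 (ℕ.≤-trans (ℕ.s≤s (toℕ<n i)) n<m)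

HasCardinality : {A : Set} → Pred A 0ℓ → ℕ → Set
HasCardinality {A} P c =
  Σ[ xs ∈ List A ] (length xs ≡ c) × Unique xs × (∀ x → (x ∈ xs) ⇔ P x)

Box : ∀ {d} → ℕ → Pred (Vec ℤ d) 0ℓ
Box B = All (λ z → (ℤ.- (+ B) ℤ.≤ z) × (z ℤ.< + B))

-- The sequence indexed by B = 1, 2, … is written with B = suc b.
proportion : ℕ → (ℕ → ℕ) → ℕ → ℚ
proportion d count b =
  (+ count (suc b) ℚ./ (2 ℕ.* suc b) ^ d) ⦃ ℕ.m^n≢0 (2 ℕ.* suc b) d ⦄

HasDensity : ∀ {d} → Pred (Vec ℤ d) 0ℓ → ℝ → Set
HasDensity {d} S ρ = Σ[ count ∈ (ℕ → ℕ) ]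
  (∀ b → HasCardinality (S ∩ Box (suc b)) (count (suc b))) ×
  ((λ b → fromℚ (proportion d count b)) ⟶ ρ)

Matrix : ℕ → ℕ → Set
Matrix n m = Vec (Vec ℤ m) n

det : ∀ {n} → Matrix n n → ℤ
det {zero}  []       = 1ℤ
det {suc n} (r ∷ rs) = sum ℤ.+-*-semiring λ j →
  (-1ℤ ℤ.^ toℕ j) ℤ.* lookup r j ℤ.* det (map (λ row → removeAt row j) rs)

RectangularUnimodular : ∀ {n m} → n ℕ.< m → Pred (Matrix n m) 0ℓ
RectangularUnimodular {n} {m} n<m M = Σ[ R ∈ Matrix (m ∸ n) m ]
  Invertible _≡_ 1ℤ ℤ._*_ (det (cast (ℕ.m+[n∸m]≡n (ℕ.<⇒≤ n<m)) (M ++ R)))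

-- The subset of ℤⁿᵐ corresponding to a set of matrices, entries read row by row
Entrywise : ∀ {n m} → Pred (Matrix n m) 0ℓ → Pred (Vec ℤ (n ℕ.* m)) 0ℓ
Entrywise {n} {m} P v = Σ[ M ∈ Matrix n m ] (v ≡ concat M) × P M

{-# OPTIONS --safe #-}

-- A matrix is unimodular exactly when column operations bring it to an echelon form with unit
-- pivots; replacing "unit" by "coprime to q" gives unimodularity modulo q, a q-periodic condition.
-- Its density is found row by row: once the first row is primitive modulo q, shears move it to
-- (g, 0, …, 0), and what remains is a smaller matrix. So the density for q = k! is a product of
-- densities of primitive vectors, and sorting the vectors modulo (k!)² by their gcd shows that the
-- density of primitive vectors in dimension s is Σ_{d ≤ k} 1/dˢ inverted, up to an error 1/k.
--
-- A matrix that is unimodular modulo k! but not over ℤ has dependent rows modulo some prime p > k.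
-- Counting matrices annihilated by a vector modulo p makes the primes k < p ≤ b contribute a
-- proportion O(Σ 1/p²) = O(1/k) of the box of radius b. The primes p > b contribute O(1/b), by
-- induction on the number of rows (Ekedahl's argument): the entries below the first row and
-- right of the first column determine a nonzero integer vector w orthogonal to them, p divides
-- the scalar product of w with the first row, which has boundedly many prime factors above b, and
-- for each of them the first column is confined to a hyperplane modulo p.

module Submission where

open import Defs
open import Data.Empty using (⊥; ⊥-elim)
open import Data.Integer.Base as ℤ using (ℤ; +_)
import Data.Integer.Properties as ℤ
import Data.Integer.Tactic.RingSolver as ℤ
open import Data.Product.Base using (∃-syntax; Σ-syntax; _×_; _,_; proj₁; proj₂; uncurry)
open import Data.Sum.Base using (_⊎_; inj₁; inj₂)
open import Data.Unit.Base using (⊤; tt)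
open import Data.Vec.Base as Vec using (Vec; []; _∷_; head; tail; map; replicate; zipWith)
open import Data.Vec.Relation.Binary.Pointwise.Inductive as Pointwise using (Pointwise; []; _∷_)
open import Data.Vec.Relation.Unary.All as All using (All; []; _∷_)
open import Function.Base using (_∘_; id; flip)
open import Relation.Binary.PropositionalEquality
open import Relation.Nullary using (¬_; Dec; yes; no)
open import Relation.Nullary.Negation using (contradiction)

-- The echelon form is computed by Euclidean division on integers, so congruent matrices are reduced
-- by unrelated shears and the periodicity of `UnimodularMod q` is not visible in its definition.
-- `Deficient p`, a relation between the rows modulo a prime `p`, is the invariant substitute: for
-- at most as many rows as columns, unimodularity modulo `q` fails exactly when some prime divisor
-- of `q` carries such a relation. The integral case is `q = 0`, which every prime divides.
--
-- The modulus is the square of k! so that a division is possible: after dividing out a gcd d ≤ k,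
-- the vectors live modulo (k!)²/d, still a multiple of k!, and whole periods remain to be counted.
--
-- For n rows, relations modulo p are normalised to leading coefficient 1. This leaves O(p^(n-1)) of
-- them, each satisfied by a proportion of about p^(-m) of the matrices, and n < m gives 1/p².
-- Without the normalisation m = n + 1 would only give 1/p, whose sum over primes diverges. The
-- count breaks down for primes beyond the box, because a residue class is charged at least one
-- point however large p is; hence the separate argument there.

-- Determinants as alternating multilinear functions of the columns

module Determinant where

  import Algebra.Properties.Semiring.Sum as Sum
  open import Data.Fin.Base using (Fin; zero; suc; toℕ)
  open import Data.Integer.Base using (0ℤ; 1ℤ; -1ℤ; _+_; _*_; _-_; -_; _^_)
  open import Data.Integer.Properties using (+-*-semiring; *-identityˡ; *-zeroʳ; +-identityʳ; -1*i≡-i)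
  open import Data.Integer.Tactic.RingSolver using (solve-∀)
  open import Data.Nat.Base using (zero; suc)
  open import Data.Vec.Base using (lookup; removeAt)
  open import Data.Vec.Properties using (map-cong; map-∘)

  open ≡-Reasoning
  open Sum +-*-semiring using (sum; sum-cong-≗; *-distribˡ-sum)

  infixl 6 _⊕_
  infixl 7 _⊛_

  _⊕_ : ∀ {n} → Vec ℤ n → Vec ℤ n → Vec ℤ n
  _⊕_ = zipWith _+_

  _⊛_ : ∀ {n} → ℤ → Vec ℤ n → Vec ℤ n
  k ⊛ v = map (k *_) v

  columns : ∀ {n m} → Matrix n m → Matrix m n
  columns {m = zero}  M = []
  columns {m = suc m} M = map head M ∷ columns (map tail M)

  -- Expansion along the first row, with an arbitrary `φ` in place of the minor. Passing over a
  -- column amounts to the same expansion with its tail stored inside `φ`, and the nested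
  -- subtractions produce the signs.
  laplace : ∀ {n k} → (Matrix n k → ℤ) → Matrix (suc n) (suc k) → ℤ
  laplace {zero}  φ (c ∷ [])     = head c * φ []
  laplace {suc n} φ (c ∷ cs) =
    head c * φ (map tail cs) - laplace (λ zs → φ (tail c ∷ zs)) cs

  detᶜ : ∀ {n} → Matrix n n → ℤ
  detᶜ {zero}  cs = 1ℤ
  detᶜ {suc n} cs = laplace detᶜ cs

  map-tail-columns : ∀ {n m} (r : Vec ℤ m) (rs : Matrix n m) →
    map tail (columns (r ∷ rs)) ≡ columns rs
  map-tail-columns []      rs = refl
  map-tail-columns (x ∷ r) rs = cong (map head rs ∷_) (map-tail-columns r (map tail rs))

  laplace-cong : ∀ {n k} {φ ψ : Matrix n k → ℤ} → (∀ zs → φ zs ≡ ψ zs) → ∀ cs →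
    laplace φ cs ≡ laplace ψ cs
  laplace-cong {zero}  eq (c ∷ []) = cong (head c *_) (eq [])
  laplace-cong {suc n} eq (c ∷ cs) =
    cong₂ (λ a b → head c * a - b) (eq (map tail cs)) (laplace-cong (λ zs → eq (tail c ∷ zs)) cs)

  removeAt-columns : ∀ {n k} (j : Fin (suc n)) (rs : Matrix k (suc (suc n))) →
    columns (map (λ r → removeAt r (suc j)) rs) ≡
    map head rs ∷ columns (map (λ r → removeAt r j) (map tail rs))
  removeAt-columns j rs = cong₂ (λ a M → a ∷ columns M)
    (trans (sym (map-∘ head _ rs)) (map-cong (λ { (_ ∷ _ ∷ _) → refl }) rs))
    (trans (sym (map-∘ tail _ rs))
      (trans (map-cong (λ { (_ ∷ _ ∷ _) → refl }) rs) (map-∘ _ tail rs)))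

  -- The induction needs `φ` to vary: deleting any later column keeps the first one, which is
  -- absorbed into `φ` before the recursive call.
  laplace-sum : ∀ {n k} (φ : Matrix n k → ℤ) (r : Vec ℤ (suc n)) (rs : Matrix k (suc n)) →
    sum (λ j → (-1ℤ ^ toℕ j) * lookup r j * φ (columns (map (λ row → removeAt row j) rs))) ≡
    laplace φ (columns (r ∷ rs))
  laplace-sum {zero} φ (x ∷ []) rs =
    trans (+-identityʳ _) (cong (_* φ []) (*-identityˡ x))
  laplace-sum {suc n} φ (x ∷ r) rs = begin
    1ℤ * x * φ (columns (map (λ row → removeAt row zero) rs)) + sum (term φ (x ∷ r) rs)
      ≡⟨ cong₂ _+_ (cong₂ _*_ (*-identityˡ x) (cong φ first)) rest ⟩
    x * φ (map tail (columns (r ∷ map tail rs))) +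
      -1ℤ * laplace (λ zs → φ (map head rs ∷ zs)) (columns (r ∷ map tail rs))
      ≡⟨ cong (λ t → x * φ (map tail (columns (r ∷ map tail rs))) + t) (-1*i≡-i _) ⟩
    laplace φ (columns ((x ∷ r) ∷ rs)) ∎
    where
    term : (Matrix (suc n) _ → ℤ) → Vec ℤ (suc (suc n)) → Matrix _ (suc (suc n)) → Fin (suc n) → ℤ
    term φ r rs j = (-1ℤ ^ suc (toℕ j)) * lookup r (suc j) *
      φ (columns (map (λ row → removeAt row (suc j)) rs))

    first : columns (map (λ row → removeAt row zero) rs) ≡ map tail (columns (r ∷ map tail rs))
    first = trans (cong columns (map-cong (λ { (_ ∷ _) → refl }) rs))
      (sym (map-tail-columns r (map tail rs)))

    shape : ∀ a b c → (-1ℤ * a) * b * c ≡ -1ℤ * (a * b * c)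
    shape = solve-∀

    rest : sum (term φ (x ∷ r) rs) ≡
      -1ℤ * laplace (λ zs → φ (map head rs ∷ zs)) (columns (r ∷ map tail rs))
    rest = begin
      sum (term φ (x ∷ r) rs)
        ≡⟨ sum-cong-≗ (λ j → trans
             (cong (λ M → (-1ℤ ^ suc (toℕ j)) * lookup r j * φ M) (removeAt-columns j rs))
             (shape (-1ℤ ^ toℕ j) (lookup r j) _)) ⟩
      sum (λ j → -1ℤ * summand j)
        ≡⟨ *-distribˡ-sum -1ℤ summand ⟨
      -1ℤ * sum summand
        ≡⟨ cong (-1ℤ *_) (laplace-sum (λ zs → φ (map head rs ∷ zs)) r (map tail rs)) ⟩
      -1ℤ * laplace (λ zs → φ (map head rs ∷ zs)) (columns (r ∷ map tail rs)) ∎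
      where
      summand : Fin (suc n) → ℤ
      summand j = (-1ℤ ^ toℕ j) * lookup r j *
        φ (map head rs ∷ columns (map (λ row → removeAt row j) (map tail rs)))

  det≡detᶜ : ∀ {n} (M : Matrix n n) → det M ≡ detᶜ (columns M)
  det≡detᶜ []       = refl
  det≡detᶜ (r ∷ rs) = trans
    (sum-cong-≗ (λ j → cong ((-1ℤ ^ toℕ j) * lookup r j *_)
      (det≡detᶜ (map (λ row → removeAt row j) rs))))
    (laplace-sum detᶜ r rs)

  -- Only the first two columns are compared. Together with the recursion in
  -- `AlternatingMultilinear` this gives vanishing on equal neighbours, which suffices because
  -- shears mix only neighbouring columns.
  Alternates : ∀ {n k} → (Matrix n k → ℤ) → Set
  Alternates {zero}        φ = ⊤
  Alternates {suc zero}    φ = ⊤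
  Alternates {suc (suc n)} φ = ∀ c cs → φ (c ∷ c ∷ cs) ≡ 0ℤ

  AlternatingMultilinear : ∀ {n k} → (Matrix n k → ℤ) → Set
  AlternatingMultilinear {zero}  φ = ⊤
  AlternatingMultilinear {suc n} φ =
    (∀ a x y cs → φ ((x ⊕ a ⊛ y) ∷ cs) ≡ φ (x ∷ cs) + a * φ (y ∷ cs)) ×
    Alternates φ ×
    (∀ c → AlternatingMultilinear (λ cs → φ (c ∷ cs)))

  laplace-linear : ∀ {n k} a (φ ψ : Matrix n k → ℤ) cs →
    laplace (λ zs → φ zs + a * ψ zs) cs ≡ laplace φ cs + a * laplace ψ cs
  laplace-linear {zero} a φ ψ (c ∷ []) = identity (head c) (φ []) (ψ []) a
    where
    identity : ∀ x p q a → x * (p + a * q) ≡ x * p + a * (x * q)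
    identity = solve-∀
  laplace-linear {suc n} a φ ψ (c ∷ cs) = trans
    (cong (λ t → head c * (φ (map tail cs) + a * ψ (map tail cs)) - t)
      (laplace-linear a (λ zs → φ (tail c ∷ zs)) (λ zs → ψ (tail c ∷ zs)) cs))
    (identity (head c) (φ (map tail cs)) (ψ (map tail cs)) a _ _)
    where
    identity : ∀ x p q a s t →
      x * (p + a * q) - (s + a * t) ≡ (x * p - s) + a * (x * q - t)
    identity = solve-∀

  laplace-zero : ∀ {n k} (φ : Matrix n k → ℤ) → (∀ zs → φ zs ≡ 0ℤ) → ∀ cs → laplace φ cs ≡ 0ℤ
  laplace-zero {zero}  φ φ≡0 (c ∷ []) = trans (cong (head c *_) (φ≡0 [])) (*-zeroʳ (head c))
  laplace-zero {suc n} φ φ≡0 (c ∷ cs) = trans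
    (cong₂ (λ a b → head c * a - b) (φ≡0 (map tail cs))
      (laplace-zero (λ zs → φ (tail c ∷ zs)) (λ zs → φ≡0 (tail c ∷ zs)) cs))
    (cong (_- 0ℤ) (*-zeroʳ (head c)))

  head-⊕⊛ : ∀ {n} a (x y : Vec ℤ (suc n)) → head (x ⊕ a ⊛ y) ≡ head x + a * head y
  head-⊕⊛ a (_ ∷ _) (_ ∷ _) = refl

  tail-⊕⊛ : ∀ {n} a (x y : Vec ℤ (suc n)) → tail (x ⊕ a ⊛ y) ≡ tail x ⊕ a ⊛ tail y
  tail-⊕⊛ a (_ ∷ _) (_ ∷ _) = refl

  -- This is the shape that `laplace φ` takes once its first column is fixed, as the recursive
  -- component of `AlternatingMultilinear` requires.
  minor-combination : ∀ {n k} a (φ : Matrix n k → ℤ) (ψ : Matrix n (suc k) → ℤ) →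
    AlternatingMultilinear φ → AlternatingMultilinear ψ →
    AlternatingMultilinear (λ cs → a * φ (map tail cs) - ψ cs)
  minor-combination {zero} a φ ψ _ _ = tt
  minor-combination {suc n} a φ ψ (linφ , altφ , restφ) (linψ , altψ , restψ) =
    (λ b x y cs → trans
      (cong₂ (λ p q → a * p - q)
        (trans (cong (λ c → φ (c ∷ map tail cs)) (tail-⊕⊛ b x y))
          (linφ b (tail x) (tail y) (map tail cs)))
        (linψ b x y cs))
      (identity a b _ _ _ _)) ,
    alternates a φ ψ altφ altψ ,
    (λ c → minor-combination a _ _ (restφ (tail c)) (restψ c))
    where
    identity : ∀ a b p q s t →
      a * (p + b * q) - (s + b * t) ≡ (a * p - s) + b * (a * q - t)
    identity = solve-∀

    alternates : ∀ {n k} a (φ : Matrix (suc n) k → ℤ) (ψ : Matrix (suc n) (suc k) → ℤ) →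
      Alternates φ → Alternates ψ → Alternates (λ cs → a * φ (map tail cs) - ψ cs)
    alternates {zero}  a φ ψ _ _ = tt
    alternates {suc n} a φ ψ altφ altψ c cs = trans
      (cong₂ (λ p q → a * p - q) (altφ (tail c) (map tail cs)) (altψ c cs))
      (cong (_- 0ℤ) (*-zeroʳ a))

  laplace-alternating : ∀ {n k} (φ : Matrix n k → ℤ) →
    AlternatingMultilinear φ → AlternatingMultilinear (laplace φ)
  laplace-alternating {zero} φ _ =
    (λ { a x y [] → trans (cong (_* φ []) (head-⊕⊛ a x y))
           (identity (head x) (head y) a (φ [])) }) ,
    tt , (λ c → tt)
    where
    identity : ∀ x y a p → (x + a * y) * p ≡ x * p + a * (y * p)
    identity = solve-∀
  laplace-alternating {suc n} φ am@(linφ , altφ , restφ) =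
    linear , alternates φ altφ ,
    (λ c → minor-combination (head c) φ (laplace (λ zs → φ (tail c ∷ zs)))
      am (laplace-alternating _ (restφ (tail c))))
    where
    identity : ∀ x y a p s t → (x + a * y) * p - (s + a * t) ≡ (x * p - s) + a * (y * p - t)
    identity = solve-∀

    linear : ∀ a x y cs → laplace φ ((x ⊕ a ⊛ y) ∷ cs) ≡ laplace φ (x ∷ cs) + a * laplace φ (y ∷ cs)
    linear a x y cs = trans
      (cong₂ (λ h t → h * φ (map tail cs) - t) (head-⊕⊛ a x y)
        (trans (laplace-cong (λ zs → trans (cong (λ c → φ (c ∷ zs)) (tail-⊕⊛ a x y))
                   (linφ a (tail x) (tail y) zs)) cs)
          (laplace-linear a (λ zs → φ (tail x ∷ zs)) (λ zs → φ (tail y ∷ zs)) cs)))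
      (identity (head x) (head y) a (φ (map tail cs)) _ _)

    cancel : ∀ p → p - (p - 0ℤ) ≡ 0ℤ
    cancel = solve-∀

    alternates : ∀ {n k} (φ : Matrix (suc n) k → ℤ) → Alternates φ → Alternates (laplace φ)
    alternates {zero} φ _ c [] = identity₁ (head c) (φ (tail c ∷ []))
      where
      identity₁ : ∀ x p → x * p - x * p ≡ 0ℤ
      identity₁ = solve-∀
    -- With two equal leading columns the first two terms of the expansion cancel, and in the rest
    -- `φ` receives `tail c` twice.
    alternates {suc n} φ altφ c cs = trans
      (cong (λ t → head c * φ (tail c ∷ map tail cs) - (head c * φ (tail c ∷ map tail cs) - t))
        (laplace-zero (λ zs → φ (tail c ∷ tail c ∷ zs)) (λ zs → altφ (tail c) zs) cs))
      (cancel (head c * φ (tail c ∷ map tail cs)))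

  detᶜ-alternating : ∀ n → AlternatingMultilinear (detᶜ {n})
  detᶜ-alternating zero    = tt
  detᶜ-alternating (suc n) = laplace-alternating detᶜ (detᶜ-alternating n)

open Determinant

-- Integral column operations and the echelon form

module Shears where

  open import Data.Integer.Base using (0ℤ; 1ℤ; -1ℤ; ∣_∣; _+_; _*_; _-_; -_)
  import Data.Integer.DivMod as ℤ
  open import Data.Integer.Divisibility.Signed using (_∣_; ∣m∣n⇒∣m+n; ∣n⇒∣m*n)
  open import Data.Integer.Tactic.RingSolver using (solve-∀)
  open import Data.Nat.Base as ℕ using (ℕ; zero; suc)
  open import Data.Nat.Coprimality using (Coprime; coprime?)
  import Data.Nat.Properties as ℕ
  open import Data.Vec.Base using (cast; _++_)
  open import Data.Vec.Properties using (map-cong; map-∘; map-id; map-cast; map-++; cast-is-id)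
  open import Relation.Nullary.Decidable using (_×-dec_)

  open ≡-Reasoning

  infixl 5 _⨟_

  -- Operations are kept as syntax so that those found by reducing one row can be stored, inverted
  -- and replayed on other rows. Swaps and sign changes are left out, so determinants are preserved
  -- exactly.
  data Shear : ℕ → Set where
    idle  : ∀ {n} → Shear n
    left  : ∀ {n} → ℤ → Shear (suc (suc n))
    right : ∀ {n} → ℤ → Shear (suc (suc n))
    keep  : ∀ {n} → Shear n → Shear (suc n)
    _⨟_   : ∀ {n} → Shear n → Shear n → Shear n

  act : ∀ {n} → Shear n → Vec ℤ n → Vec ℤ n
  act idle      v            = v
  act (left k)  (x ∷ y ∷ v)  = x + k * y ∷ y ∷ v
  act (right k) (x ∷ y ∷ v)  = x ∷ y + k * x ∷ v
  act (keep o)  (x ∷ v)      = x ∷ act o v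
  act (o ⨟ o′)  v            = act o′ (act o v)

  actᶜ : ∀ {n k} → Shear n → Matrix n k → Matrix n k
  actᶜ idle      cs           = cs
  actᶜ (left k)  (x ∷ y ∷ cs) = x ⊕ k ⊛ y ∷ y ∷ cs
  actᶜ (right k) (x ∷ y ∷ cs) = x ∷ y ⊕ k ⊛ x ∷ cs
  actᶜ (keep o)  (c ∷ cs)     = c ∷ actᶜ o cs
  actᶜ (o ⨟ o′)  cs           = actᶜ o′ (actᶜ o cs)

  inverse : ∀ {n} → Shear n → Shear n
  inverse idle      = idle
  inverse (left k)  = left (- k)
  inverse (right k) = right (- k)
  inverse (keep o)  = keep (inverse o)
  inverse (o ⨟ o′)  = inverse o′ ⨟ inverse o

  private
    undo : ∀ x k y → (x + (- k) * y) + k * y ≡ x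
    undo = solve-∀

    undo′ : ∀ x k y → (x + k * y) + (- k) * y ≡ x
    undo′ = solve-∀

  act-inverse : ∀ {n} (o : Shear n) v → act o (act (inverse o) v) ≡ v
  act-inverse idle      v           = refl
  act-inverse (left k)  (x ∷ y ∷ v) = cong (λ t → t ∷ y ∷ v) (undo x k y)
  act-inverse (right k) (x ∷ y ∷ v) = cong (λ t → x ∷ t ∷ v) (undo y k x)
  act-inverse (keep o)  (x ∷ v)     = cong (x ∷_) (act-inverse o v)
  act-inverse (o ⨟ o′)  v           =
    trans (cong (act o′) (act-inverse o (act (inverse o′) v))) (act-inverse o′ v)

  inverse-act : ∀ {n} (o : Shear n) v → act (inverse o) (act o v) ≡ v
  inverse-act idle      v           = refl
  inverse-act (left k)  (x ∷ y ∷ v) = cong (λ t → t ∷ y ∷ v) (undo′ x k y)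
  inverse-act (right k) (x ∷ y ∷ v) = cong (λ t → x ∷ t ∷ v) (undo′ y k x)
  inverse-act (keep o)  (x ∷ v)     = cong (x ∷_) (inverse-act o v)
  inverse-act (o ⨟ o′)  v           =
    trans (cong (act (inverse o)) (inverse-act o′ (act o v))) (inverse-act o v)

  act-⊕ : ∀ {n} (o : Shear n) v w → act o (v ⊕ w) ≡ act o v ⊕ act o w
  act-⊕ idle      v           w             = refl
  act-⊕ (left k)  (x ∷ y ∷ v) (x′ ∷ y′ ∷ w) = cong (_∷ _) (identity x y x′ y′ k)
    where
    identity : ∀ x y x′ y′ k → (x + x′) + k * (y + y′) ≡ (x + k * y) + (x′ + k * y′)
    identity = solve-∀
  act-⊕ (right k) (x ∷ y ∷ v) (x′ ∷ y′ ∷ w) =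
    cong (λ t → x + x′ ∷ t ∷ _) (identity y x y′ x′ k)
    where
    identity : ∀ x y x′ y′ k → (x + x′) + k * (y + y′) ≡ (x + k * y) + (x′ + k * y′)
    identity = solve-∀
  act-⊕ (keep o)  (x ∷ v)     (x′ ∷ w)      = cong (x + x′ ∷_) (act-⊕ o v w)
  act-⊕ (o ⨟ o′)  v           w             =
    trans (cong (act o′) (act-⊕ o v w)) (act-⊕ o′ (act o v) (act o w))

  act-⊛ : ∀ {n} (o : Shear n) a v → act o (a ⊛ v) ≡ a ⊛ act o v
  act-⊛ idle      a v           = refl
  act-⊛ (left k)  a (x ∷ y ∷ v) = cong (_∷ _) (identity a x y k)
    where
    identity : ∀ a x y k → a * x + k * (a * y) ≡ a * (x + k * y)
    identity = solve-∀
  act-⊛ (right k) a (x ∷ y ∷ v) = cong (λ t → a * x ∷ t ∷ _) (identity a y x k)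
    where
    identity : ∀ a x y k → a * x + k * (a * y) ≡ a * (x + k * y)
    identity = solve-∀
  act-⊛ (keep o)  a (x ∷ v)     = cong (a * x ∷_) (act-⊛ o a v)
  act-⊛ (o ⨟ o′)  a v           = trans (cong (act o′) (act-⊛ o a v)) (act-⊛ o′ a (act o v))

  act-∣ : ∀ {n d} (o : Shear n) {v} → All (d ∣_) v → All (d ∣_) (act o v)
  act-∣ idle      ds            = ds
  act-∣ (left k)  (p ∷ q ∷ ds)  = ∣m∣n⇒∣m+n p (∣n⇒∣m*n k q) ∷ q ∷ ds
  act-∣ (right k) (p ∷ q ∷ ds)  = p ∷ ∣m∣n⇒∣m+n q (∣n⇒∣m*n k p) ∷ ds
  act-∣ (keep o)  (p ∷ ds)      = p ∷ act-∣ o ds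
  act-∣ (o ⨟ o′)  ds            = act-∣ o′ (act-∣ o ds)

  act-∣⁻ : ∀ {n d} (o : Shear n) {v} → All (d ∣_) (act o v) → All (d ∣_) v
  act-∣⁻ o {v} ds = subst (All _) (inverse-act o v) (act-∣ (inverse o) ds)

  columns-act : ∀ {n m} (o : Shear m) (M : Matrix n m) →
    columns (map (act o) M) ≡ actᶜ o (columns M)
  columns-act idle     M = cong columns (map-id M)
  columns-act (left k) M = cong₂ _∷_ (first M) (cong₂ (λ c N → c ∷ columns N) (second M) (others M))
    where
    first : ∀ {n m} (M : Matrix n (suc (suc m))) →
      map head (map (act (left k)) M) ≡ map head M ⊕ k ⊛ map head (map tail M)
    first []                = refl
    first ((x ∷ y ∷ v) ∷ M) = cong (_ ∷_) (first M)
    second : ∀ {n m} (M : Matrix n (suc (suc m))) →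
      map head (map tail (map (act (left k)) M)) ≡ map head (map tail M)
    second []                = refl
    second ((x ∷ y ∷ v) ∷ M) = cong (_ ∷_) (second M)
    others : ∀ {n m} (M : Matrix n (suc (suc m))) →
      map tail (map tail (map (act (left k)) M)) ≡ map tail (map tail M)
    others []                = refl
    others ((x ∷ y ∷ v) ∷ M) = cong (_ ∷_) (others M)
  columns-act (right k) M = cong₂ _∷_ (first M) (cong₂ (λ c N → c ∷ columns N) (second M) (others M))
    where
    first : ∀ {n m} (M : Matrix n (suc (suc m))) → map head (map (act (right k)) M) ≡ map head M
    first []                = refl
    first ((x ∷ y ∷ v) ∷ M) = cong (_ ∷_) (first M)
    second : ∀ {n m} (M : Matrix n (suc (suc m))) →
      map head (map tail (map (act (right k)) M)) ≡ map head (map tail M) ⊕ k ⊛ map head M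
    second []                = refl
    second ((x ∷ y ∷ v) ∷ M) = cong (_ ∷_) (second M)
    others : ∀ {n m} (M : Matrix n (suc (suc m))) →
      map tail (map tail (map (act (right k)) M)) ≡ map tail (map tail M)
    others []                = refl
    others ((x ∷ y ∷ v) ∷ M) = cong (_ ∷_) (others M)
  columns-act (keep o) M = cong₂ _∷_ (heads M) (trans (cong columns (tails M)) (columns-act o (map tail M)))
    where
    heads : ∀ {n m} {o : Shear m} (M : Matrix n (suc m)) → map head (map (act (keep o)) M) ≡ map head M
    heads []            = refl
    heads ((x ∷ v) ∷ M) = cong (x ∷_) (heads M)
    tails : ∀ {n m} {o : Shear m} (M : Matrix n (suc m)) →
      map tail (map (act (keep o)) M) ≡ map (act o) (map tail M)
    tails []            = refl
    tails ((x ∷ v) ∷ M) = cong (_ ∷_) (tails M)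
  columns-act (o ⨟ o′) M = trans (cong columns (map-∘ (act o′) (act o) M))
    (trans (columns-act o′ (map (act o) M)) (cong (actᶜ o′) (columns-act o M)))

  alternating-act : ∀ {n k} (φ : Matrix n k → ℤ) → AlternatingMultilinear φ →
    (o : Shear n) → ∀ cs → φ (actᶜ o cs) ≡ φ cs
  alternating-act φ am idle cs = refl
  alternating-act φ (lin , alt , rest) (left k) (x ∷ y ∷ cs) = begin
    φ (x ⊕ k ⊛ y ∷ y ∷ cs)              ≡⟨ lin k x y (y ∷ cs) ⟩
    φ (x ∷ y ∷ cs) + k * φ (y ∷ y ∷ cs)  ≡⟨ cong (λ t → φ (x ∷ y ∷ cs) + k * t) (alt y cs) ⟩
    φ (x ∷ y ∷ cs) + k * 0ℤ              ≡⟨ identity (φ (x ∷ y ∷ cs)) k ⟩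
    φ (x ∷ y ∷ cs)                       ∎
    where
    identity : ∀ a k → a + k * 0ℤ ≡ a
    identity = solve-∀
  alternating-act φ (lin , alt , rest) (right k) (x ∷ y ∷ cs) = begin
    φ (x ∷ y ⊕ k ⊛ x ∷ cs)              ≡⟨ proj₁ (rest x) k y x cs ⟩
    φ (x ∷ y ∷ cs) + k * φ (x ∷ x ∷ cs)  ≡⟨ cong (λ t → φ (x ∷ y ∷ cs) + k * t) (alt x cs) ⟩
    φ (x ∷ y ∷ cs) + k * 0ℤ              ≡⟨ identity (φ (x ∷ y ∷ cs)) k ⟩
    φ (x ∷ y ∷ cs)                       ∎
    where
    identity : ∀ a k → a + k * 0ℤ ≡ a
    identity = solve-∀
  alternating-act φ (lin , alt , rest) (keep o) (c ∷ cs) =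
    alternating-act (λ zs → φ (c ∷ zs)) (rest c) o cs
  alternating-act φ am (o ⨟ o′) cs =
    trans (alternating-act φ am o′ (actᶜ o cs)) (alternating-act φ am o cs)

  det-act : ∀ {n} (o : Shear n) (M : Matrix n n) → det (map (act o) M) ≡ det M
  det-act {n} o M = begin
    det (map (act o) M)             ≡⟨ det≡detᶜ (map (act o) M) ⟩
    detᶜ (columns (map (act o) M))  ≡⟨ cong detᶜ (columns-act o M) ⟩
    detᶜ (actᶜ o (columns M))       ≡⟨ alternating-act detᶜ (detᶜ-alternating n) o (columns M) ⟩
    detᶜ (columns M)                ≡⟨ det≡detᶜ M ⟨
    det M                           ∎

  euclid : ∀ {n} (x y : ℤ) →
    Σ[ o ∈ Shear (suc (suc n)) ] Σ[ g ∈ ℤ ] (∀ v → act o (x ∷ y ∷ v) ≡ g ∷ 0ℤ ∷ v)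
  euclid {n} x y = go x y (suc ∣ y ∣) ℕ.≤-refl
    where
    identity₁ : ∀ r q y → (r + q * y) + (- q) * y ≡ r
    identity₁ = solve-∀
    identity₂ : ∀ y → y + (-1ℤ) * (0ℤ + 1ℤ * y) ≡ 0ℤ
    identity₂ = solve-∀
    identity₃ : ∀ y → 0ℤ + 1ℤ * y ≡ y
    identity₃ = solve-∀

    remainder : ∀ a b .⦃ _ : ℤ.NonZero b ⦄ → a + (- (a ℤ./ b)) * b ≡ + (a ℤ.% b)
    remainder a b = trans (cong (λ t → t + (- (a ℤ./ b)) * b) (ℤ.a≡a%n+[a/n]*n a b))
      (identity₁ (+ (a ℤ.% b)) (a ℤ./ b) b)

    go : ∀ x y N → ∣ y ∣ ℕ.< N →
      Σ[ o ∈ Shear (suc (suc n)) ] Σ[ g ∈ ℤ ] (∀ v → act o (x ∷ y ∷ v) ≡ g ∷ 0ℤ ∷ v)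
    go x y (suc N) (ℕ.s≤s ∣y∣≤N) with y ℤ.≟ 0ℤ
    ... | yes y≡0 = idle , x , (λ v → cong (λ t → x ∷ t ∷ v) y≡0)
    ... | no  y≢0 = step (x ℤ.% y) (remainder x y) (ℤ.n%d<d x y)
      where
      instance _ = ℤ.≢-nonZero y≢0
      q = x ℤ./ y
      step : ∀ r → x + (- q) * y ≡ + r → r ℕ.< ∣ y ∣ →
        Σ[ o ∈ Shear (suc (suc n)) ] Σ[ g ∈ ℤ ] (∀ v → act o (x ∷ y ∷ v) ≡ g ∷ 0ℤ ∷ v)
      -- The pair has become (0, y); it passes through (y, y) to (y, 0), which replaces a swap.
      step zero eq _ = left (- q) ⨟ left 1ℤ ⨟ right -1ℤ , y , λ v →
        trans (cong (λ t → t + 1ℤ * y ∷ y + -1ℤ * (t + 1ℤ * y) ∷ v) eq)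
          (cong₂ (λ a b → a ∷ b ∷ v) (identity₃ y) (identity₂ y))
      step r@(suc _) eq r<y with go (+ r) (+ (y ℤ.% + r)) N (ℕ.<-≤-trans (ℤ.n%d<d y (+ r)) (ℕ.≤-trans (ℕ.<⇒≤ r<y) ∣y∣≤N))
      ... | o , g , reduces = left (- q) ⨟ right (- (y ℤ./ + r)) ⨟ o , g , λ v →
        trans (cong (act o) (trans (cong (λ t → t ∷ y + (- (y ℤ./ + r)) * t ∷ v) eq)
          (cong (λ t → + r ∷ t ∷ v) (remainder y (+ r))))) (reduces v)

  reduction : ∀ {m} (r : Vec ℤ (suc m)) →
    Σ[ o ∈ Shear (suc m) ] Σ[ g ∈ ℤ ] act o r ≡ g ∷ replicate m 0ℤ
  reduction (x ∷ [])        = idle , x , refl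
  reduction (x ∷ r@(_ ∷ _)) with reduction r
  ... | o , g , eq with euclid x g
  ...   | o′ , g′ , eq′ = keep o ⨟ o′ , g′ , trans (cong (λ t → act o′ (x ∷ t)) eq) (eq′ _)

  reducer : ∀ {m} → Vec ℤ (suc m) → Shear (suc m)
  reducer r = proj₁ (reduction r)

  -- The greatest common divisor of the entries.
  content : ∀ {m} → Vec ℤ (suc m) → ℕ
  content r = ∣ proj₁ (proj₂ (reduction r)) ∣

  project : ∀ {m} → Vec ℤ (suc m) → Vec ℤ (suc m) → Vec ℤ m
  project r = tail ∘ act (reducer r)

  -- Unimodularity modulo q, read off from the echelon form; q = 0 means over ℤ.
  UnimodularMod : ∀ {n m} → ℕ → Matrix n m → Set
  UnimodularMod         q []       = ⊤
  UnimodularMod {_} {zero}  q (r ∷ rs) = ⊥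
  UnimodularMod {_} {suc m} q (r ∷ rs) = Coprime (content r) q × UnimodularMod q (map (project r) rs)

  unimodularMod? : ∀ {n m} q (M : Matrix n m) → Dec (UnimodularMod q M)
  unimodularMod?              q []       = yes tt
  unimodularMod? {_} {zero}   q (r ∷ rs) = no id
  unimodularMod? {_} {suc m}  q (r ∷ rs) =
    coprime? (content r) q ×-dec unimodularMod? q (map (project r) rs)

  det-pivot : ∀ {n} g (rs : Matrix n (suc n)) →
    det ((g ∷ replicate n 0ℤ) ∷ rs) ≡ g * det (map tail rs)
  det-pivot {n} g rs = trans (det≡detᶜ ((g ∷ replicate n 0ℤ) ∷ rs)) (
    trans (lemma detᶜ g rs) (cong (g *_) (sym (det≡detᶜ (map tail rs)))))
    where
    zeros : ∀ {n k} (φ : Matrix n k → ℤ) (rs : Matrix k (suc n)) →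
      laplace φ (columns (replicate (suc n) 0ℤ ∷ rs)) ≡ 0ℤ
    zeros {zero}  φ rs = refl
    zeros {suc n} φ rs = trans
      (cong (λ t → 0ℤ * φ (map tail (columns (replicate (suc n) 0ℤ ∷ map tail rs))) - t)
        (zeros (λ zs → φ (map head rs ∷ zs)) (map tail rs)))
      (identity (φ (map tail (columns (replicate (suc n) 0ℤ ∷ map tail rs)))))
      where
      identity : ∀ a → 0ℤ * a - 0ℤ ≡ 0ℤ
      identity = solve-∀

    lemma : ∀ {n k} (φ : Matrix n k → ℤ) g (rs : Matrix k (suc n)) →
      laplace φ (columns ((g ∷ replicate n 0ℤ) ∷ rs)) ≡ g * φ (columns (map tail rs))
    lemma {zero}  φ g rs = refl
    lemma {suc n} φ g rs = trans
      (cong₂ (λ s t → g * φ s - t)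
        (map-tail-columns (replicate (suc n) 0ℤ) (map tail rs))
        (zeros (λ zs → φ (map head rs ∷ zs)) (map tail rs)))
      (identity (g * φ (columns (map tail rs))))
      where
      identity : ∀ a → a - 0ℤ ≡ a
      identity = solve-∀

  -- The operations reducing `r` act on the adjoined rows as well, and expanding along the reduced
  -- row leaves the projections of all other rows. Absolute values hide the sign of the pivot.
  det-reduce : ∀ {n k m} .(eq : suc n ℕ.+ k ≡ suc m) (r : Vec ℤ (suc m)) (rs : Matrix n (suc m)) (R : Matrix k (suc m)) →
    ∣ det (cast eq ((r ∷ rs) ++ R)) ∣ ≡
    content r ℕ.* ∣ det (cast (cong ℕ.pred eq) (map (project r) rs ++ map (project r) R)) ∣
  det-reduce {m = m} eq r rs R = begin
    ∣ det (r ∷ rest) ∣                                  ≡⟨ cong ∣_∣ (sym (det-act o (r ∷ rest))) ⟩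
    ∣ det (act o r ∷ map (act o) rest) ∣                ≡⟨ cong (λ v → ∣ det (v ∷ map (act o) rest) ∣) (proj₂ (proj₂ (reduction r))) ⟩
    ∣ det ((g ∷ replicate m 0ℤ) ∷ map (act o) rest) ∣   ≡⟨ cong ∣_∣ (det-pivot g (map (act o) rest)) ⟩
    ∣ g * det (map tail (map (act o) rest)) ∣           ≡⟨ ℤ.∣i*j∣≡∣i∣*∣j∣ g _ ⟩
    ∣ g ∣ ℕ.* ∣ det (map tail (map (act o) rest)) ∣     ≡⟨ cong (λ N → ∣ g ∣ ℕ.* ∣ det N ∣) projected ⟩
    ∣ g ∣ ℕ.* ∣ det (cast (cong ℕ.pred eq) (map (project r) rs ++ map (project r) R)) ∣ ∎
    where
    o = reducer r
    g = proj₁ (proj₂ (reduction r))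
    rest = cast (cong ℕ.pred eq) (rs ++ R)
    projected : map tail (map (act o) rest) ≡ cast (cong ℕ.pred eq) (map (project r) rs ++ map (project r) R)
    projected = trans (sym (map-∘ tail (act o) rest))
      (trans (map-cast (project r) (cong ℕ.pred eq) (rs ++ R))
        (cong (cast (cong ℕ.pred eq)) (map-++ (project r) rs R)))

  -- Completion to a square matrix of determinant ±1

  identityMatrix : ∀ n → Matrix n n
  identityMatrix zero    = []
  identityMatrix (suc n) = (1ℤ ∷ replicate n 0ℤ) ∷ map (0ℤ ∷_) (identityMatrix n)

  det-identity : ∀ n → det (identityMatrix n) ≡ 1ℤ
  det-identity zero    = refl
  det-identity (suc n) = begin
    det (identityMatrix (suc n))                          ≡⟨ det-pivot 1ℤ (map (0ℤ ∷_) (identityMatrix n)) ⟩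
    1ℤ * det (map tail (map (0ℤ ∷_) (identityMatrix n)))  ≡⟨ ℤ.*-identityˡ _ ⟩
    det (map tail (map (0ℤ ∷_) (identityMatrix n)))       ≡⟨ cong det (trans (sym (map-∘ tail (0ℤ ∷_) (identityMatrix n))) (map-id _)) ⟩
    det (identityMatrix n)                                ≡⟨ det-identity n ⟩
    1ℤ                                                    ∎

  -- By `det-reduce` the determinant is, up to sign, a product of natural numbers among which are
  -- all the contents; a product equal to 1 forces each factor to be 1.
  unit-det⇒unimodular : ∀ {n k m} .(eq : n ℕ.+ k ≡ m) (M : Matrix n m) (R : Matrix k m) →
    ∣ det (cast eq (M ++ R)) ∣ ≡ 1 → UnimodularMod 0 M
  unit-det⇒unimodular eq []  R unit = tt
  unit-det⇒unimodular {suc n} {k} {suc m} eq (r ∷ rs) R unit =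
    (λ {d} (d∣g , _) → ∣1⇒≡1 (subst (d ℕ∣_) (ℕ.m*n≡1⇒m≡1 (content r) rest product≡1) d∣g)) ,
    unit-det⇒unimodular (cong ℕ.pred eq) (map (project r) rs) (map (project r) R)
      (ℕ.m*n≡1⇒n≡1 (content r) rest product≡1)
    where
    open import Data.Nat.Divisibility using (∣1⇒≡1) renaming (_∣_ to _ℕ∣_)
    rest = ∣ det (cast (cong ℕ.pred eq) (map (project r) rs ++ map (project r) R)) ∣
    product≡1 : content r ℕ.* rest ≡ 1
    product≡1 = trans (sym (det-reduce eq r rs R)) unit

  -- Once all rows of `M` are used up, the identity matrix completes what is left. Going back, each
  -- adjoined row gets a leading 0 and the shear of `r` is undone. The contents are 1 because only 1
  -- is coprime to 0.
  unimodular⇒unit-det : ∀ {n k m} (eq : n ℕ.+ k ≡ m) (M : Matrix n m) → UnimodularMod 0 M →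
    Σ[ R ∈ Matrix k m ] ∣ det (cast eq (M ++ R)) ∣ ≡ 1
  unimodular⇒unit-det {zero} {k} {m} eq [] _ = complete k m eq
    where
    complete : ∀ k m (eq : k ≡ m) → Σ[ R ∈ Matrix k m ] ∣ det (cast eq R) ∣ ≡ 1
    complete k .k refl = identityMatrix k ,
      cong ∣_∣ (trans (cong det (cast-is-id refl (identityMatrix k))) (det-identity k))
  unimodular⇒unit-det {suc n} {k} {suc m} eq (r ∷ rs) (coprime , unimodular)
    with unimodular⇒unit-det (cong ℕ.pred eq) (map (project r) rs) unimodular
  ... | R , unit = map lift R , (begin
    ∣ det (cast eq ((r ∷ rs) ++ map lift R)) ∣
      ≡⟨ det-reduce eq r rs (map lift R) ⟩
    content r ℕ.* ∣ det (cast (cong ℕ.pred eq) (map (project r) rs ++ map (project r) (map lift R))) ∣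
      ≡⟨ cong₂ (λ a N → a ℕ.* ∣ det (cast (cong ℕ.pred eq) (map (project r) rs ++ N)) ∣)
           (coprime (∣-refl , _ ∣0)) unlift ⟩
    1 ℕ.* ∣ det (cast (cong ℕ.pred eq) (map (project r) rs ++ R)) ∣
      ≡⟨ trans (ℕ.*-identityˡ _) unit ⟩
    1 ∎)
    where
    open import Data.Nat.Divisibility using (∣-refl; _∣0)
    lift : Vec ℤ m → Vec ℤ (suc m)
    lift v = act (inverse (reducer r)) (0ℤ ∷ v)
    unlift : map (project r) (map lift R) ≡ R
    unlift = trans (sym (map-∘ (project r) lift R))
      (trans (map-cong (λ v → cong tail (act-inverse (reducer r) (0ℤ ∷ v))) R) (map-id R))

  unit⇒∣∣≡1 : ∀ x → ∃[ y ] (y * x ≡ 1ℤ) × (x * y ≡ 1ℤ) → ∣ x ∣ ≡ 1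
  unit⇒∣∣≡1 x (y , _ , xy) = ℕ.m*n≡1⇒m≡1 ∣ x ∣ ∣ y ∣ (trans (sym (ℤ.∣i*j∣≡∣i∣*∣j∣ x y)) (cong ∣_∣ xy))

  ∣∣≡1⇒unit : ∀ x → ∣ x ∣ ≡ 1 → ∃[ y ] (y * x ≡ 1ℤ) × (x * y ≡ 1ℤ)
  ∣∣≡1⇒unit (+ .1)        refl = 1ℤ , refl , refl
  ∣∣≡1⇒unit (ℤ.-[1+ .0 ]) refl = -1ℤ , refl , refl

  rectangular⇒unimodular : ∀ {n m} (n<m : n ℕ.< m) (M : Matrix n m) →
    RectangularUnimodular n<m M → UnimodularMod 0 M
  rectangular⇒unimodular n<m M (R , unit) = unit-det⇒unimodular (ℕ.m+[n∸m]≡n (ℕ.<⇒≤ n<m)) M R (unit⇒∣∣≡1 _ unit)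

  unimodular⇒rectangular : ∀ {n m} (n<m : n ℕ.< m) (M : Matrix n m) →
    UnimodularMod 0 M → RectangularUnimodular n<m M
  unimodular⇒rectangular n<m M u with unimodular⇒unit-det (ℕ.m+[n∸m]≡n (ℕ.<⇒≤ n<m)) M u
  ... | R , unit = R , ∣∣≡1⇒unit _ unit

open Shears

-- Relations between the rows modulo a prime

module Deficiency where

  open import Data.Integer.Base using (0ℤ; 1ℤ; _+_; _*_; _-_; -_)
  open import Data.Integer.Divisibility.Signed
  open import Data.Integer.Tactic.RingSolver using (solve-∀)
  open import Data.List.Base using ([]; _∷_)
  open import Data.List.Relation.Unary.All using ([]; _∷_)
  open import Data.Nat.Base as ℕ using (ℕ; zero; suc; s≤s)
  open import Data.Nat.Coprimality using (coprime?; gcd≡1⇒coprime)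
  import Data.Nat.Divisibility as ℕ
  open import Data.Nat.GCD using (gcd; gcd[m,n]∣m; gcd[m,n]∣n)
  open import Data.Nat.ListAction using (product)
  open import Data.Nat.Primality using (Prime; prime[2]; ¬prime[1]; euclidsLemma)
  open import Data.Nat.Primality.Factorisation using (PrimeFactorisation; factorise)
  open import Data.Vec.Properties using (map-∘)

  primeDivisor : ∀ n → n ≢ 1 → ∃[ p ] Prime p × p ℕ.∣ n
  -- The value 0 does occur: it is the gcd of the content of a zero row with `q = 0`.
  primeDivisor zero n≢1 = 2 , prime[2] , 2 ℕ.∣0
  primeDivisor n@(suc _) n≢1 with factorise n
  ... | record { factors = []; isFactorisation = eq } = ⊥-elim (n≢1 eq)
  ... | record { factors = p ∷ ps; isFactorisation = eq; factorsPrime = isPrime ∷ _ } =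
    p , isPrime , ℕ.divides (product ps) (trans eq (ℕ.*-comm p (product ps)))
    where import Data.Nat.Properties as ℕ

  prime∣* : ∀ {p} x y → Prime p → (+ p) ∣ x * y → (+ p) ∣ x ⊎ (+ p) ∣ y
  prime∣* {p} x y isPrime p∣xy
    with euclidsLemma ℤ.∣ x ∣ ℤ.∣ y ∣ isPrime (subst (p ℕ.∣_) (ℤ.∣i*j∣≡∣i∣*∣j∣ x y) (∣⇒∣ᵤ p∣xy))
  ... | inj₁ p∣x = inj₁ (∣ᵤ⇒∣ p∣x)
  ... | inj₂ p∣y = inj₂ (∣ᵤ⇒∣ p∣y)

  ∣1⇒⊥ : ∀ {p} → Prime p → ¬ (+ p) ∣ 1ℤ
  ∣1⇒⊥ isPrime p∣1 = ¬prime[1] (subst Prime (ℕ.∣1⇒≡1 (∣⇒∣ᵤ p∣1)) isPrime)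

  _∣0ℤ : ∀ d → d ∣ 0ℤ
  d ∣0ℤ = divides 0ℤ (sym (ℤ.*-zeroˡ d))

  comb : ∀ {n m} → Vec ℤ n → Matrix n m → Vec ℤ m
  comb {m = m} []       []       = replicate m 0ℤ
  comb         (c ∷ cs) (r ∷ rs) = c ⊛ r ⊕ comb cs rs

  act-0 : ∀ {n} (o : Shear n) → act o (replicate n 0ℤ) ≡ replicate n 0ℤ
  act-0 idle      = refl
  act-0 (left k)  = cong (_∷ _) (trans (ℤ.+-identityˡ (k * 0ℤ)) (ℤ.*-zeroʳ k))
  act-0 (right k) = cong (λ t → 0ℤ ∷ t ∷ _) (trans (ℤ.+-identityˡ (k * 0ℤ)) (ℤ.*-zeroʳ k))
  act-0 (keep o)  = cong (0ℤ ∷_) (act-0 o)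
  act-0 (o ⨟ o′)  = trans (cong (act o′) (act-0 o)) (act-0 o′)

  act-comb : ∀ {n m} (o : Shear m) (c : Vec ℤ n) M → act o (comb c M) ≡ comb c (map (act o) M)
  act-comb o []       []       = act-0 o
  act-comb o (c ∷ cs) (r ∷ rs) =
    trans (act-⊕ o (c ⊛ r) (comb cs rs)) (cong₂ _⊕_ (act-⊛ o c r) (act-comb o cs rs))

  tail-⊕ : ∀ {n} (x y : Vec ℤ (suc n)) → tail (x ⊕ y) ≡ tail x ⊕ tail y
  tail-⊕ (_ ∷ _) (_ ∷ _) = refl

  head-⊕ : ∀ {n} (x y : Vec ℤ (suc n)) → head (x ⊕ y) ≡ head x + head y
  head-⊕ (_ ∷ _) (_ ∷ _) = refl

  head-⊛ : ∀ {n} k (x : Vec ℤ (suc n)) → head (k ⊛ x) ≡ k * head x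
  head-⊛ k (_ ∷ _) = refl

  tail-⊛ : ∀ {n} k (x : Vec ℤ (suc n)) → tail (k ⊛ x) ≡ k ⊛ tail x
  tail-⊛ k (_ ∷ _) = refl

  tail-comb : ∀ {n m} (c : Vec ℤ n) (M : Matrix n (suc m)) → tail (comb c M) ≡ comb c (map tail M)
  tail-comb []       []       = refl
  tail-comb (c ∷ cs) (r ∷ rs) =
    trans (tail-⊕ (c ⊛ r) (comb cs rs)) (cong₂ _⊕_ (tail-⊛ c r) (tail-comb cs rs))

  comb-⊛ : ∀ {n m} k (c : Vec ℤ n) (M : Matrix n m) → comb (k ⊛ c) M ≡ k ⊛ comb c M
  comb-⊛ {m = m} k [] [] = zeros m
    where
    zeros : ∀ m → replicate m 0ℤ ≡ k ⊛ replicate m 0ℤ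
    zeros zero    = refl
    zeros (suc m) = cong₂ _∷_ (sym (ℤ.*-zeroʳ k)) (zeros m)
  comb-⊛ k (c ∷ cs) (r ∷ rs) = trans (cong ((k * c) ⊛ r ⊕_) (comb-⊛ k cs rs)) (distribute r (comb cs rs))
    where
    distribute : ∀ {m} (r v : Vec ℤ m) → (k * c) ⊛ r ⊕ k ⊛ v ≡ k ⊛ (c ⊛ r ⊕ v)
    distribute []      []      = refl
    distribute (x ∷ r) (y ∷ v) = cong₂ _∷_ (identity k c x y) (distribute r v)
      where
      identity : ∀ k c x y → (k * c) * x + k * y ≡ k * (c * x + y)
      identity = solve-∀

  All-∣-⊕ : ∀ {n d} {x y : Vec ℤ n} → All (d ∣_) x → All (d ∣_) y → All (d ∣_) (x ⊕ y)
  All-∣-⊕ {x = []}    {[]}    []       []       = []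
  All-∣-⊕ {x = _ ∷ _} {_ ∷ _} (p ∷ ps) (q ∷ qs) = ∣m∣n⇒∣m+n p q ∷ All-∣-⊕ ps qs

  All-∣-⊛ : ∀ {n d} k {x : Vec ℤ n} → All (d ∣_) x → All (d ∣_) (k ⊛ x)
  All-∣-⊛ k []       = []
  All-∣-⊛ k (p ∷ ps) = ∣n⇒∣m*n k p ∷ All-∣-⊛ k ps

  All-∣-⊛ʳ : ∀ {n d k} → d ∣ k → (x : Vec ℤ n) → All (d ∣_) (k ⊛ x)
  All-∣-⊛ʳ d∣k []      = []
  All-∣-⊛ʳ d∣k (x ∷ v) = ∣m⇒∣m*n x d∣k ∷ All-∣-⊛ʳ d∣k v

  All-∣-0 : ∀ {d} n → All (d ∣_) (replicate n 0ℤ)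
  All-∣-0 zero    = []
  All-∣-0 (suc n) = (_ ∣0ℤ) ∷ All-∣-0 n

  All-∣-comb : ∀ {n m d} {c : Vec ℤ n} → All (d ∣_) c → (M : Matrix n m) → All (d ∣_) (comb c M)
  All-∣-comb {m = m} []       []       = All-∣-0 m
  All-∣-comb         (p ∷ ps) (r ∷ rs) = All-∣-⊕ (All-∣-⊛ʳ p r) (All-∣-comb ps rs)

  All-∣-prime : ∀ {n p} g {x : Vec ℤ n} → Prime p → ¬ (+ p) ∣ g → All ((+ p) ∣_) (g ⊛ x) → All ((+ p) ∣_) x
  All-∣-prime g {[]}    isPrime p∤g []       = []
  All-∣-prime g {x ∷ v} isPrime p∤g (d ∷ ds) with prime∣* g x isPrime d
  ... | inj₁ p∣g = ⊥-elim (p∤g p∣g)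
  ... | inj₂ p∣x = p∣x ∷ All-∣-prime g isPrime p∤g ds

  All-head : ∀ {n} {P : ℤ → Set} {v : Vec ℤ (suc n)} → All P v → P (head v)
  All-head (p ∷ _) = p

  All-tail : ∀ {n} {P : ℤ → Set} {v : Vec ℤ (suc n)} → All P v → All P (tail v)
  All-tail (_ ∷ ps) = ps

  All-uncons : ∀ {n} {P : ℤ → Set} {v : Vec ℤ (suc n)} → P (head v) → All P (tail v) → All P v
  All-uncons {v = _ ∷ _} p ps = p ∷ ps

  pivot : ∀ {m} → Vec ℤ (suc m) → ℤ
  pivot r = proj₁ (proj₂ (reduction r))

  act-reducer : ∀ {m} (r : Vec ℤ (suc m)) → act (reducer r) r ≡ pivot r ∷ replicate m 0ℤ
  act-reducer r = proj₂ (proj₂ (reduction r))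

  ∣pivot⇒All-∣ : ∀ {m d} (r : Vec ℤ (suc m)) → d ∣ pivot r → All (d ∣_) r
  ∣pivot⇒All-∣ {m} r d∣g =
    act-∣⁻ (reducer r) (subst (All _) (sym (act-reducer r)) (d∣g ∷ All-∣-0 m))

  All-∣⇒∣pivot : ∀ {m d} (r : Vec ℤ (suc m)) → All (d ∣_) r → d ∣ pivot r
  All-∣⇒∣pivot r ds = All-head (subst (All _) (act-reducer r) (act-∣ (reducer r) ds))

  -- Linear dependence of the rows over the field with `p` elements, phrased over the integers so
  -- that it is compatible both with shears and with congruences.
  Deficient : ∀ {n m} → ℕ → Matrix n m → Set
  Deficient {n} p M = Σ[ c ∈ Vec ℤ n ] ¬ All ((+ p) ∣_) c × All ((+ p) ∣_) (comb c M)

  -- After the shears that reduce `r`, the first row contributes only to the pivot column. So a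
  -- relation either restricts to one between the projected rows, or has all later coefficients
  -- divisible by `p`; then `p` divides `c` times the pivot, although the pivot is coprime to `q`.
  unimodular⇒¬deficient : ∀ {n m q p} (M : Matrix n m) → Prime p → p ℕ.∣ q →
    UnimodularMod q M → ¬ Deficient p M
  unimodular⇒¬deficient [] isPrime p∣q _ ([] , ¬p∣c , _) = ¬p∣c []
  unimodular⇒¬deficient {m = suc m} {q} {p} (r ∷ rs) isPrime p∣q (coprime , unimodular) (c ∷ cs , ¬p∣c , p∣comb)
    with All.all? ((+ p) ∣?_) cs
  ... | no ¬p∣cs = unimodular⇒¬deficient (map (project r) rs) isPrime p∣q unimodular
          (cs , ¬p∣cs , subst (All _) (cong (comb cs) (sym (map-∘ tail (act o) rs))) p∣tail)
    where
    o = reducer r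
    reduced : act o (comb (c ∷ cs) (r ∷ rs)) ≡ c ⊛ (pivot r ∷ replicate m 0ℤ) ⊕ comb cs (map (act o) rs)
    reduced = trans (act-comb o (c ∷ cs) (r ∷ rs))
      (cong (λ v → c ⊛ v ⊕ comb cs (map (act o) rs)) (act-reducer r))
    c0+v : ∀ {m} (v : Vec ℤ m) → c ⊛ replicate m 0ℤ ⊕ v ≡ v
    c0+v []      = refl
    c0+v (x ∷ v) = cong₂ _∷_ (identity c x) (c0+v v)
      where
      identity : ∀ c x → c * 0ℤ + x ≡ x
      identity = solve-∀
    p∣tail : All ((+ p) ∣_) (comb cs (map tail (map (act o) rs)))
    p∣tail = subst (All _)
      (trans (cong tail reduced)
        (trans (tail-⊕ (c ⊛ (pivot r ∷ replicate m 0ℤ)) (comb cs (map (act o) rs)))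
          (trans (c0+v _) (tail-comb cs (map (act o) rs)))))
      (All-tail (act-∣ o p∣comb))
  ... | yes p∣cs = contradiction′ (prime∣* c (pivot r) isPrime p∣cg)
    where
    o = reducer r
    rest = comb cs (map (act o) rs)
    p∣rest : All ((+ p) ∣_) rest
    p∣rest = All-∣-comb p∣cs (map (act o) rs)
    reduced : act o (comb (c ∷ cs) (r ∷ rs)) ≡ c ⊛ (pivot r ∷ replicate m 0ℤ) ⊕ rest
    reduced = trans (act-comb o (c ∷ cs) (r ∷ rs))
      (cong (λ v → c ⊛ v ⊕ rest) (act-reducer r))
    p∣cg : (+ p) ∣ c * pivot r
    p∣cg = ∣m+n∣n⇒∣m
      (subst ((+ p) ∣_) (trans (cong head reduced) (head-⊕ (c ⊛ (pivot r ∷ replicate m 0ℤ)) rest))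
        (All-head (act-∣ o p∣comb)))
      (All-head p∣rest)
    contradiction′ : (+ p) ∣ c ⊎ (+ p) ∣ pivot r → ⊥
    contradiction′ (inj₁ p∣c) = ¬p∣c (p∣c ∷ p∣cs)
    contradiction′ (inj₂ p∣g) = ¬prime[1] (subst Prime (coprime (∣⇒∣ᵤ p∣g , p∣q)) isPrime)

  -- If the content of the first row shares a prime with `q`, that row alone is a relation.
  -- Otherwise a relation between the projected rows is lifted. The hypothesis `n ≤ m` prevents the
  -- columns from running out before the rows.
  unimodular⊎deficient : ∀ {n m} q → n ℕ.≤ m → (M : Matrix n m) →
    UnimodularMod q M ⊎ ∃[ p ] Prime p × p ℕ.∣ q × Deficient p M
  unimodular⊎deficient q n≤m [] = inj₁ tt
  unimodular⊎deficient {suc n} {suc m} q (s≤s n≤m) (r ∷ rs) with coprime? (content r) q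
  ... | no ¬coprime with primeDivisor (gcd (content r) q) (λ gcd≡1 → ¬coprime (gcd≡1⇒coprime gcd≡1))
  ...   | p , isPrime , p∣gcd = inj₂ (p , isPrime , ℕ.∣-trans p∣gcd (gcd[m,n]∣n (content r) q) ,
            1ℤ ∷ replicate n 0ℤ , (λ { (p∣1 ∷ _) → ∣1⇒⊥ isPrime p∣1 }) ,
            All-∣-⊕ (All-∣-⊛ 1ℤ (∣pivot⇒All-∣ r (∣ᵤ⇒∣ (ℕ.∣-trans p∣gcd (gcd[m,n]∣m (content r) q)))))
                    (All-∣-comb (All-∣-0 n) rs))
  unimodular⊎deficient {suc n} {suc m} q (s≤s n≤m) (r ∷ rs) | yes coprime
    with unimodular⊎deficient q n≤m (map (project r) rs)
  ... | inj₁ unimodular = inj₁ (coprime , unimodular)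
  ... | inj₂ (p , isPrime , p∣q , cs , ¬p∣cs , p∣comb) = inj₂ (p , isPrime , p∣q ,
          -- The relation `cs` leaves the entry `a` in the pivot column. Scaling it by the pivot `g`
          -- lets `- a` times the first row cancel that entry, and keeps some coefficient prime to
          -- `p` since `p` does not divide `g`.
          - a ∷ g ⊛ cs ,
          (λ { (_ ∷ p∣gcs) → ¬p∣cs (All-∣-prime g isPrime p∤g p∣gcs) }) ,
          act-∣⁻ o (subst (All _) (sym reduced)
            (All-uncons (subst ((+ p) ∣_) (sym heads) ((+ p) ∣0ℤ))
              (subst (All _) (sym (tail-⊕ ((- a) ⊛ (g ∷ replicate m 0ℤ)) (g ⊛ v)))
                (All-∣-⊕ (All-∣-⊛ (- a) (All-∣-0 m))
                  (subst (All _) (sym (tail-⊛ g v)) (All-∣-⊛ g p∣tail)))))))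
    where
    o = reducer r
    g = pivot r
    v = comb cs (map (act o) rs)
    a = head v
    p∤g : ¬ (+ p) ∣ g
    p∤g p∣g = ¬prime[1] (subst Prime (coprime (∣⇒∣ᵤ p∣g , p∣q)) isPrime)
    p∣tail : All ((+ p) ∣_) (tail v)
    p∣tail = subst (All _)
      (trans (cong (comb cs) (map-∘ tail (act o) rs)) (sym (tail-comb cs (map (act o) rs)))) p∣comb
    reduced : act o (comb (- a ∷ g ⊛ cs) (r ∷ rs)) ≡ (- a) ⊛ (g ∷ replicate m 0ℤ) ⊕ g ⊛ v
    reduced = trans (act-comb o (- a ∷ g ⊛ cs) (r ∷ rs))
      (cong₂ (λ x y → (- a) ⊛ x ⊕ y) (act-reducer r) (comb-⊛ g cs (map (act o) rs)))
    identity : ∀ a g → (- a) * g + g * a ≡ 0ℤ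
    identity = solve-∀
    heads : head ((- a) ⊛ (g ∷ replicate m 0ℤ) ⊕ g ⊛ v) ≡ 0ℤ
    heads = trans (head-⊕ ((- a) ⊛ (g ∷ replicate m 0ℤ)) (g ⊛ v))
      (trans (cong (λ t → (- a) * g + t) (head-⊛ g v)) (identity a g))

  -- Invariance of unimodularity modulo q under congruence

  -- Wrapping the divisibility in a record keeps `x` and `y` recoverable by unification, which the
  -- difference `x - y` alone does not.
  record Congruent (q : ℕ) (x y : ℤ) : Set where
    constructor congruent
    field difference : (+ q) ∣ x - y

  open Congruent public

  congruent-sym : ∀ {q x y} → Congruent q x y → Congruent q y x
  congruent-sym {q} {x} {y} (congruent d) = congruent (subst ((+ q) ∣_) (identity x y) (∣m⇒∣-m d))
    where
    identity : ∀ x y → - (x - y) ≡ y - x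
    identity = solve-∀

  congruent-refl : ∀ {q} x → Congruent q x x
  congruent-refl {q} x = congruent (subst ((+ q) ∣_) (sym (ℤ.+-inverseʳ x)) ((+ q) ∣0ℤ))

  congruent-∣ : ∀ {p q x y} → p ℕ.∣ q → Congruent q x y → Congruent p x y
  congruent-∣ p∣q (congruent d) = congruent (∣-trans (∣ᵤ⇒∣ p∣q) d)

  ∣-resp-congruent : ∀ {q x y} → Congruent q x y → (+ q) ∣ x → (+ q) ∣ y
  ∣-resp-congruent {q} {x} {y} (congruent d) q∣x = subst ((+ q) ∣_) (identity x y) (∣m∣n⇒∣m-n q∣x d)
    where
    identity : ∀ x y → x - (x - y) ≡ y
    identity = solve-∀

  congruent-step : ∀ {q a b x y} c → Congruent q a b → Congruent q x y → Congruent q (c * a + x) (c * b + y)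
  congruent-step {q} {a} {b} {x} {y} c (congruent d) (congruent e) =
    congruent (subst ((+ q) ∣_) (identity c a b x y) (∣m∣n⇒∣m+n (∣n⇒∣m*n c d) e))
    where
    identity : ∀ c a b x y → c * (a - b) + (x - y) ≡ (c * a + x) - (c * b + y)
    identity = solve-∀

  CongruentVec : ∀ {n} → ℕ → Vec ℤ n → Vec ℤ n → Set
  CongruentVec q = Pointwise (Congruent q)

  comb-congruent : ∀ {n m q} (c : Vec ℤ n) {M N : Matrix n m} →
    Pointwise (CongruentVec q) M N → CongruentVec q (comb c M) (comb c N)
  comb-congruent {m = m} [] [] = zeros m
    where
    zeros : ∀ m → CongruentVec _ (replicate m 0ℤ) (replicate m 0ℤ)
    zeros zero    = []
    zeros (suc m) = congruent-refl 0ℤ ∷ zeros m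
  comb-congruent (c ∷ cs) (r≈s ∷ rs≈ss) = step r≈s (comb-congruent cs rs≈ss)
    where
    step : ∀ {m q} {a b x y : Vec ℤ m} → CongruentVec q a b → CongruentVec q x y →
      CongruentVec q (c ⊛ a ⊕ x) (c ⊛ b ⊕ y)
    step []       []       = []
    step (d ∷ ds) (e ∷ es) = congruent-step c d e ∷ step ds es

  All-∣-resp : ∀ {n p q} {x y : Vec ℤ n} → p ℕ.∣ q → CongruentVec q x y →
    All ((+ p) ∣_) x → All ((+ p) ∣_) y
  All-∣-resp p∣q []       []       = []
  All-∣-resp p∣q (d ∷ ds) (e ∷ es) = ∣-resp-congruent (congruent-∣ p∣q d) e ∷ All-∣-resp p∣q ds es

  -- The echelon forms of `M` and `N` are not comparable, but a relation modulo a prime divisor of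
  -- `q` passes from `N` to `M` with the same coefficients.
  unimodular-resp-congruent : ∀ {n m q} → n ℕ.≤ m → {M N : Matrix n m} →
    Pointwise (CongruentVec q) M N → UnimodularMod q M → UnimodularMod q N
  unimodular-resp-congruent {q = q} n≤m {M} {N} M≈N unimodular with unimodular⊎deficient q n≤m N
  ... | inj₁ u = u
  ... | inj₂ (p , isPrime , p∣q , c , ¬p∣c , p∣comb) = ⊥-elim
          (unimodular⇒¬deficient M isPrime p∣q unimodular
            (c , ¬p∣c , All-∣-resp p∣q
              (comb-congruent c (Pointwise.sym (Pointwise.sym congruent-sym) M≈N)) p∣comb))

open Deficiency

-- Finite sums and counting

module Counting where

  open import Data.Integer.Base using (0ℤ; 1ℤ; -[1+_]; -1ℤ)
  import Data.Integer.DivMod as ℤ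
  open import Data.Integer.Divisibility.Signed as ℤ using (divides)
  open import Data.List.Base as List using (List; []; _∷_; _++_; length; filter; cartesianProductWith; upTo)
  open import Data.List.Membership.Propositional using (_∈_)
  open import Data.List.Membership.Propositional.Properties
    using (∈-map⁺; ∈-++⁺ˡ; ∈-++⁺ʳ; ∈-upTo⁺; ∈-cartesianProductWith⁺; ∈-cartesianProductWith⁻; ∈-filter⁺; ∈-filter⁻; ∈-map⁻; ∈-++⁻; ∈-∃++)
  import Data.List.Properties as List
  open import Data.List.Relation.Unary.All as ListAll using ([]; _∷_)
  open import Data.List.Relation.Unary.AllPairs using ([]; _∷_)
  open import Data.List.Relation.Unary.Any using (here; there)
  open import Data.List.Relation.Unary.Unique.Propositional using (Unique)
  import Data.List.Relation.Unary.Unique.Propositional.Properties as Unique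
  open import Data.Nat.Base
  open import Data.Nat.Coprimality
    using (coprime?; Coprime; coprime-divisor; coprime⇒gcd≡1; gcd≡1⇒coprime; coprime-Bézout)
  open import Data.Nat.DivMod using (_/_; _%_; m≡m%n+[m/n]*n; m%n<n; /-monoˡ-≤; m<n*o⇒m/o<n; m/n*n≤m; m*n/n≡m)
  open import Data.Nat.Divisibility as ℕ
    using (_∣_; divides; _∣?_; ∣-trans; ∣-refl; ∣-antisym; ∣⇒≤; m∣m*n; n∣m*n; ∣n⇒∣m*n; 0∣⇒≡0; _∣0)
  open import Data.Nat.GCD using (gcd; gcd[m,n]∣m; gcd[m,n]∣n; c*gcd[m,n]≡gcd[cm,cn]; module Bézout)
  open import Data.Nat.ListAction using (product)
  open import Data.Nat.Primality using (Prime; prime⇒nonZero; prime⇒irreducible; ¬prime[1]; prime?)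
  open import Data.Nat.Primality.Factorisation
    using (PrimeFactorisation; factorise; factorisationHasAllPrimeFactors)
  open import Data.Nat.Properties
  open import Data.Nat.Tactic.RingSolver using (solve-∀)
  open import Data.Vec.Base using (concat)
  open import Data.Vec.Properties using (map-id; ≡-dec; ++-injective)
  import Data.Vec.Relation.Unary.All.Properties as All
  open import Function.Bundles using (mk⇔)
  open import Relation.Nullary.Decidable using (_×-dec_)
  open import Relation.Unary using (Decidable; _∩_)

  ∑ : ∀ {A : Set} → List A → (A → ℕ) → ℕ
  ∑ []       f = 0
  ∑ (x ∷ xs) f = f x + ∑ xs f

  𝟙 : ∀ {P : Set} → Dec P → ℕ
  𝟙 (yes _) = 1
  𝟙 (no  _) = 0

  𝟙-⇔ : ∀ {P Q : Set} (p : Dec P) (q : Dec Q) → (P → Q) → (Q → P) → 𝟙 p ≡ 𝟙 q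
  𝟙-⇔ (yes _) (yes _) f g = refl
  𝟙-⇔ (yes p) (no ¬q) f g = contradiction (f p) ¬q
  𝟙-⇔ (no ¬p) (yes q) f g = contradiction (g q) ¬p
  𝟙-⇔ (no _)  (no _)  f g = refl

  𝟙-no : ∀ {P : Set} (p : Dec P) → ¬ P → 𝟙 p ≡ 0
  𝟙-no (yes p) ¬p = contradiction p ¬p
  𝟙-no (no _)  ¬p = refl

  𝟙≤1 : ∀ {P : Set} (p : Dec P) → 𝟙 p ≤ 1
  𝟙≤1 (yes _) = ≤-refl
  𝟙≤1 (no _)  = z≤n

  𝟙-× : ∀ {P Q : Set} (p : Dec P) (q : Dec Q) → 𝟙 (p ×-dec q) ≡ 𝟙 p * 𝟙 q
  𝟙-× (yes _) (yes _) = refl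
  𝟙-× (yes _) (no _)  = refl
  𝟙-× (no _)  (yes _) = refl
  𝟙-× (no _)  (no _)  = refl

  module _ {A : Set} where

    ∑-cong : ∀ (xs : List A) {f g : A → ℕ} → (∀ x → f x ≡ g x) → ∑ xs f ≡ ∑ xs g
    ∑-cong []       eq = refl
    ∑-cong (x ∷ xs) eq = cong₂ _+_ (eq x) (∑-cong xs eq)

    ∑-mono : ∀ (xs : List A) {f g : A → ℕ} → (∀ x → f x ≤ g x) → ∑ xs f ≤ ∑ xs g
    ∑-mono []       le = z≤n
    ∑-mono (x ∷ xs) le = +-mono-≤ (le x) (∑-mono xs le)

    ∑-++ : ∀ (xs ys : List A) f → ∑ (xs ++ ys) f ≡ ∑ xs f + ∑ ys f
    ∑-++ []       ys f = refl
    ∑-++ (x ∷ xs) ys f = trans (cong (λ t → f x + t) (∑-++ xs ys f)) (sym (+-assoc (f x) _ _))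

    ∑-map : ∀ {B : Set} (h : A → B) xs f → ∑ (List.map h xs) f ≡ ∑ xs (f ∘ h)
    ∑-map h []       f = refl
    ∑-map h (x ∷ xs) f = cong (λ t → f (h x) + t) (∑-map h xs f)

    ∑-*ˡ : ∀ c (xs : List A) f → ∑ xs (λ x → c * f x) ≡ c * ∑ xs f
    ∑-*ˡ c []       f = sym (*-zeroʳ c)
    ∑-*ˡ c (x ∷ xs) f = trans (cong (λ t → c * f x + t) (∑-*ˡ c xs f)) (sym (*-distribˡ-+ c (f x) _))

    ∑-*ʳ : ∀ c (xs : List A) f → ∑ xs (λ x → f x * c) ≡ ∑ xs f * c
    ∑-*ʳ c xs f = trans (∑-cong xs (λ x → *-comm (f x) c)) (trans (∑-*ˡ c xs f) (*-comm c (∑ xs f)))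

    ∑-+ : ∀ (xs : List A) f g → ∑ xs (λ x → f x + g x) ≡ ∑ xs f + ∑ xs g
    ∑-+ []       f g = refl
    ∑-+ (x ∷ xs) f g = trans (cong (λ t → f x + g x + t) (∑-+ xs f g)) (identity (f x) (g x) _ _)
      where
      identity : ∀ a b c d → (a + b) + (c + d) ≡ (a + c) + (b + d)
      identity = solve-∀

    ∑-const : ∀ (xs : List A) c → ∑ xs (λ _ → c) ≡ length xs * c
    ∑-const []       c = refl
    ∑-const (x ∷ xs) c = cong (λ t → c + t) (∑-const xs c)

    ∑-zero : ∀ (xs : List A) → ∑ xs (λ _ → 0) ≡ 0
    ∑-zero xs = trans (∑-const xs 0) (*-zeroʳ (length xs))

    length-filter : ∀ {P : A → Set} (P? : Decidable P) xs → length (filter P? xs) ≡ ∑ xs (λ x → 𝟙 (P? x))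
    length-filter P? [] = refl
    length-filter P? (x ∷ xs) with P? x
    ... | yes _ = cong suc (length-filter P? xs)
    ... | no  _ = length-filter P? xs

  ∑-comm : ∀ {A B : Set} (xs : List A) (ys : List B) (f : A → B → ℕ) →
    ∑ xs (λ x → ∑ ys (f x)) ≡ ∑ ys (λ y → ∑ xs (λ x → f x y))
  ∑-comm []       ys f = sym (∑-zero ys)
  ∑-comm (x ∷ xs) ys f = trans (cong (λ t → ∑ ys (f x) + t) (∑-comm xs ys f)) (sym (∑-+ ys (f x) _))

  ∑-cartesian : ∀ {A B C : Set} (h : A → B → C) xs ys f →
    ∑ (cartesianProductWith h xs ys) f ≡ ∑ xs (λ x → ∑ ys (λ y → f (h x y)))
  ∑-cartesian h []       ys f = refl
  ∑-cartesian h (x ∷ xs) ys f = trans (∑-++ (List.map (h x) ys) _ f)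
    (cong₂ _+_ (∑-map (h x) ys f) (∑-cartesian h xs ys f))

  vecs : ∀ {A : Set} → List A → ∀ n → List (Vec A n)
  vecs xs zero    = [] ∷ []
  vecs xs (suc n) = cartesianProductWith _∷_ xs (vecs xs n)

  ∑-vecs : ∀ {A : Set} (xs : List A) n (f : Vec A (suc n) → ℕ) →
    ∑ (vecs xs (suc n)) f ≡ ∑ xs (λ x → ∑ (vecs xs n) (λ v → f (x ∷ v)))
  ∑-vecs xs n f = ∑-cartesian _∷_ xs (vecs xs n) f

  length-vecs : ∀ {A : Set} (xs : List A) n → length (vecs xs n) ≡ length xs ^ n
  length-vecs xs zero    = refl
  length-vecs xs (suc n) = begin
    length (vecs xs (suc n))                           ≡⟨ count (vecs xs (suc n)) ⟨
    ∑ (vecs xs (suc n)) (λ _ → 1)                      ≡⟨ ∑-vecs xs n _ ⟩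
    ∑ xs (λ x → ∑ (vecs xs n) (λ _ → 1))               ≡⟨ ∑-const xs _ ⟩
    length xs * ∑ (vecs xs n) (λ _ → 1)                ≡⟨ cong (length xs *_) (trans (count (vecs xs n)) (length-vecs xs n)) ⟩
    length xs * length xs ^ n                          ∎
    where
    open ≡-Reasoning
    count : ∀ {A : Set} (xs : List A) → ∑ xs (λ _ → 1) ≡ length xs
    count xs = trans (∑-const xs 1) (*-identityʳ (length xs))

  Respects : ∀ {A : Set} → (A → A → Set) → (A → ℕ) → Set
  Respects R f = ∀ {x y} → R x y → f x ≡ f y

  -- ∼ stands for ≡, ≤ or ≥.
  module Coordinatewise (_∼_ : ℕ → ℕ → Set) (reflexive : ∀ {a b} → a ≡ b → a ∼ b)
    (transitive : ∀ {a b c} → a ∼ b → b ∼ c → a ∼ c)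
    (∑-∼ : ∀ {A : Set} (xs : List A) {f g : A → ℕ} → (∀ x → f x ∼ g x) → ∑ xs f ∼ ∑ xs g) where

    -- A comparison with factor `s` in one coordinate is iterated over `n` coordinates. It is
    -- assumed only for functions respecting `R`, because the comparisons in use hold only for
    -- periodic functions. A coordinate may itself be a whole row.
    ∑-vecs-∼ : ∀ {A B : Set} {R : B → B → Set} → (∀ {b} → R b b) →
      (T : A → B) (xs : List A) (ys : List B) (s : ℕ) →
      (∀ g → Respects R g → ∑ xs (g ∘ T) ∼ (s * ∑ ys g)) →
      ∀ n f → Respects (Pointwise R {n}) f →
      ∑ (vecs xs n) (f ∘ map T) ∼ (s ^ n * ∑ (vecs ys n) f)
    ∑-vecs-∼ R-refl T xs ys s compare zero f respects = reflexive (sym (*-identityˡ _))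
    ∑-vecs-∼ {R = R} R-refl T xs ys s compare (suc n) f respects =
      transitive (reflexive (∑-vecs xs n (f ∘ map T)))
        (transitive (∑-∼ xs (λ x → ∑-vecs-∼ R-refl T xs ys s compare n (λ v → f (T x ∷ v))
                       (λ r → respects (R-refl ∷ r))))
          (transitive (compare (λ b → s ^ n * ∑ (vecs ys n) (λ v → f (b ∷ v)))
              (λ r → cong (s ^ n *_) (∑-cong (vecs ys n) (λ v → respects (r ∷ Pointwise.refl R-refl)))))
            (reflexive (trans (cong (s *_) (∑-*ˡ (s ^ n) ys _))
              (trans (sym (*-assoc s (s ^ n) _))
                (cong (s * s ^ n *_) (sym (∑-vecs ys n f))))))))

  module Coordinatewise-≡ = Coordinatewise _≡_ id trans ∑-cong
  module Coordinatewise-≤ = Coordinatewise _≤_ ≤-reflexive ≤-trans ∑-mono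
  module Coordinatewise-≥ = Coordinatewise _≥_ (≤-reflexive ∘ sym) (flip ≤-trans)
    (λ xs ge → ∑-mono xs ge)

  ∑-vecs-≤ : ∀ {A : Set} {R : A → A → Set} → (∀ {a} → R a a) → (xs ys : List A) (s : ℕ) →
    (∀ g → Respects R g → ∑ xs g ≤ s * ∑ ys g) →
    ∀ n f → Respects (Pointwise R {n}) f → ∑ (vecs xs n) f ≤ s ^ n * ∑ (vecs ys n) f
  ∑-vecs-≤ R-refl xs ys s compare n f respects = subst (_≤ _)
    (∑-cong (vecs xs n) (λ v → cong f (map-id v)))
    (Coordinatewise-≤.∑-vecs-∼ R-refl id xs ys s compare n f respects)

  ∑-vecs-≥ : ∀ {A : Set} {R : A → A → Set} → (∀ {a} → R a a) → (xs ys : List A) (s : ℕ) →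
    (∀ g → Respects R g → s * ∑ ys g ≤ ∑ xs g) →
    ∀ n f → Respects (Pointwise R {n}) f → s ^ n * ∑ (vecs ys n) f ≤ ∑ (vecs xs n) f
  ∑-vecs-≥ R-refl xs ys s compare n f respects = subst (_ ≤_)
    (∑-cong (vecs xs n) (λ v → cong f (map-id v)))
    (Coordinatewise-≥.∑-vecs-∼ R-refl id xs ys s compare n f respects)

  -- Sums of periodic functions over intervals and residues

  interval : ℤ → ℕ → List ℤ
  interval a zero    = []
  interval a (suc l) = a ∷ interval (a ℤ.+ 1ℤ) l

  residues : ℕ → List ℤ
  residues q = interval 0ℤ q

  length-interval : ∀ a l → length (interval a l) ≡ l
  length-interval a zero    = refl
  length-interval a (suc l) = cong suc (length-interval (a ℤ.+ 1ℤ) l)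

  interval-++ : ∀ a l k → interval a (l + k) ≡ interval a l ++ interval (a ℤ.+ + l) k
  interval-++ a zero    k = cong (λ b → interval b k) (sym (ℤ.+-identityʳ a))
  interval-++ a (suc l) k = cong (a ∷_) (trans (interval-++ (a ℤ.+ 1ℤ) l k)
    (cong (λ b → interval (a ℤ.+ 1ℤ) l ++ interval b k) (ℤ.+-assoc a 1ℤ (+ l))))

  module _ {q : ℕ} (f : ℤ → ℕ) (periodic : Respects (Congruent q) f) where

    private
      ∑-interval-suc : ∀ a → ∑ (interval a q) f ≡ ∑ (interval (a ℤ.+ 1ℤ) q) f
      ∑-interval-suc a = +-cancelʳ-≡ (f (a ℤ.+ + q)) _ _ (begin
        ∑ (interval a q) f + f (a ℤ.+ + q)        ≡⟨ cong (λ t → ∑ (interval a q) f + t) (+-identityʳ _) ⟨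
        ∑ (interval a q) f + ∑ (interval (a ℤ.+ + q) 1) f
          ≡⟨ ∑-++ (interval a q) _ f ⟨
        ∑ (interval a q ++ interval (a ℤ.+ + q) 1) f
          ≡⟨ cong (λ xs → ∑ xs f) (interval-++ a q 1) ⟨
        ∑ (interval a (q + 1)) f                  ≡⟨ cong (λ l → ∑ (interval a l) f) (+-comm q 1) ⟩
        f a + ∑ (interval (a ℤ.+ 1ℤ) q) f         ≡⟨ +-comm (f a) _ ⟩
        ∑ (interval (a ℤ.+ 1ℤ) q) f + f a         ≡⟨ cong (λ t → ∑ (interval (a ℤ.+ 1ℤ) q) f + t) (periodic wrap) ⟩
        ∑ (interval (a ℤ.+ 1ℤ) q) f + f (a ℤ.+ + q) ∎)
        where
        open ≡-Reasoning
        identity : ∀ a b → a ℤ.- (a ℤ.+ b) ≡ (ℤ.- 1ℤ) ℤ.* b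
        identity = ℤ.solve-∀
        wrap : Congruent q a (a ℤ.+ + q)
        wrap = congruent (divides (ℤ.- 1ℤ) (identity a (+ q)))

    -- Moving the interval by one exchanges `f a` for the equal value `f (a + q)`; any starting
    -- point is reached from 0 by such moves.
    ∑-interval-period : ∀ a → ∑ (interval a q) f ≡ ∑ (residues q) f
    ∑-interval-period (+ zero)  = refl
    ∑-interval-period (+ suc n) = trans
      (trans (cong (λ a → ∑ (interval a q) f) (ℤ.+-comm 1ℤ (+ n))) (sym (∑-interval-suc (+ n))))
      (∑-interval-period (+ n))
    ∑-interval-period (ℤ.-[1+ zero ])  = ∑-interval-suc ℤ.-[1+ 0 ]
    ∑-interval-period (ℤ.-[1+ suc n ]) =
      trans (∑-interval-suc ℤ.-[1+ suc n ]) (∑-interval-period ℤ.-[1+ n ])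

    ∑-interval-* : ∀ a t → ∑ (interval a (t * q)) f ≡ t * ∑ (residues q) f
    ∑-interval-* a zero    = refl
    ∑-interval-* a (suc t) = trans (cong (λ xs → ∑ xs f) (interval-++ a q (t * q)))
      (trans (∑-++ (interval a q) _ f) (cong₂ _+_ (∑-interval-period a) (∑-interval-* (a ℤ.+ + q) t)))

    ∑-interval-translate : ∀ a k l → ∑ (interval a l) (λ x → f (x ℤ.+ k)) ≡ ∑ (interval (a ℤ.+ k) l) f
    ∑-interval-translate a k zero    = refl
    ∑-interval-translate a k (suc l) = cong (λ t → f (a ℤ.+ k) + t)
      (trans (∑-interval-translate (a ℤ.+ 1ℤ) k l) (cong (λ b → ∑ (interval b l) f) (identity a k)))
      where
      identity : ∀ a k → (a ℤ.+ 1ℤ) ℤ.+ k ≡ (a ℤ.+ k) ℤ.+ 1ℤ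
      identity = ℤ.solve-∀

    ∑-residues-translate : ∀ k → ∑ (residues q) (λ x → f (x ℤ.+ k)) ≡ ∑ (residues q) f
    ∑-residues-translate k = trans (∑-interval-translate 0ℤ k q) (∑-interval-period (0ℤ ℤ.+ k))

  ∑-interval-mono : ∀ a {k l} f → k ≤ l → ∑ (interval a k) f ≤ ∑ (interval a l) f
  ∑-interval-mono a {k} {l} f k≤l = subst (∑ (interval a k) f ≤_)
    (trans (sym (∑-++ (interval a k) _ f))
      (trans (cong (λ xs → ∑ xs f) (sym (interval-++ a k (l ∸ k)))) (cong (λ l → ∑ (interval a l) f) (m+[n∸m]≡n k≤l))))
    (m≤m+n (∑ (interval a k) f) (∑ (interval (a ℤ.+ + k) (l ∸ k)) f))

  module _ {q : ℕ} where

    act-congruent : ∀ {n} (o : Shear n) {v w} → CongruentVec q v w → CongruentVec q (act o v) (act o w)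
    act-congruent idle      vs           = vs
    act-congruent (left k)  (d ∷ e ∷ vs) = shear k d e ∷ e ∷ vs
      where
      identity : ∀ k x x′ y y′ → (x ℤ.- x′) ℤ.+ k ℤ.* (y ℤ.- y′) ≡ (x ℤ.+ k ℤ.* y) ℤ.- (x′ ℤ.+ k ℤ.* y′)
      identity = ℤ.solve-∀
      shear : ∀ k {x x′ y y′} → Congruent q x x′ → Congruent q y y′ → Congruent q (x ℤ.+ k ℤ.* y) (x′ ℤ.+ k ℤ.* y′)
      shear k {x} {x′} {y} {y′} d e = subst₂ (Congruent q) (ℤ.+-comm (k ℤ.* y) x) (ℤ.+-comm (k ℤ.* y′) x′)
        (congruent-step k e d)
    act-congruent (right k) (_∷_ {x = x} {y = x′} d (_∷_ {x = y} {y = y′} e vs)) =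
      d ∷ subst₂ (Congruent q) (ℤ.+-comm (k ℤ.* x) y) (ℤ.+-comm (k ℤ.* x′) y′) (congruent-step k d e) ∷ vs
    act-congruent (keep o)  (d ∷ vs)     = d ∷ act-congruent o vs
    act-congruent (o ⨟ o′)  vs           = act-congruent o′ (act-congruent o vs)

    congruentVec-refl : ∀ {n} {v : Vec ℤ n} → CongruentVec q v v
    congruentVec-refl = Pointwise.refl (congruent-refl _)

    tail-congruent : ∀ {n} {v w : Vec ℤ (suc n)} → CongruentVec q v w → CongruentVec q (tail v) (tail w)
    tail-congruent (_ ∷ vs) = vs

    -- An elementary shear translates one coordinate by an amount depending on the others. It does
    -- not preserve the list of representatives, only the residue classes, which is enough for a
    -- periodic `f`.
    ∑-act : ∀ {n} (o : Shear n) (f : Vec ℤ n → ℕ) → Respects (CongruentVec q) f →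
      ∑ (vecs (residues q) n) (f ∘ act o) ≡ ∑ (vecs (residues q) n) f
    ∑-act idle f respects = refl
    ∑-act {suc (suc n)} (left k) f respects = begin
      ∑ (vecs R (suc (suc n))) (f ∘ act (left k))
        ≡⟨ ∑-vecs R (suc n) _ ⟩
      ∑ R (λ x → ∑ (vecs R (suc n)) (λ v → f (act (left k) (x ∷ v))))
        ≡⟨ ∑-comm R (vecs R (suc n)) _ ⟩
      ∑ (vecs R (suc n)) (λ v → ∑ R (λ x → f (act (left k) (x ∷ v))))
        ≡⟨ ∑-cong (vecs R (suc n)) (λ { (y ∷ v) → ∑-residues-translate (λ x → f (x ∷ y ∷ v))
             (λ r → respects (r ∷ congruentVec-refl)) (k ℤ.* y) }) ⟩
      ∑ (vecs R (suc n)) (λ v → ∑ R (λ x → f (x ∷ v)))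
        ≡⟨ ∑-comm R (vecs R (suc n)) _ ⟨
      ∑ R (λ x → ∑ (vecs R (suc n)) (λ v → f (x ∷ v)))
        ≡⟨ ∑-vecs R (suc n) f ⟨
      ∑ (vecs R (suc (suc n))) f ∎
      where
      open ≡-Reasoning
      R = residues q
    ∑-act {suc (suc n)} (right k) f respects = trans (∑-vecs R (suc n) _)
      (trans (∑-cong R (λ x → trans (∑-vecs R n _)
          (trans (∑-residues-translate (λ y → ∑ (vecs R n) (λ v → f (x ∷ y ∷ v)))
                   (λ r → ∑-cong (vecs R n) (λ v → respects (congruent-refl x ∷ r ∷ congruentVec-refl)))
                   (k ℤ.* x))
            (sym (∑-vecs R n _)))))
        (sym (∑-vecs R (suc n) f)))
      where R = residues q
    ∑-act {suc n} (keep o) f respects = trans (∑-vecs R n _)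
      (trans (∑-cong R (λ x → ∑-act o (λ v → f (x ∷ v)) (λ r → respects (congruent-refl x ∷ r))))
        (sym (∑-vecs R n f)))
      where R = residues q
    ∑-act (o ⨟ o′) f respects = trans (∑-act o (f ∘ act o′) (respects ∘ act-congruent o′)) (∑-act o′ f respects)

    -- Once the shear is removed by `∑-act`, the projection forgets the first coordinate, which has
    -- `q` values.
    ∑-project : ∀ {m} (r : Vec ℤ (suc m)) g → Respects (CongruentVec q) g →
      ∑ (vecs (residues q) (suc m)) (g ∘ project r) ≡ q * ∑ (vecs (residues q) m) g
    ∑-project {m} r g respects = trans (∑-act (reducer r) (g ∘ tail) (respects ∘ tail-congruent))
      (trans (∑-vecs (residues q) m (g ∘ tail))
        (trans (∑-const (residues q) _) (cong (_* ∑ (vecs (residues q) m) g) (length-interval 0ℤ q))))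

  -- Unimodular matrices modulo p, counted row by row

  matrices : List ℤ → ∀ n m → List (Matrix n m)
  matrices xs n m = vecs (vecs xs m) n

  -- q is meant to be a multiple of p, so that the residues modulo q make up whole periods.
  unimodularCount : (p q n m : ℕ) → ℕ
  unimodularCount p q n m = ∑ (matrices (residues q) n m) (λ M → 𝟙 (unimodularMod? p M))

  primitiveCount : (p q m : ℕ) → ℕ
  primitiveCount p q m = ∑ (vecs (residues q) (suc m)) (λ r → 𝟙 (coprime? (content r) p))

  Pointwise-map : ∀ {A : Set} {R S : A → A → Set} {n} {x y : Vec A n} → (∀ {a b} → R a b → S a b) →
    Pointwise R x y → Pointwise S x y
  Pointwise-map f []       = []
  Pointwise-map f (r ∷ rs) = f r ∷ Pointwise-map f rs

  unimodular-respects : ∀ {n m p q} → p ∣ q → n ≤ m →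
    Respects (Pointwise (CongruentVec q)) (λ (M : Matrix n m) → 𝟙 (unimodularMod? p M))
  unimodular-respects {p = p} p∣q n≤m {M} {N} M≈N = 𝟙-⇔ (unimodularMod? p M) (unimodularMod? p N)
    (unimodular-resp-congruent n≤m (Pointwise-map (Pointwise-map (congruent-∣ p∣q)) M≈N))
    (unimodular-resp-congruent n≤m (Pointwise.sym (Pointwise.sym congruent-sym)
      (Pointwise-map (Pointwise-map (congruent-∣ p∣q)) M≈N)))

  -- The projection depends on the first row `r`, but by `∑-project` the resulting sum does not, so
  -- the sum over `r` splits off. Each of the `n` remaining rows loses one coordinate, whence
  -- `q ^ n`.
  unimodularCount-suc : ∀ {p q} n m → p ∣ q → n ≤ m →
    unimodularCount p q (suc n) (suc m) ≡ primitiveCount p q m * (q ^ n * unimodularCount p q n m)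
  unimodularCount-suc {p} {q} n m p∣q n≤m = begin
    unimodularCount p q (suc n) (suc m)
      ≡⟨ ∑-vecs rows n _ ⟩
    ∑ rows (λ r → ∑ (vecs rows n) (λ rs → 𝟙 (coprime? (content r) p ×-dec unimodularMod? p (map (project r) rs))))
      ≡⟨ ∑-cong rows (λ r → trans
           (∑-cong (vecs rows n) (λ rs → 𝟙-× (coprime? (content r) p) (unimodularMod? p (map (project r) rs))))
           (trans (∑-*ˡ (𝟙 (coprime? (content r) p)) (vecs rows n) _)
             (cong (𝟙 (coprime? (content r) p) *_)
               (Coordinatewise-≡.∑-vecs-∼ congruentVec-refl (project r) rows (vecs (residues q) m) q
                 (∑-project r) n _ (unimodular-respects p∣q n≤m))))) ⟩
    ∑ rows (λ r → 𝟙 (coprime? (content r) p) * (q ^ n * unimodularCount p q n m))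
      ≡⟨ ∑-*ʳ (q ^ n * unimodularCount p q n m) rows _ ⟩
    primitiveCount p q m * (q ^ n * unimodularCount p q n m) ∎
    where
    open ≡-Reasoning
    rows = vecs (residues q) (suc m)

  module _ {p q : ℕ} (p∣q : p ∣ q) {n m : ℕ} (n≤m : n ≤ m) (a : ℤ) (t l : ℕ) where

    unimodular-interval-≤ : l ≤ t * q →
      ∑ (matrices (interval a l) n m) (λ M → 𝟙 (unimodularMod? p M)) ≤ (t ^ m) ^ n * unimodularCount p q n m
    unimodular-interval-≤ l≤tq = ∑-vecs-≤ {R = CongruentVec q} congruentVec-refl _ _ (t ^ m)
      (∑-vecs-≤ {R = Congruent q} (congruent-refl _) (interval a l) (residues q) t
        (λ g periodic → ≤-trans (∑-interval-mono a g l≤tq) (≤-reflexive (∑-interval-* g periodic a t))) m)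
      n _ (unimodular-respects p∣q n≤m)

    unimodular-interval-≥ : t * q ≤ l →
      (t ^ m) ^ n * unimodularCount p q n m ≤ ∑ (matrices (interval a l) n m) (λ M → 𝟙 (unimodularMod? p M))
    unimodular-interval-≥ tq≤l = ∑-vecs-≥ {R = CongruentVec q} congruentVec-refl _ _ (t ^ m)
      (∑-vecs-≥ {R = Congruent q} (congruent-refl _) (interval a l) (residues q) t
        (λ g periodic → ≤-trans (≤-reflexive (sym (∑-interval-* g periodic a t))) (∑-interval-mono a g tq≤l)) m)
      n _ (unimodular-respects p∣q n≤m)

  ^-distribʳ-* : ∀ n a b → (a * b) ^ n ≡ a ^ n * b ^ n
  ^-distribʳ-* zero    a b = refl
  ^-distribʳ-* (suc n) a b = trans (cong (a * b *_) (^-distribʳ-* n a b)) (identity a b (a ^ n) (b ^ n))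
    where
    identity : ∀ a b c d → a * b * (c * d) ≡ a * c * (b * d)
    identity = solve-∀

  -- Primitive vectors

  All-∣⇒∣content : ∀ {m d} (r : Vec ℤ (suc m)) → All ((+ d) ℤ.∣_) r → d ∣ content r
  All-∣⇒∣content r ds = ℤ.∣⇒∣ᵤ (All-∣⇒∣pivot r ds)

  ∣content⇒All-∣ : ∀ {m d} (r : Vec ℤ (suc m)) → d ∣ content r → All ((+ d) ℤ.∣_) r
  ∣content⇒All-∣ r d∣content = ∣pivot⇒All-∣ r (ℤ.∣ᵤ⇒∣ d∣content)

  -- The two vectors may be reduced by different shears. The equality therefore comes from mutual
  -- divisibility, the content being a common divisor that every common divisor divides.
  content-⊛ : ∀ {m} d (w : Vec ℤ (suc m)) → content ((+ d) ⊛ w) ≡ d * content w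
  content-⊛ {m} d w = ∣-antisym
    (subst (content ((+ d) ⊛ w) ∣_) (ℤ.∣i*j∣≡∣i∣*∣j∣ (+ d) (pivot w)) (ℤ.∣⇒∣ᵤ divides-pivot))
    (All-∣⇒∣content ((+ d) ⊛ w) (scale (∣content⇒All-∣ w ∣-refl)))
    where
    scale : ∀ {m c} {w : Vec ℤ m} → All ((+ c) ℤ.∣_) w → All ((+ (d * c)) ℤ.∣_) ((+ d) ⊛ w)
    scale []       = []
    scale {c = c} {x ∷ w} (e ∷ es) =
      subst (ℤ._∣ (+ d) ℤ.* x) (sym (ℤ.pos-* d c)) (ℤ.*-monoʳ-∣ (+ d) e) ∷ scale es
    divides-pivot : (+ content ((+ d) ⊛ w)) ℤ.∣ (+ d) ℤ.* pivot w
    divides-pivot = All-head (subst (All _)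
      (trans (act-⊛ (reducer w) (+ d) w) (cong ((+ d) ⊛_) (act-reducer w)))
      (act-∣ (reducer w) (∣content⇒All-∣ ((+ d) ⊛ w) ∣-refl)))

  sumTo : (ℕ → ℕ) → ℕ → ℕ
  sumTo s zero    = 0
  sumTo s (suc n) = sumTo s n + s (suc n)

  sumTo-+ : ∀ s k e → sumTo s (k + e) ≡ sumTo s k + sumTo (λ i → s (k + i)) e
  sumTo-+ s k zero    = trans (cong (sumTo s) (+-identityʳ k)) (sym (+-identityʳ _))
  sumTo-+ s k (suc e) = trans (cong (sumTo s) (+-suc k e))
    (trans (cong₂ _+_ (sumTo-+ s k e) (cong s (sym (+-suc k e))))
      (+-assoc (sumTo s k) _ _))

  -- Σ_{i ≤ e} 1/(k + i)² ≤ 1/k − 1/(k + e), cleared of denominators.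
  sumTo-telescope : ∀ s A k e → .⦃ _ : NonZero k ⦄ →
    (∀ i → i < e → (k + suc i) * (k + suc i) * s (suc i) ≤ A) → (k + e) * k * sumTo s e ≤ A * e
  sumTo-telescope s A k zero    bound = ≤-reflexive (trans (*-zeroʳ ((k + 0) * k)) (sym (*-zeroʳ A)))
  sumTo-telescope s A k (suc e) bound = *-cancelˡ-≤ n ⦃ >-nonZero (≤-trans (>-nonZero⁻¹ k) (m≤m+n k e)) ⦄ (begin
    n * ((k + suc e) * k * (sumTo s e + s (suc e)))
      ≡⟨ cong (λ t → n * (t * k * (sumTo s e + s (suc e)))) (+-suc k e) ⟩
    n * (suc n * k * (sumTo s e + s (suc e)))
      ≡⟨ expand n k (sumTo s e) (s (suc e)) ⟩
    suc n * (n * k * sumTo s e) + k * (n * suc n * s (suc e))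
      ≤⟨ +-mono-≤ (*-monoʳ-≤ (suc n) (sumTo-telescope s A k e (λ i i<e → bound i (m≤n⇒m≤1+n i<e))))
           (*-monoʳ-≤ k (≤-trans (*-monoˡ-≤ (s (suc e)) (*-monoˡ-≤ (suc n) (n≤1+n n)))
             (subst (λ t → t * t * s (suc e) ≤ A) (+-suc k e) (bound e ≤-refl)))) ⟩
    suc n * (A * e) + k * A
      ≡⟨ collect k e A ⟩
    n * (A * suc e) ∎)
    where
    open ≤-Reasoning
    n = k + e
    expand : ∀ n k a b → n * ((1 + n) * k * (a + b)) ≡ (1 + n) * (n * k * a) + k * (n * (1 + n) * b)
    expand = solve-∀
    collect : ∀ k e A → (1 + (k + e)) * (A * e) + k * A ≡ (k + e) * (A * (1 + e))
    collect = solve-∀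

  sumTo-tail : ∀ s A k e → (∀ i → i < e → (k + suc i) * (k + suc i) * s (suc i) ≤ A) → k * sumTo s e ≤ A
  sumTo-tail s A zero      e bound = z≤n
  sumTo-tail s A k@(suc _) e bound = *-cancelˡ-≤ (k + e) (begin
    (k + e) * (k * sumTo s e)  ≡⟨ *-assoc (k + e) k (sumTo s e) ⟨
    (k + e) * k * sumTo s e    ≤⟨ sumTo-telescope s A k e bound ⟩
    A * e                      ≤⟨ *-monoʳ-≤ A (m≤n+m e k) ⟩
    A * (k + e)                ≡⟨ *-comm A (k + e) ⟩
    (k + e) * A                ∎)
    where open ≤-Reasoning

  ∑-sumTo : ∀ {A : Set} (xs : List A) (f : ℕ → A → ℕ) n →
    ∑ xs (λ x → sumTo (λ d → f d x) n) ≡ sumTo (λ d → ∑ xs (f d)) n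
  ∑-sumTo xs f zero    = ∑-zero xs
  ∑-sumTo xs f (suc n) = trans (∑-+ xs _ (f (suc n))) (cong (λ t → t + ∑ xs (f (suc n))) (∑-sumTo xs f n))

  sumTo-𝟙 : ∀ g n → 1 ≤ g → g ≤ n → sumTo (λ d → 𝟙 (g ≟ d)) n ≡ 1
  sumTo-𝟙 g n 1≤g g≤n = go n g≤n
    where
    below : ∀ n → n < g → sumTo (λ d → 𝟙 (g ≟ d)) n ≡ 0
    below zero    n<g = refl
    below (suc n) n<g = cong₂ _+_ (below n (<-trans (n<1+n n) n<g))
      (𝟙-no (g ≟ suc n) (λ eq → <-irrefl (sym eq) n<g))
    go : ∀ n → g ≤ n → sumTo (λ d → 𝟙 (g ≟ d)) n ≡ 1
    go zero    g≤0 = contradiction (≤-trans 1≤g g≤0) λ ()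
    go (suc n) g≤n with g ≟ suc n
    ... | yes refl = cong (λ t → t + 1) (below n ≤-refl)
    ... | no  g≢n  = trans (+-identityʳ _) (go n (≤-pred (≤∧≢⇒< g≤n g≢n)))

  module _ (d-1 : ℕ) where

    private
      d = suc d-1

      ∑-interval-zero : ∀ a l (g : ℤ → ℕ) → (∀ i → i < l → g (a ℤ.+ + i) ≡ 0) → ∑ (interval a l) g ≡ 0
      ∑-interval-zero a zero    g g≡0 = refl
      ∑-interval-zero a (suc l) g g≡0 = cong₂ _+_
        (trans (cong g (sym (ℤ.+-identityʳ a))) (g≡0 0 (s≤s z≤n)))
        (∑-interval-zero (a ℤ.+ 1ℤ) l g
          (λ i i<l → trans (cong g (ℤ.+-assoc a 1ℤ (+ i))) (g≡0 (suc i) (s≤s i<l))))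

      ∑-block : ∀ a (g : ℤ → ℕ) → (∀ x → ¬ (+ d) ℤ.∣ x → g x ≡ 0) →
        ∑ (interval ((+ d) ℤ.* a) d) g ≡ g ((+ d) ℤ.* a)
      ∑-block a g g≡0 = trans (cong (λ t → g b + t) (∑-interval-zero (b ℤ.+ 1ℤ) d-1 g
          (λ i i<d-1 → g≡0 _ (λ d∣ → <⇒≱ (s≤s i<d-1) (∣⇒≤ (ℤ.∣⇒∣ᵤ (ℤ.∣m+n∣m⇒∣n
            (subst ((+ d) ℤ.∣_) (ℤ.+-assoc b 1ℤ (+ i)) d∣) (ℤ.∣m⇒∣m*n a ℤ.∣-refl))))))))
        (+-identityʳ (g b))
        where b = (+ d) ℤ.* a

    -- In every block of `d` integers starting at a multiple of `d`, only the first can contribute.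
    ∑-interval-dilate : ∀ a t (g : ℤ → ℕ) → (∀ x → ¬ (+ d) ℤ.∣ x → g x ≡ 0) →
      ∑ (interval ((+ d) ℤ.* a) (t * d)) g ≡ ∑ (interval a t) (λ y → g ((+ d) ℤ.* y))
    ∑-interval-dilate a zero    g g≡0 = refl
    ∑-interval-dilate a (suc t) g g≡0 = begin
      ∑ (interval b (d + t * d)) g
        ≡⟨ cong (λ xs → ∑ xs g) (interval-++ b d (t * d)) ⟩
      ∑ (interval b d ++ interval (b ℤ.+ + d) (t * d)) g
        ≡⟨ ∑-++ (interval b d) _ g ⟩
      ∑ (interval b d) g + ∑ (interval (b ℤ.+ + d) (t * d)) g
        ≡⟨ cong₂ (λ u c → u + ∑ (interval c (t * d)) g) (∑-block a g g≡0) (identity (+ d) a) ⟩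
      g b + ∑ (interval ((+ d) ℤ.* (a ℤ.+ 1ℤ)) (t * d)) g
        ≡⟨ cong (λ u → g b + u) (∑-interval-dilate (a ℤ.+ 1ℤ) t g g≡0) ⟩
      ∑ (interval a (suc t)) (λ y → g ((+ d) ℤ.* y)) ∎
      where
      open ≡-Reasoning
      b = (+ d) ℤ.* a
      identity : ∀ d a → d ℤ.* a ℤ.+ d ≡ d ℤ.* (a ℤ.+ 1ℤ)
      identity = ℤ.solve-∀

    ∑-vecs-dilate : ∀ t n (f : Vec ℤ n → ℕ) → (∀ v → ¬ All ((+ d) ℤ.∣_) v → f v ≡ 0) →
      ∑ (vecs (residues (t * d)) n) f ≡ ∑ (vecs (residues t) n) (λ w → f ((+ d) ⊛ w))
    ∑-vecs-dilate t zero    f f≡0 = refl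
    ∑-vecs-dilate t (suc n) f f≡0 = begin
      ∑ (vecs (residues (t * d)) (suc n)) f
        ≡⟨ ∑-vecs (residues (t * d)) n f ⟩
      ∑ (residues (t * d)) g
        ≡⟨ cong (λ a → ∑ (interval a (t * d)) g) (sym (ℤ.*-zeroʳ (+ d))) ⟩
      ∑ (interval ((+ d) ℤ.* 0ℤ) (t * d)) g
        ≡⟨ ∑-interval-dilate 0ℤ t g (λ x d∤x → trans
             (∑-cong (vecs (residues (t * d)) n) (λ v → f≡0 (x ∷ v) (λ { (d∣x ∷ _) → d∤x d∣x })))
             (∑-zero (vecs (residues (t * d)) n))) ⟩
      ∑ (residues t) (λ y → g ((+ d) ℤ.* y))
        ≡⟨ ∑-cong (residues t) (λ y → ∑-vecs-dilate t n (λ v → f ((+ d) ℤ.* y ∷ v))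
             (λ v ¬d∣v → f≡0 _ (λ { (_ ∷ d∣v) → ¬d∣v d∣v }))) ⟩
      ∑ (residues t) (λ y → ∑ (vecs (residues t) n) (λ w → f ((+ d) ⊛ (y ∷ w))))
        ≡⟨ ∑-vecs (residues t) n _ ⟨
      ∑ (vecs (residues t) (suc n)) (λ w → f ((+ d) ⊛ w)) ∎
      where
      open ≡-Reasoning
      g : ℤ → ℕ
      g x = ∑ (vecs (residues (t * d)) n) (λ v → f (x ∷ v))

  coprime-* : ∀ {a b} → Coprime a b → Coprime a (b * b)
  coprime-* {a} {b} coprime {i} (i∣a , i∣bb) = coprime (i∣a ,
    coprime-divisor {n = b} (λ (j∣i , j∣b) → coprime (∣-trans j∣i i∣a , j∣b)) i∣bb)

  coprime-respects : ∀ {m p q} → p ∣ q →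
    Respects (CongruentVec q) (λ (r : Vec ℤ (suc m)) → 𝟙 (coprime? (content r) p))
  coprime-respects {m} {p} {q} p∣q {x} {y} x≈y = 𝟙-⇔ (coprime? (content x) p) (coprime? (content y) p)
    (transfer x≈y) (transfer (Pointwise.sym congruent-sym x≈y))
    where
    transfer : ∀ {x y : Vec ℤ (suc m)} → CongruentVec q x y → Coprime (content x) p → Coprime (content y) p
    transfer {x} {y} x≈y coprime = proj₁ (unimodular-resp-congruent {1} (s≤s z≤n)
      {x ∷ []} {y ∷ []} (Pointwise-map (congruent-∣ p∣q) x≈y ∷ []) (coprime , tt))

  ∣! : ∀ {d} k → 1 ≤ d → d ≤ k → d ∣ k !
  ∣! zero    1≤d d≤0 = contradiction (≤-trans 1≤d d≤0) λ ()
  ∣! {d} (suc k) 1≤d d≤k with d ≟ suc k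
  ... | yes refl = m∣m*n (k !)
  ... | no  d≢k  = ∣n⇒∣m*n (suc k) (∣! k 1≤d (≤-pred (≤∧≢⇒< d≤k d≢k)))

  module PrimitiveCount (p m : ℕ) .⦃ _ : NonZero p ⦄ where

    q : ℕ
    q = p * p

    private
      instance
        q-nonZero : NonZero q
        q-nonZero = m*n≢0 p p

    -- The content of a vector of residues depends on the representatives chosen; its gcd with `q`
    -- does not, and it lies between 1 and `q`.
    gcdWith-q : Vec ℤ (suc m) → ℕ
    gcdWith-q v = gcd (content v) q

    withGcd : ℕ → ℕ
    withGcd d = ∑ (vecs (residues q) (suc m)) (λ v → 𝟙 (gcdWith-q v ≟ d))

    gcdWith-q≡⇒All-∣ : ∀ d v → gcdWith-q v ≡ d → All ((+ d) ℤ.∣_) v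
    gcdWith-q≡⇒All-∣ d v refl = ∣content⇒All-∣ v (gcd[m,n]∣m (content v) q)

    sumTo-withGcd : sumTo withGcd q ≡ q ^ suc m
    sumTo-withGcd = begin
      sumTo withGcd q
        ≡⟨ ∑-sumTo (vecs (residues q) (suc m)) (λ d v → 𝟙 (gcdWith-q v ≟ d)) q ⟨
      ∑ (vecs (residues q) (suc m)) (λ v → sumTo (λ d → 𝟙 (gcdWith-q v ≟ d)) q)
        ≡⟨ ∑-cong (vecs (residues q) (suc m)) (λ v → sumTo-𝟙 (gcdWith-q v) q
             (n≢0⇒n>0 (λ gcd≡0 → ≢-nonZero⁻¹ q (0∣⇒≡0 (subst (_∣ q) gcd≡0 (gcd[m,n]∣n (content v) q)))))
             (∣⇒≤ (gcd[m,n]∣n (content v) q))) ⟩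
      ∑ (vecs (residues q) (suc m)) (λ _ → 1)
        ≡⟨ ∑-const (vecs (residues q) (suc m)) 1 ⟩
      length (vecs (residues q) (suc m)) * 1
        ≡⟨ *-identityʳ _ ⟩
      length (vecs (residues q) (suc m))
        ≡⟨ length-vecs (residues q) (suc m) ⟩
      length (residues q) ^ suc m
        ≡⟨ cong (_^ suc m) (length-interval 0ℤ q) ⟩
      q ^ suc m ∎
      where open ≡-Reasoning

    private
      module _ (d t : ℕ) .⦃ _ : NonZero d ⦄ (q≡td : q ≡ t * d) where

        withGcd-dilate : withGcd d ≡ ∑ (vecs (residues t) (suc m)) (λ w → 𝟙 (gcdWith-q ((+ d) ⊛ w) ≟ d))
        withGcd-dilate = go d q≡td
          where
          go : ∀ d → .⦃ _ : NonZero d ⦄ → q ≡ t * d →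
            withGcd d ≡ ∑ (vecs (residues t) (suc m)) (λ w → 𝟙 (gcdWith-q ((+ d) ⊛ w) ≟ d))
          go d@(suc d-1) q≡td = trans
            (cong (λ q′ → ∑ (vecs (residues q′) (suc m)) (λ v → 𝟙 (gcdWith-q v ≟ d))) q≡td)
            (∑-vecs-dilate d-1 t (suc m) _
              (λ v ¬d∣v → 𝟙-no (gcdWith-q v ≟ d) (λ eq → ¬d∣v (gcdWith-q≡⇒All-∣ d v eq))))

        gcd-dilate : ∀ w → gcdWith-q ((+ d) ⊛ w) ≡ d * gcd (content w) t
        gcd-dilate w = trans (cong₂ gcd (content-⊛ d w) (trans q≡td (*-comm t d)))
          (sym (c*gcd[m,n]≡gcd[cm,cn] d (content w) t))

        withGcd-≤ : withGcd d * d ^ suc m ≤ q ^ suc m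
        withGcd-≤ = begin
          withGcd d * d ^ suc m
            ≡⟨ cong (_* d ^ suc m) withGcd-dilate ⟩
          ∑ (vecs (residues t) (suc m)) (λ w → 𝟙 (gcdWith-q ((+ d) ⊛ w) ≟ d)) * d ^ suc m
            ≤⟨ *-monoˡ-≤ (d ^ suc m) (∑-mono (vecs (residues t) (suc m)) (λ w → 𝟙≤1 (gcdWith-q ((+ d) ⊛ w) ≟ d))) ⟩
          ∑ (vecs (residues t) (suc m)) (λ _ → 1) * d ^ suc m
            ≡⟨ cong (_* d ^ suc m) (trans (∑-const (vecs (residues t) (suc m)) 1)
                 (trans (*-identityʳ _) (trans (length-vecs (residues t) (suc m)) (cong (_^ suc m) (length-interval 0ℤ t))))) ⟩
          t ^ suc m * d ^ suc m
            ≡⟨ ^-distribʳ-* (suc m) t d ⟨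
          (t * d) ^ suc m
            ≡⟨ cong (_^ suc m) (sym q≡td) ⟩
          q ^ suc m ∎
          where open ≤-Reasoning

        -- The vectors counted are `d` times vectors `w` modulo `t` whose content is coprime to `t`.
        -- As `p` divides `t` and `t` divides `p * p`, this means coprime to `p`, a condition
        -- periodic modulo `t`; passing from modulus `t` to `q = d * t` multiplies the count by
        -- `d ^ suc m`.
        withGcd-≡ : p ∣ t → d ^ suc m * withGcd d ≡ primitiveCount p q m
        withGcd-≡ p∣t = begin
          d ^ suc m * withGcd d
            ≡⟨ cong (d ^ suc m *_) (trans withGcd-dilate (∑-cong (vecs (residues t) (suc m)) same)) ⟩
          d ^ suc m * ∑ (vecs (residues t) (suc m)) (λ w → 𝟙 (coprime? (content w) p))
            ≡⟨ Coordinatewise-≡.∑-vecs-∼ {R = Congruent t} (congruent-refl _) id (residues (d * t)) (residues t) d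
                 (λ g periodic → ∑-interval-* g periodic 0ℤ d) (suc m) _ (coprime-respects p∣t) ⟨
          ∑ (vecs (residues (d * t)) (suc m)) (λ v → 𝟙 (coprime? (content (Vec.map id v)) p))
            ≡⟨ ∑-cong (vecs (residues (d * t)) (suc m)) (λ v → cong (λ v → 𝟙 (coprime? (content v) p)) (map-id v)) ⟩
          ∑ (vecs (residues (d * t)) (suc m)) (λ v → 𝟙 (coprime? (content v) p))
            ≡⟨ cong (λ q′ → ∑ (vecs (residues q′) (suc m)) (λ v → 𝟙 (coprime? (content v) p)))
                 (trans (*-comm d t) (sym q≡td)) ⟩
          primitiveCount p q m ∎
          where
          open ≡-Reasoning
          same : ∀ w → 𝟙 (gcdWith-q ((+ d) ⊛ w) ≟ d) ≡ 𝟙 (coprime? (content w) p)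
          same w = 𝟙-⇔ (gcdWith-q ((+ d) ⊛ w) ≟ d) (coprime? (content w) p)
            (λ eq (i∣content , i∣p) → gcd≡1⇒coprime
              (*-cancelˡ-≡ (gcd (content w) t) 1 d
                (trans (sym (gcd-dilate w)) (trans eq (sym (*-identityʳ d)))))
              (i∣content , ∣-trans i∣p p∣t))
            (λ coprime → trans (gcd-dilate w) (trans (cong (d *_) (coprime⇒gcd≡1 {content w} {t}
              (λ (i∣content , i∣t) → coprime-* {content w} {p} coprime
                (i∣content , ∣-trans i∣t (divides d (trans q≡td (*-comm t d)))))))
              (*-identityʳ d)))

    -- For `p = u * d` the cofactor of `d` in `p * p` is `u * p`, a multiple of `p`; with modulus
    -- `p` instead of its square this would fail.
    withGcd-divisor : ∀ d → .⦃ _ : NonZero d ⦄ → d ∣ p → d ^ suc m * withGcd d ≡ primitiveCount p q m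
    withGcd-divisor d (divides u p≡ud) = withGcd-≡ d (u * p)
      (trans (cong (_* p) p≡ud) (identity u d p)) (n∣m*n u)
      where
      identity : ∀ u d p → u * d * p ≡ u * p * d
      identity = solve-∀

    withGcd-bound : ∀ d → .⦃ _ : NonZero d ⦄ → withGcd d * d ^ suc m ≤ q ^ suc m
    withGcd-bound d with d ∣? q
    ... | yes (divides t q≡td) = withGcd-≤ d t q≡td
    ... | no  d∤q = subst (λ c → c * d ^ suc m ≤ q ^ suc m) (sym withGcd≡0) z≤n
      where
      withGcd≡0 : withGcd d ≡ 0
      withGcd≡0 = trans (∑-cong (vecs (residues q) (suc m)) (λ v → 𝟙-no (gcdWith-q v ≟ d)
        (λ eq → d∤q (subst (_∣ q) eq (gcd[m,n]∣n (content v) q))))) (∑-zero (vecs (residues q) (suc m)))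

    -- At most a proportion 1/d^(m+1) of the vectors have gcd `d`. Since `1 ≤ m` this is at most
    -- 1/d², and the terms with d > k telescope to at most 1/k.
    sumTo-withGcd-split : ∀ k → k ≤ p → 1 ≤ m →
      ∃[ e ] (q ^ suc m ≡ sumTo withGcd k + e) × k * e ≤ q ^ suc m
    sumTo-withGcd-split k k≤p 1≤m = sumTo (λ i → withGcd (k + i)) (q ∸ k) ,
      (begin
        q ^ suc m                 ≡⟨ sumTo-withGcd ⟨
        sumTo withGcd q           ≡⟨ cong (sumTo withGcd) (m+[n∸m]≡n k≤q) ⟨
        sumTo withGcd (k + (q ∸ k)) ≡⟨ sumTo-+ withGcd k (q ∸ k) ⟩
        sumTo withGcd k + sumTo (λ i → withGcd (k + i)) (q ∸ k) ∎) ,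
      sumTo-tail (λ i → withGcd (k + i)) (q ^ suc m) k (q ∸ k) (λ i _ → bound i)
      where
      open ≡-Reasoning
      k≤q : k ≤ q
      k≤q = ≤-trans k≤p (m≤m*n p p)
      bound : ∀ i → (k + suc i) * (k + suc i) * withGcd (k + suc i) ≤ q ^ suc m
      bound i = ≤-trans
        (≤-trans (*-monoˡ-≤ (withGcd d) (≤-trans (≤-reflexive (cong (d *_) (sym (*-identityʳ d))))
            (^-monoʳ-≤ d (s≤s 1≤m))))
          (≤-reflexive (*-comm (d ^ suc m) (withGcd d))))
        (withGcd-bound d)
        where
        d = k + suc i
        instance
          d-nonZero : NonZero d
          d-nonZero = >-nonZero (≤-trans (s≤s z≤n) (m≤n+m (suc i) k))

  -- Covers, and primes below the radius of the box

  -- An upper bound for the number of elements satisfying a predicate that need not be decidable.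
  record Cover {A : Set} (P : A → Set) (s : ℕ) : Set where
    constructor cover
    field
      list     : List A
      length≤  : length list ≤ s
      complete : ∀ {x} → P x → x ∈ list

  open Cover public

  module _ {A : Set} where

    cover-⊆ : ∀ {P Q : A → Set} {s} → (∀ {x} → Q x → P x) → Cover P s → Cover Q s
    cover-⊆ Q⊆P (cover xs le c) = cover xs le (c ∘ Q⊆P)

    cover-≤ : ∀ {P : A → Set} {s t} → s ≤ t → Cover P s → Cover P t
    cover-≤ s≤t (cover xs le c) = cover xs (≤-trans le s≤t) c

    cover-∅ : ∀ {P : A → Set} → (∀ {x} → ¬ P x) → Cover P 0
    cover-∅ ¬P = cover [] z≤n (⊥-elim ∘ ¬P)

    cover-∪ : ∀ {P Q : A → Set} {s t} → Cover P s → Cover Q t → Cover (λ x → P x ⊎ Q x) (s + t)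
    cover-∪ (cover xs le c) (cover ys le′ c′) = cover (xs ++ ys)
      (≤-trans (≤-reflexive (List.length-++ xs)) (+-mono-≤ le le′))
      λ { (inj₁ p) → ∈-++⁺ˡ (c p) ; (inj₂ q) → ∈-++⁺ʳ xs (c′ q) }

    cover-map : ∀ {B : Set} {P : A → Set} {s} (f : A → B) → Cover P s →
      Cover (λ b → ∃[ a ] P a × b ≡ f a) s
    cover-map f (cover xs le c) = cover (List.map f xs)
      (≤-trans (≤-reflexive (List.length-map f xs)) le)
      λ { (a , p , refl) → ∈-map⁺ f (c p) }

    -- The bound `t` must hold over every `a`, not only over those satisfying `P`. Where a fibre is
    -- controlled only under a condition, the condition is made part of `Q` and the fibre is empty
    -- elsewhere.
    cover-Σ : ∀ {B : Set} {P : A → Set} {Q : A → B → Set} {s t} →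
      Cover P s → (∀ a → Cover (Q a) t) → Cover (λ (a , b) → P a × Q a b) (s * t)
    cover-Σ {B} {P} {Q} {s} {t} (cover xs le c) covers = cover (pairs xs)
      (≤-trans (length-pairs xs) (*-monoˡ-≤ t le))
      λ (p , q) → pairs-complete (c p) q
      where
      pairs : List A → List (A × B)
      pairs []       = []
      pairs (a ∷ as) = List.map (a ,_) (list (covers a)) ++ pairs as

      length-pairs : ∀ as → length (pairs as) ≤ length as * t
      length-pairs []       = z≤n
      length-pairs (a ∷ as) = ≤-trans
        (≤-reflexive (trans (List.length-++ (List.map (a ,_) (list (covers a))))
          (cong (λ l → l + length (pairs as)) (List.length-map (a ,_) (list (covers a))))))
        (+-mono-≤ (length≤ (covers a)) (length-pairs as))

      pairs-complete : ∀ {as a b} → a ∈ as → Q a b → (a , b) ∈ pairs as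
      pairs-complete {a ∷ as} (here refl) q = ∈-++⁺ˡ (∈-map⁺ (a ,_) (complete (covers a) q))
      pairs-complete {a ∷ as} (there a∈as) q = ∈-++⁺ʳ (List.map (a ,_) (list (covers a))) (pairs-complete a∈as q)

    cover-⋃ : ∀ {P : ℕ → A → Set} {s} n → (∀ i → Cover (P (suc i)) (s (suc i))) →
      Cover (λ x → ∃[ i ] i < n × P (suc i) x) (sumTo s n)
    cover-⋃ zero    covers = cover-∅ λ { (_ , () , _) }
    cover-⋃ {P} (suc n) covers = cover-⊆ last (cover-∪ (cover-⋃ {P} n covers) (covers n))
      where
      last : ∀ {x} → (∃[ i ] i < suc n × P (suc i) x) → (∃[ i ] i < n × P (suc i) x) ⊎ P (suc n) x
      last (i , i<n , p) with i ≟ n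
      ... | yes refl = inj₂ p
      ... | no  i≢n  = inj₁ (i , ≤∧≢⇒< (≤-pred i<n) i≢n , p)

  cover-× : ∀ {A B : Set} {P : A → Set} {Q : B → Set} {s t} → Cover P s → Cover Q t →
    Cover (λ (a , b) → P a × Q b) (s * t)
  cover-× c c′ = cover-Σ c (λ _ → c′)

  cover-vec : ∀ {A : Set} {P : A → Set} {s} n → Cover P s → Cover (All P {n}) (s ^ n)
  cover-vec zero    c = cover ([] ∷ []) ≤-refl λ { [] → here refl }
  cover-vec (suc n) c = cover-⊆ (λ { {x ∷ v} (p ∷ ps) → (x , v) , (p , ps) , refl })
    (cover-map (uncurry _∷_) (cover-Σ c (λ _ → cover-vec n c)))

  InBox : ℕ → ℤ → Set
  InBox b z = (ℤ.- (+ b) ℤ.≤ z) × (z ℤ.< + b)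

  inBox-offset : ∀ {b z} → InBox b z → ∃[ e ] e < 2 * b × z ≡ ℤ.- (+ b) ℤ.+ + e
  inBox-offset {b} {z} (-b≤z , z<b) with z ℤ.- (ℤ.- (+ b)) in eq | ℤ.i≤j⇒0≤j-i -b≤z
  ... | + e      | _ = e , ℤ.drop‿+<+ (subst₂ ℤ._<_ eq (identity₁ b) (ℤ.+-monoˡ-< (ℤ.- (ℤ.- (+ b))) z<b)) ,
        trans (identity₂ z (+ b)) (cong (λ t → ℤ.- (+ b) ℤ.+ t) eq)
    where
    identity₁ : ∀ b → + b ℤ.- (ℤ.- (+ b)) ≡ + (2 * b)
    identity₁ b = trans (cong (λ t → + b ℤ.+ t) (ℤ.neg-involutive (+ b)))
      (cong +_ (cong (λ t → b + t) (sym (+-identityʳ b))))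
    identity₂ : ∀ z b → z ≡ ℤ.- b ℤ.+ (z ℤ.- (ℤ.- b))
    identity₂ = ℤ.solve-∀
  ... | -[1+ _ ] | ()

  ∈-interval : ∀ a l {e} → e < l → a ℤ.+ + e ∈ interval a l
  ∈-interval a (suc l) {zero}  _         = here (ℤ.+-identityʳ a)
  ∈-interval a (suc l) {suc e} (s≤s e<l) = there (subst (_∈ interval (a ℤ.+ 1ℤ) l)
    (ℤ.+-assoc a 1ℤ (+ e)) (∈-interval (a ℤ.+ 1ℤ) l e<l))

  interval-∈ : ∀ a l {z} → z ∈ interval a l → ∃[ e ] e < l × z ≡ a ℤ.+ + e
  interval-∈ a (suc l) (here refl) = 0 , s≤s z≤n , sym (ℤ.+-identityʳ a)
  interval-∈ a (suc l) (there z∈) with interval-∈ (a ℤ.+ 1ℤ) l z∈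
  ... | e , e<l , refl = suc e , s≤s e<l , ℤ.+-assoc a 1ℤ (+ e)

  ∈-vecs⁺ : ∀ {A : Set} {xs : List A} {n} {v : Vec A n} → All (_∈ xs) v → v ∈ vecs xs n
  ∈-vecs⁺ []       = here refl
  ∈-vecs⁺ (x ∷ ps) = ∈-cartesianProductWith⁺ _∷_ x (∈-vecs⁺ ps)

  ∈-vecs⁻ : ∀ {A : Set} (xs : List A) {n} {v : Vec A n} → v ∈ vecs xs n → All (_∈ xs) v
  ∈-vecs⁻ xs {zero}  {[]} _ = []
  ∈-vecs⁻ xs {suc n} v∈ with ∈-cartesianProductWith⁻ _∷_ xs (vecs xs n) v∈
  ... | x , w , x∈ , w∈ , refl = x∈ ∷ ∈-vecs⁻ xs w∈

  box : ℕ → List ℤ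
  box b = interval (ℤ.- (+ b)) (2 * b)

  inBox⇒∈box : ∀ {b z} → InBox b z → z ∈ box b
  inBox⇒∈box {b} inBox with inBox-offset inBox
  ... | e , e<2b , refl = ∈-interval (ℤ.- (+ b)) (2 * b) e<2b

  ∈box⇒inBox : ∀ {b z} → z ∈ box b → InBox b z
  ∈box⇒inBox {b} z∈ with interval-∈ (ℤ.- (+ b)) (2 * b) z∈
  ... | e , e<2b , refl = ℤ.i≤i+j (ℤ.- (+ b)) (+ e) ,
    subst (ℤ.- (+ b) ℤ.+ + e ℤ.<_) (identity b) (ℤ.+-monoʳ-< (ℤ.- (+ b)) (ℤ.+<+ e<2b))
    where
    lemma : ∀ x → ℤ.- x ℤ.+ (x ℤ.+ x) ≡ x
    lemma = ℤ.solve-∀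
    identity : ∀ b → ℤ.- (+ b) ℤ.+ + (2 * b) ≡ + b
    identity b = trans (cong (λ t → ℤ.- (+ b) ℤ.+ t) (cong +_ (cong (λ t → b + t) (+-identityʳ b)))) (lemma (+ b))

  cover-interval : ∀ a l → Cover (_∈ interval a l) l
  cover-interval a l = cover (interval a l) (≤-reflexive (length-interval a l)) id

  cover-inBox : ∀ b → Cover (InBox b) (2 * b)
  cover-inBox b = cover-⊆ inBox⇒∈box (cover-interval (ℤ.- (+ b)) (2 * b))

  congruent⇒≡ : ∀ {q u v} → u < q → v < q → Congruent q (+ u) (+ v) → u ≡ v
  congruent⇒≡ {q} {u} {v} u<q v<q (congruent q∣) with ℤ.∣ + u ℤ.- + v ∣ in eq
  ... | zero  = ℤ.+-injective (ℤ.i-j≡0⇒i≡j (+ u) (+ v) (ℤ.∣i∣≡0⇒i≡0 eq))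
  ... | suc d = contradiction
    (≤-<-trans (subst (_≤ u ⊔ v) (trans (cong ℤ.∣_∣ (sym (ℤ.m-n≡m⊖n u v))) eq) (ℤ.∣m⊝n∣≤m⊔n u v)) (⊔-lub u<q v<q))
    (≤⇒≯ (∣⇒≤ (subst (q ∣_) eq (ℤ.∣⇒∣ᵤ q∣))))

  congruent-trans : ∀ {q x y z} → Congruent q x y → Congruent q y z → Congruent q x z
  congruent-trans {q} {x} {y} {z} (congruent d) (congruent e) =
    congruent (subst ((+ q) ℤ.∣_) (identity x y z) (ℤ.∣m∣n⇒∣m+n d e))
    where
    identity : ∀ x y z → (x ℤ.- y) ℤ.+ (y ℤ.- z) ≡ x ℤ.- z
    identity = ℤ.solve-∀

  residue-congruent : ∀ q .⦃ _ : NonZero q ⦄ z → Congruent q z (+ (z ℤ.%ℕ q))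
  residue-congruent q z = congruent (divides (z ℤ./ℕ q)
    (trans (cong (λ t → t ℤ.- + (z ℤ.%ℕ q)) (ℤ.a≡a%ℕn+[a/ℕn]*n z q)) (identity (+ (z ℤ.%ℕ q)) _)))
    where
    identity : ∀ r s → (r ℤ.+ s) ℤ.- r ≡ s
    identity = ℤ.solve-∀

  module _ (q : ℕ) ⦃ q≢0 : NonZero q ⦄ (b : ℕ) where

    classSize : ℕ
    classSize = suc (2 * b / q)

    -- Offsets from the lower end of the box have a fixed remainder `r` modulo `q` and are below
    -- `2 * b`, so their quotient by `q` is at most `2 * b / q`.
    cover-class : ∀ a → Cover (λ z → InBox b z × Congruent q z a) classSize
    cover-class a = cover (List.map point (upTo classSize))
      (≤-reflexive (trans (List.length-map point (upTo classSize)) (List.length-upTo classSize)))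
      λ (inBox , z≡a) → member inBox z≡a
      where
      a₀ = ℤ.- (+ b)
      r = (a ℤ.- a₀) ℤ.%ℕ q
      point : ℕ → ℤ
      point i = a₀ ℤ.+ + (r + i * q)
      member : ∀ {z} → InBox b z → Congruent q z a → z ∈ List.map point (upTo classSize)
      member {z} inBox z≡a with inBox-offset inBox
      ... | e , e<2b , refl = subst (λ t → a₀ ℤ.+ + t ∈ List.map point (upTo classSize))
          (trans (cong (λ t → t + e / q * q) (sym same)) (sym (m≡m%n+[m/n]*n e q)))
          (∈-map⁺ point (∈-upTo⁺ (s≤s (/-monoˡ-≤ q (<⇒≤ e<2b)))))
        where
        shifted : Congruent q (+ e) (a ℤ.- a₀)
        shifted = congruent (subst ((+ q) ℤ.∣_) (identity a₀ (+ e) a) (difference z≡a))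
          where
          identity : ∀ s e a → (s ℤ.+ e) ℤ.- a ≡ e ℤ.- (a ℤ.- s)
          identity = ℤ.solve-∀
        same : e % q ≡ r
        same = congruent⇒≡ (m%n<n e q) (ℤ.n%ℕd<d (a ℤ.- a₀) q)
          (congruent-trans (congruent-sym (residue-congruent q (+ e)))
            (congruent-trans shifted (residue-congruent q (a ℤ.- a₀))))

    cover-classVec : ∀ {m} (a : Vec ℤ m) → Cover (λ v → Box b v × CongruentVec q v a) (classSize ^ m)
    cover-classVec []      = cover ([] ∷ []) ≤-refl λ { {[]} _ → here refl }
    cover-classVec (x ∷ a) = cover-⊆ (λ { {z ∷ v} (i ∷ is , c ∷ cs) → (z , v) , ((i , c) , (is , cs)) , refl })
      (cover-map (uncurry _∷_) (cover-× (cover-class x) (cover-classVec a)))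

  -- With entries reduced modulo a prime, these represent the points of projective space: one vector
  -- from each line of proportional relations, which saves a factor `p` in the count.
  data Monic : ∀ {n} → Vec ℤ n → Set where
    one  : ∀ {n} {c : Vec ℤ n} → Monic (1ℤ ∷ c)
    zero : ∀ {n} {c : Vec ℤ n} → Monic c → Monic (0ℤ ∷ c)

  congruent-cancel : ∀ {q r w a} → Congruent q (1ℤ ℤ.* r ℤ.+ w) a → Congruent q r (a ℤ.- w)
  congruent-cancel {q} {r} {w} {a} (congruent d) = congruent (subst ((+ q) ℤ.∣_) (identity r w a) d)
    where
    identity : ∀ r w a → (1ℤ ℤ.* r ℤ.+ w) ℤ.- a ≡ r ℤ.- (a ℤ.- w)
    identity = ℤ.solve-∀

  0⊛⊕ : ∀ {m} (r w : Vec ℤ m) → 0ℤ ⊛ r ⊕ w ≡ w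
  0⊛⊕ []      []      = refl
  0⊛⊕ (x ∷ r) (y ∷ w) = cong₂ _∷_ (trans (cong (ℤ._+ y) (ℤ.*-zeroˡ x)) (ℤ.+-identityˡ y)) (0⊛⊕ r w)

  -- All rows are free except the one with leading coefficient 1, whose residue class modulo `q` is
  -- determined by the rows below it; the rows above have coefficient 0.
  cover-combination : ∀ q ⦃ q≢0 : NonZero q ⦄ b {n m} (c : Vec ℤ (suc n)) → Monic c → (a : Vec ℤ m) →
    Cover (λ (M : Matrix (suc n) m) → All (Box b) M × CongruentVec q (comb c M) a)
      (((2 * b) ^ m) ^ n * classSize q b ^ m)
  cover-combination q b {n} {m} (1ℤ ∷ c) one a = cover-⊆
    (λ { {r ∷ rs} (i ∷ is , congr) → (rs , r) , (is , i , solve r (comb c rs) a congr) , refl })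
    (cover-map (λ (rs , r) → r ∷ rs)
      (cover-Σ (cover-vec n (cover-vec m (cover-inBox b)))
        (λ rs → cover-classVec q b (Vec.zipWith ℤ._-_ a (comb c rs)))))
    where
    solve : ∀ {m} (r w a : Vec ℤ m) → CongruentVec q (1ℤ ⊛ r ⊕ w) a → CongruentVec q r (Vec.zipWith ℤ._-_ a w)
    solve []      []      []      []       = []
    solve (x ∷ r) (y ∷ w) (z ∷ a) (d ∷ ds) = congruent-cancel d ∷ solve r w a ds
  cover-combination q b {suc n} {m} (0ℤ ∷ c) (zero monic) a = cover-≤
    (≤-reflexive (sym (*-assoc ((2 * b) ^ m) (((2 * b) ^ m) ^ n) (classSize q b ^ m))))
    (cover-⊆
      (λ { {r ∷ rs} (i ∷ is , congr) → (r , rs) , (i , is , subst (λ v → CongruentVec q v a) (0⊛⊕ r (comb c rs)) congr) , refl })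
      (cover-map (uncurry _∷_) (cover-× (cover-vec m (cover-inBox b)) (cover-combination q b c monic a))))

  inverseMod : ∀ {p} x → Prime p → ¬ (+ p) ℤ.∣ x → ∃[ u ] Congruent p (u ℤ.* x) 1ℤ
  inverseMod {p} x isPrime p∤x = signed x (inverse-∣x∣ (coprime-Bézout {ℤ.∣ x ∣} {p} coprime))
    where
    coprime : Coprime ℤ.∣ x ∣ p
    coprime (i∣x , i∣p) with prime⇒irreducible isPrime i∣p
    ... | inj₁ i≡1  = i≡1
    ... | inj₂ refl = contradiction (ℤ.∣ᵤ⇒∣ i∣x) p∤x

    identity₁ : ∀ a → (1ℤ ℤ.+ a) ℤ.- 1ℤ ≡ a
    identity₁ = ℤ.solve-∀
    identity₂ : ∀ u y → (ℤ.- u) ℤ.* y ℤ.- 1ℤ ≡ ℤ.- (1ℤ ℤ.+ u ℤ.* y)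
    identity₂ = ℤ.solve-∀
    identity₃ : ∀ u y → (ℤ.- u) ℤ.* (ℤ.- y) ≡ u ℤ.* y
    identity₃ = ℤ.solve-∀

    inverse-∣x∣ : Bézout.Identity 1 ℤ.∣ x ∣ p → ∃[ u ] Congruent p (u ℤ.* + ℤ.∣ x ∣) 1ℤ
    inverse-∣x∣ (Bézout.+- u v eq) = + u , congruent (divides (+ v)
      (trans (cong (ℤ._- 1ℤ) (trans (sym (ℤ.pos-* u ℤ.∣ x ∣)) (cong +_ (sym eq))))
        (trans (identity₁ (+ (v * p))) (ℤ.pos-* v p))))
    inverse-∣x∣ (Bézout.-+ u v eq) = ℤ.- + u , congruent (divides (ℤ.- + v)
      (trans (identity₂ (+ u) (+ ℤ.∣ x ∣))
        (trans (cong ℤ.-_ (trans (cong (λ t → 1ℤ ℤ.+ t) (sym (ℤ.pos-* u ℤ.∣ x ∣))) (trans (cong +_ eq) (ℤ.pos-* v p))))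
          (ℤ.neg-distribˡ-* (+ v) (+ p)))))

    signed : ∀ x → ∃[ u ] Congruent p (u ℤ.* + ℤ.∣ x ∣) 1ℤ → ∃[ u ] Congruent p (u ℤ.* x) 1ℤ
    signed (+ n)      inv     = inv
    signed (-[1+ n ]) (u , c) = ℤ.- u , subst (λ t → Congruent p t 1ℤ) (sym (identity₃ u (+ suc n))) c

  Residue : ℕ → ℤ → Set
  Residue q z = z ∈ residues q

  residue : ∀ q .⦃ _ : NonZero q ⦄ z → ∃[ r ] Residue q r × Congruent q z r
  residue q z = + (z ℤ.%ℕ q) , ∈-interval 0ℤ q (ℤ.n%ℕd<d z q) , residue-congruent q z

  residueVec : ∀ q .⦃ _ : NonZero q ⦄ {n} (v : Vec ℤ n) → ∃[ w ] All (Residue q) w × CongruentVec q v w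
  residueVec q []      = [] , [] , []
  residueVec q (x ∷ v) with residue q x | residueVec q v
  ... | y , r , c | w , rs , cs = y ∷ w , r ∷ rs , c ∷ cs

  normalise : ∀ {p n} (c : Vec ℤ n) → Prime p → ¬ All ((+ p) ℤ.∣_) c →
    ∃[ k ] ∃[ d ] Monic d × All (Residue p) d × CongruentVec p (k ⊛ c) d
  normalise []      isPrime ¬p∣c = contradiction [] ¬p∣c
  normalise {p} {suc n} (x ∷ c) isPrime ¬p∣c = go ((+ p) ℤ.∣? x)
    where
    instance
      p≢0 : NonZero p
      p≢0 = prime⇒nonZero isPrime
    1<p : 1 < p
    1<p = ≤∧≢⇒< (>-nonZero⁻¹ p) λ { refl → ¬prime[1] isPrime }
    go : Dec ((+ p) ℤ.∣ x) → ∃[ k ] ∃[ d ] Monic d × All (Residue p) d × CongruentVec p (k ⊛ (x ∷ c)) d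
    go (no p∤x) with inverseMod x isPrime p∤x
    ... | u , ux≡1 with residueVec p (u ⊛ c)
    ...   | d , rs , congr = u , 1ℤ ∷ d , one , ∈-interval 0ℤ p 1<p ∷ rs , ux≡1 ∷ congr
    go (yes p∣x) with normalise c isPrime (λ p∣c → ¬p∣c (p∣x ∷ p∣c))
    ... | k , d , monic , rs , congr = k , 0ℤ ∷ d , zero monic , ∈-interval 0ℤ p (>-nonZero⁻¹ p) ∷ rs ,
      congruent (subst ((+ p) ℤ.∣_) (sym (ℤ.+-identityʳ (k ℤ.* x))) (ℤ.∣n⇒∣m*n k p∣x)) ∷ congr

  -- There are `suc n` places for the leading 1 and at most `q ^ n` choices for the entries after
  -- it.
  cover-monic : ∀ q ⦃ q≢0 : NonZero q ⦄ n →
    Cover (λ (d : Vec ℤ (suc n)) → Monic d × All (Residue q) d) (suc n * q ^ n)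
  cover-monic q zero = cover ((1ℤ ∷ []) ∷ []) ≤-refl λ { (one , _ ∷ []) → here refl }
  cover-monic q (suc n) = cover-≤
    (+-monoʳ-≤ (q ^ suc n) (*-monoʳ-≤ (suc n) (^-monoʳ-≤ q (n≤1+n n))))
    (cover-⊆ split (cover-∪
      (cover-map (1ℤ ∷_) (cover-vec (suc n) (cover-interval 0ℤ q)))
      (cover-map (0ℤ ∷_) (cover-monic q n))))
    where
    split : ∀ {d} → Monic d × All (Residue q) d →
      (∃[ e ] All (Residue q) e × d ≡ 1ℤ ∷ e) ⊎ (∃[ e ] (Monic e × All (Residue q) e) × d ≡ 0ℤ ∷ e)
    split (one        , _ ∷ rs) = inj₁ (_ , rs , refl)
    split (zero monic , _ ∷ rs) = inj₂ (_ , (monic , rs) , refl)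

  comb-congruentˡ : ∀ {q n m} {c d : Vec ℤ n} → CongruentVec q c d → (M : Matrix n m) →
    CongruentVec q (comb c M) (comb d M)
  comb-congruentˡ {m = m} [] [] = congruentVec-refl
  comb-congruentˡ {q} (e ∷ es) (r ∷ rs) = step e r (comb-congruentˡ es rs)
    where
    step : ∀ {m c d} {v w : Vec ℤ m} → Congruent q c d → (r : Vec ℤ m) → CongruentVec q v w →
      CongruentVec q (c ⊛ r ⊕ v) (d ⊛ r ⊕ w)
    step e []      []       = []
    step {c = c} {d} {y ∷ v} {z ∷ w} e (x ∷ r) (f ∷ fs) =
      subst₂ (λ s t → Congruent q (s ℤ.+ y) (t ℤ.+ z)) (ℤ.*-comm x c) (ℤ.*-comm x d) (congruent-step x e f) ∷ step e r fs

  ∣⇒congruent-0 : ∀ {q n} {v : Vec ℤ n} → All ((+ q) ℤ.∣_) v → CongruentVec q v (Vec.replicate n 0ℤ)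
  ∣⇒congruent-0 []       = []
  ∣⇒congruent-0 {v = x ∷ v} (d ∷ ds) = congruent (subst (_ ℤ.∣_) (sym (ℤ.+-identityʳ x)) d) ∷ ∣⇒congruent-0 ds

  deficient⇒monic : ∀ {p n m} {M : Matrix n m} → Prime p → Deficient p M →
    ∃[ d ] (Monic d × All (Residue p) d) × CongruentVec p (comb d M) (Vec.replicate m 0ℤ)
  deficient⇒monic {p} {M = M} isPrime (c , ¬p∣c , p∣comb) with normalise c isPrime ¬p∣c
  ... | k , d , monic , rs , congr = d , (monic , rs) , ∣⇒congruent-0
          (All-∣-resp ℕ.∣-refl (comb-congruentˡ congr M)
            (subst (All _) (sym (comb-⊛ k c M)) (All-∣-⊛ k p∣comb)))

  deficientSize : (n m b p : ℕ) → ⦃ NonZero p ⦄ → ℕ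
  deficientSize n m b p = suc n * p ^ n * (((2 * b) ^ m) ^ n * classSize p b ^ m)

  cover-deficient : ∀ {p} ⦃ _ : NonZero p ⦄ n m b → Prime p →
    Cover (λ (M : Matrix (suc n) m) → All (Box b) M × Deficient p M) (deficientSize n m b p)
  cover-deficient {p} n m b isPrime = cover-⊆
    (λ {M} (i , deficient) → let d , monic , congr = deficient⇒monic isPrime deficient in
      (d , M) , (monic , proj₁ monic , i , congr) , refl)
    (cover-map proj₂ (cover-Σ (cover-monic p n) λ d → choose d))
    where
    choose : ∀ (d : Vec ℤ (suc n)) →
      Cover (λ (M : Matrix (suc n) m) → Monic d × All (Box b) M × CongruentVec p (comb d M) (Vec.replicate m 0ℤ))
        (((2 * b) ^ m) ^ n * classSize p b ^ m)
    -- A cover is due for every `d`, so monicity is decided here and other vectors get the empty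
    -- cover.
    choose d with monic? d
      where
      monic? : ∀ {n} (d : Vec ℤ n) → Dec (Monic d)
      monic? [] = no λ ()
      monic? (x ∷ d) with x ℤ.≟ 1ℤ | x ℤ.≟ 0ℤ
      ... | yes refl | _        = yes one
      ... | no x≢1   | no x≢0   = no λ { one → x≢1 refl ; (zero _) → x≢0 refl }
      ... | no x≢1   | yes refl with monic? d
      ...   | yes monic = yes (zero monic)
      ...   | no ¬monic = no λ { (zero monic) → ¬monic monic }
    ... | yes monic = cover-⊆ proj₂ (cover-combination p b d monic (Vec.replicate m 0ℤ))
    ... | no ¬monic = cover-≤ z≤n (cover-∅ λ (monic , _) → ¬monic monic)

  -- The summand 1 in `classSize` costs no more than a factor 2, but only while `q` does not exceed
  -- the side of the box.
  classSize-≤ : ∀ q ⦃ _ : NonZero q ⦄ b → q ≤ 2 * b → q * classSize q b ≤ 2 * (2 * b)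
  classSize-≤ q b q≤2b = begin
    q * suc (2 * b / q)      ≡⟨ *-suc q (2 * b / q) ⟩
    q + q * (2 * b / q)      ≡⟨ cong (λ t → q + t) (*-comm q (2 * b / q)) ⟩
    q + 2 * b / q * q        ≤⟨ +-mono-≤ q≤2b (m/n*n≤m (2 * b) q) ⟩
    2 * b + 2 * b            ≡⟨ cong (λ t → 2 * b + t) (+-identityʳ (2 * b)) ⟨
    2 * (2 * b)              ∎
    where
    open ≤-Reasoning
    open import Data.Nat.DivMod using (m/n*n≤m)

  -- The congruences save `p ^ m` and the choice of a relation costs `p ^ n`; the hypothesis
  -- `suc n < m` leaves two powers of `p` to spare, which makes the sum over `p` converge.
  deficientSize-≤ : ∀ n m b p ⦃ _ : NonZero p ⦄ → suc n < m → p ≤ 2 * b →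
    p * p * deficientSize n m b p ≤ suc n * 2 ^ m * ((2 * b) ^ m) ^ suc n
  deficientSize-≤ n m b p n<m p≤2b = begin
    p * p * (suc n * p ^ n * (N * c ^ m))   ≡⟨ regroup p (suc n) (p ^ n) N (c ^ m) ⟩
    suc n * N * (p ^ (2 + n) * c ^ m)       ≤⟨ *-monoʳ-≤ (suc n * N) (*-monoˡ-≤ (c ^ m) (^-monoʳ-≤ p n<m)) ⟩
    suc n * N * (p ^ m * c ^ m)             ≡⟨ cong (suc n * N *_) (^-distribʳ-* m p c) ⟨
    suc n * N * (p * c) ^ m                 ≤⟨ *-monoʳ-≤ (suc n * N) (^-monoˡ-≤ m (classSize-≤ p b p≤2b)) ⟩
    suc n * N * (2 * (2 * b)) ^ m           ≡⟨ cong (suc n * N *_) (^-distribʳ-* m 2 (2 * b)) ⟩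
    suc n * N * (2 ^ m * (2 * b) ^ m)       ≡⟨ collect (suc n) N (2 ^ m) ((2 * b) ^ m) ⟩
    suc n * 2 ^ m * ((2 * b) ^ m * N)       ∎
    where
    open ≤-Reasoning
    N = ((2 * b) ^ m) ^ n
    c = classSize p b
    regroup : ∀ p s x N y → p * p * (s * x * (N * y)) ≡ s * N * (p * (p * x) * y)
    regroup = solve-∀
    collect : ∀ s N x y → s * N * (x * y) ≡ s * x * (y * N)
    collect = solve-∀

  -- Primes above the radius of the box

  dot : ∀ {n} → Vec ℤ n → Vec ℤ n → ℤ
  dot []      []      = 0ℤ
  dot (x ∷ v) (y ∷ w) = x ℤ.* y ℤ.+ dot v w

  dot-⊕ˡ : ∀ {n} (u v w : Vec ℤ n) → dot (u ⊕ v) w ≡ dot u w ℤ.+ dot v w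
  dot-⊕ˡ []      []      []      = refl
  dot-⊕ˡ (x ∷ u) (y ∷ v) (z ∷ w) = trans (cong (λ t → (x ℤ.+ y) ℤ.* z ℤ.+ t) (dot-⊕ˡ u v w))
    (identity x y z (dot u w) (dot v w))
    where
    identity : ∀ x y z s t → (x ℤ.+ y) ℤ.* z ℤ.+ (s ℤ.+ t) ≡ (x ℤ.* z ℤ.+ s) ℤ.+ (y ℤ.* z ℤ.+ t)
    identity = ℤ.solve-∀

  dot-⊛ˡ : ∀ {n} k (v w : Vec ℤ n) → dot (k ⊛ v) w ≡ k ℤ.* dot v w
  dot-⊛ˡ k []      []      = sym (ℤ.*-zeroʳ k)
  dot-⊛ˡ k (x ∷ v) (y ∷ w) = trans (cong (λ t → k ℤ.* x ℤ.* y ℤ.+ t) (dot-⊛ˡ k v w)) (identity k x y (dot v w))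
    where
    identity : ∀ k x y s → k ℤ.* x ℤ.* y ℤ.+ k ℤ.* s ≡ k ℤ.* (x ℤ.* y ℤ.+ s)
    identity = ℤ.solve-∀

  dot-⊛ʳ : ∀ {n} k (v w : Vec ℤ n) → dot v (k ⊛ w) ≡ k ℤ.* dot v w
  dot-⊛ʳ k []      []      = sym (ℤ.*-zeroʳ k)
  dot-⊛ʳ k (x ∷ v) (y ∷ w) = trans (cong (λ t → x ℤ.* (k ℤ.* y) ℤ.+ t) (dot-⊛ʳ k v w)) (identity k x y (dot v w))
    where
    identity : ∀ k x y s → x ℤ.* (k ℤ.* y) ℤ.+ k ℤ.* s ≡ k ℤ.* (x ℤ.* y ℤ.+ s)
    identity = ℤ.solve-∀

  dot-0ʳ : ∀ {n} (v : Vec ℤ n) → dot v (replicate n 0ℤ) ≡ 0ℤ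
  dot-0ʳ []      = refl
  dot-0ʳ (x ∷ v) = cong₂ ℤ._+_ (ℤ.*-zeroʳ x) (dot-0ʳ v)

  dot-0ˡ : ∀ {n} (v : Vec ℤ n) → dot (replicate n 0ℤ) v ≡ 0ℤ
  dot-0ˡ []      = refl
  dot-0ˡ (x ∷ v) = cong₂ ℤ._+_ (ℤ.*-zeroˡ x) (dot-0ˡ v)

  dot-comb : ∀ {n m} (c : Vec ℤ n) (X : Matrix n m) w → All (λ r → dot r w ≡ 0ℤ) X → dot (comb c X) w ≡ 0ℤ
  dot-comb []      []       w []           = dot-0ˡ w
  dot-comb (c ∷ cs) (r ∷ rs) w (r·w≡0 ∷ rest) = trans (dot-⊕ˡ (c ⊛ r) (comb cs rs) w)
    (cong₂ ℤ._+_ (trans (dot-⊛ˡ c r w) (trans (cong (c ℤ.*_) r·w≡0) (ℤ.*-zeroʳ c))) (dot-comb cs rs w rest))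

  ∣-dot : ∀ {n d} {v : Vec ℤ n} → All (d ℤ.∣_) v → ∀ w → d ℤ.∣ dot v w
  ∣-dot []       []      = _ ∣0ℤ
  ∣-dot (e ∷ es) (y ∷ w) = ℤ.∣m∣n⇒∣m+n (ℤ.∣m⇒∣m*n y e) (∣-dot es w)

  Bounded : ∀ {n} → ℕ → Vec ℤ n → Set
  Bounded c = All (λ x → ℤ.∣ x ∣ ≤ c)

  ∣dot∣-≤ : ∀ {n c d} {v w : Vec ℤ n} → Bounded c v → Bounded d w → ℤ.∣ dot v w ∣ ≤ n * (c * d)
  ∣dot∣-≤ {v = []}    {[]}    []       []       = z≤n
  ∣dot∣-≤ {v = x ∷ v} {y ∷ w} (p ∷ ps) (q ∷ qs) = ≤-trans (ℤ.∣i+j∣≤∣i∣+∣j∣ (x ℤ.* y) (dot v w))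
    (+-mono-≤ (≤-trans (≤-reflexive (ℤ.∣i*j∣≡∣i∣*∣j∣ x y)) (*-mono-≤ p q)) (∣dot∣-≤ ps qs))

  IsZero : ∀ {n} → Vec ℤ n → Set
  IsZero = All (_≡ 0ℤ)

  data Selects {A : Set} : ∀ {n} → Vec A (suc n) → A → Vec A n → Set where
    here  : ∀ {n x} {xs : Vec A n} → Selects (x ∷ xs) x xs
    there : ∀ {n x y} {xs : Vec A (suc n)} {ys} → Selects xs x ys → Selects (y ∷ xs) x (y ∷ ys)

  selects-All⁺ : ∀ {A : Set} {P : A → Set} {n} {xs : Vec A (suc n)} {x ys} →
    Selects xs x ys → P x → All P ys → All P xs
  selects-All⁺ here      p ps       = p ∷ ps
  selects-All⁺ (there s) p (q ∷ ps) = q ∷ selects-All⁺ s p ps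

  selects-All⁻ : ∀ {A : Set} {P : A → Set} {n} {xs : Vec A (suc n)} {x ys} →
    Selects xs x ys → All P xs → P x × All P ys
  selects-All⁻ here      (p ∷ ps) = p , ps
  selects-All⁻ (there s) (q ∷ ps) = let p , rest = selects-All⁻ s ps in p , q ∷ rest

  selectRow : ∀ {n m} (X : Matrix (suc n) (suc m)) →
    All (λ r → head r ≡ 0ℤ) X ⊎ (∃[ x ] ∃[ ys ] Selects X x ys × head x ≢ 0ℤ)
  selectRow (r ∷ rs) with head r ℤ.≟ 0ℤ
  ... | no r₀≢0 = inj₂ (r , rs , here , r₀≢0)
  selectRow (r ∷ [])         | yes r₀≡0 = inj₁ (r₀≡0 ∷ [])
  selectRow (r ∷ rs@(_ ∷ _)) | yes r₀≡0 with selectRow rs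
  ... | inj₁ zeros             = inj₁ (r₀≡0 ∷ zeros)
  ... | inj₂ (x , ys , s , x₀) = inj₂ (x , r ∷ ys , there s , x₀)

  -- Cross multiplication by the leading entries avoids division.
  eliminate : ∀ {m} → Vec ℤ (suc m) → Vec ℤ (suc m) → Vec ℤ m
  eliminate x r = head x ⊛ tail r ⊕ (ℤ.- head r) ⊛ tail x

  -- Gaussian elimination doubles the exponent at every step, which is harmless: only a bound
  -- polynomial in the size of the entries is needed.
  nullExponent : ℕ → ℕ → ℕ
  nullExponent zero    e = 0
  nullExponent (suc n) e = suc e + nullExponent n (suc e + e)

  -- The vector depends on `X` alone; the box enters only through `bounded`, where `2 ≤ b` and
  -- `m ≤ b` turn numerical factors into powers of `b`.
  record NullVector {n m} (X : Matrix n m) : Set where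
    field
      vector  : Vec ℤ m
      nonzero : ¬ IsZero vector
      kills   : All (λ r → dot r vector ≡ 0ℤ) X
      bounded : ∀ b e → 2 ≤ b → m ≤ b → All (Bounded (b ^ e)) X → Bounded (b ^ nullExponent n e) vector

  open NullVector

  unitVector : ∀ m → Vec ℤ (suc m)
  unitVector m = 1ℤ ∷ replicate m 0ℤ

  unitVector-bounded : ∀ m c → 1 ≤ c → Bounded c (unitVector m)
  unitVector-bounded m c 1≤c = 1≤c ∷ zeros m
    where
    zeros : ∀ m → Bounded c (replicate m 0ℤ)
    zeros zero    = []
    zeros (suc m) = z≤n ∷ zeros m

  1≤^ : ∀ b e → 2 ≤ b → 1 ≤ b ^ e
  1≤^ b e 2≤b = m^n>0 b ⦃ >-nonZero (≤-trans (s≤s z≤n) 2≤b) ⦄ e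

  -- If the first column vanishes, the first unit vector is orthogonal to every row. Otherwise a row
  -- with nonzero leading entry is used to remove one row and one column, which preserves `n < m`.
  nullVector : ∀ {n m} → n < m → (X : Matrix n m) → NullVector X
  nullVector {zero} {suc m} n<m [] = record
    { vector  = unitVector m
    ; nonzero = λ { (() ∷ _) }
    ; kills   = []
    ; bounded = λ b e 2≤b m≤b _ → unitVector-bounded m 1 ≤-refl
    }
  nullVector {suc n} {suc m} (s≤s n<m) X with selectRow X
  ... | inj₁ heads≡0 = record
    { vector  = unitVector m
    ; nonzero = λ { (() ∷ _) }
    ; kills   = All.map (λ {r} → killed r) heads≡0
    ; bounded = λ b e 2≤b m≤b _ → unitVector-bounded m _ (1≤^ b (nullExponent (suc n) e) 2≤b)
    }
    where
    killed : ∀ r → head r ≡ 0ℤ → dot r (unitVector m) ≡ 0ℤ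
    killed (x ∷ r) x≡0 = cong₂ ℤ._+_ (trans (ℤ.*-identityʳ x) x≡0) (dot-0ʳ r)
  ... | inj₂ (x , ys , selects , x₀≢0) = record
    { vector  = vec
    ; nonzero = λ { (_ ∷ zeros) → nonzero rec (cancel (vector rec) zeros) }
    ; kills   = selects-All⁺ selects (killed-x x refl) (killed-ys ys (kills rec))
    ; bounded = bound
    }
    where
    rec : NullVector (map (eliminate x) ys)
    rec = nullVector n<m (map (eliminate x) ys)
    w = vector rec
    a = head x
    -- Orthogonality to the pivot row `x` determines the first entry, and the factor `a` on the
    -- others clears its denominator.
    vec = (ℤ.- dot (tail x) w) ∷ a ⊛ w

    cancel : ∀ {k} (v : Vec ℤ k) → IsZero (a ⊛ v) → IsZero v
    cancel []      []       = []
    cancel (y ∷ v) (z ∷ zs) with ℤ.i*j≡0⇒i≡0∨j≡0 a z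
    ... | inj₁ a≡0 = contradiction a≡0 x₀≢0
    ... | inj₂ y≡0 = y≡0 ∷ cancel v zs

    dot-vec : ∀ r → dot r vec ≡ dot (eliminate x r) w
    dot-vec (y ∷ r) = trans (cong (λ t → y ℤ.* (ℤ.- dot (tail x) w) ℤ.+ t) (dot-⊛ʳ a r w))
      (trans (identity y (dot (tail x) w) a (dot r w))
        (sym (trans (dot-⊕ˡ (a ⊛ r) ((ℤ.- y) ⊛ tail x) w)
          (cong₂ ℤ._+_ (dot-⊛ˡ a r w) (dot-⊛ˡ (ℤ.- y) (tail x) w)))))
      where
      identity : ∀ y d a e → y ℤ.* (ℤ.- d) ℤ.+ a ℤ.* e ≡ a ℤ.* e ℤ.+ (ℤ.- y) ℤ.* d
      identity = ℤ.solve-∀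

    killed-x : ∀ y → y ≡ x → dot y vec ≡ 0ℤ
    killed-x y@(y₀ ∷ y′) refl = trans (cong (λ t → y₀ ℤ.* (ℤ.- dot y′ w) ℤ.+ t) (dot-⊛ʳ y₀ y′ w))
      (identity y₀ (dot y′ w))
      where
      identity : ∀ y d → y ℤ.* (ℤ.- d) ℤ.+ y ℤ.* d ≡ 0ℤ
      identity = ℤ.solve-∀

    killed-ys : ∀ {k} (ys : Matrix k (suc m)) → All (λ r → dot r w ≡ 0ℤ) (map (eliminate x) ys) →
      All (λ r → dot r vec ≡ 0ℤ) ys
    killed-ys []       []       = []
    killed-ys (y ∷ ys) (k ∷ ks) = trans (dot-vec y) k ∷ killed-ys ys ks

    bound : ∀ b e → 2 ≤ b → suc m ≤ b → All (Bounded (b ^ e)) X → Bounded (b ^ nullExponent (suc n) e) vec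
    bound b e 2≤b m<b X≤ = dot-bound ∷ scaled w≤
      where
      open ≤-Reasoning
      x≤ = proj₁ (selects-All⁻ selects X≤)
      ys≤ = proj₂ (selects-All⁻ selects X≤)
      f = nullExponent n (suc e + e)

      eliminate-entries : ∀ {k} s t {u v : Vec ℤ k} → ℤ.∣ s ∣ ≤ b ^ e → ℤ.∣ t ∣ ≤ b ^ e →
        Bounded (b ^ e) u → Bounded (b ^ e) v → Bounded (b ^ (suc e + e)) (s ⊛ u ⊕ (ℤ.- t) ⊛ v)
      eliminate-entries s t {[]}    {[]}    s≤ t≤ []       []       = []
      eliminate-entries s t {y ∷ u} {z ∷ v} s≤ t≤ (p ∷ ps) (q ∷ qs) = (begin
        ℤ.∣ s ℤ.* y ℤ.+ (ℤ.- t) ℤ.* z ∣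
          ≤⟨ ℤ.∣i+j∣≤∣i∣+∣j∣ (s ℤ.* y) ((ℤ.- t) ℤ.* z) ⟩
        ℤ.∣ s ℤ.* y ∣ + ℤ.∣ (ℤ.- t) ℤ.* z ∣
          ≡⟨ cong₂ _+_ (ℤ.∣i*j∣≡∣i∣*∣j∣ s y)
               (trans (ℤ.∣i*j∣≡∣i∣*∣j∣ (ℤ.- t) z) (cong (_* ℤ.∣ z ∣) (ℤ.∣-i∣≡∣i∣ t))) ⟩
        ℤ.∣ s ∣ * ℤ.∣ y ∣ + ℤ.∣ t ∣ * ℤ.∣ z ∣
          ≤⟨ +-mono-≤ (*-mono-≤ s≤ p) (*-mono-≤ t≤ q) ⟩
        b ^ e * b ^ e + b ^ e * b ^ e
          ≡⟨ cong (λ c → b ^ e * b ^ e + c) (+-identityʳ (b ^ e * b ^ e)) ⟨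
        2 * (b ^ e * b ^ e)
          -- The factor 2 is paid for with one more power of `b`, whence the exponent `suc e + e` in
          -- `nullExponent`.
          ≤⟨ *-monoˡ-≤ (b ^ e * b ^ e) 2≤b ⟩
        b * (b ^ e * b ^ e)
          ≡⟨ cong (b *_) (^-distribˡ-+-* b e e) ⟨
        b ^ (suc e + e) ∎) ∷ eliminate-entries s t s≤ t≤ ps qs

      head≤ : ∀ {k c} {v : Vec ℤ (suc k)} → Bounded c v → ℤ.∣ head v ∣ ≤ c
      head≤ = All-head {P = λ y → ℤ.∣ y ∣ ≤ _}
      tail≤ : ∀ {k c} {v : Vec ℤ (suc k)} → Bounded c v → Bounded c (tail v)
      tail≤ = All-tail {P = λ y → ℤ.∣ y ∣ ≤ _}

      eliminated : ∀ {k} {ys : Matrix k (suc m)} → All (Bounded (b ^ e)) ys →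
        All (Bounded (b ^ (suc e + e))) (map (eliminate x) ys)
      eliminated []                   = []
      eliminated {ys = r ∷ _} (y ∷ ys) = eliminate-entries a (head r) (head≤ x≤) (head≤ y) (tail≤ y) (tail≤ x≤) ∷ eliminated ys

      w≤ : Bounded (b ^ f) w
      w≤ = bounded rec b (suc e + e) 2≤b (≤-trans (n≤1+n m) m<b) (eliminated ys≤)

      scaled : ∀ {k} {v : Vec ℤ k} → Bounded (b ^ f) v → Bounded (b ^ (suc e + f)) (a ⊛ v)
      scaled []                 = []
      scaled {v = y ∷ v} (p ∷ ps) = (begin
        ℤ.∣ a ℤ.* y ∣         ≡⟨ ℤ.∣i*j∣≡∣i∣*∣j∣ a y ⟩
        ℤ.∣ a ∣ * ℤ.∣ y ∣     ≤⟨ *-mono-≤ (head≤ x≤) p ⟩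
        b ^ e * b ^ f         ≡⟨ ^-distribˡ-+-* b e f ⟨
        b ^ (e + f)           ≤⟨ ^-monoʳ-≤ b ⦃ >-nonZero (≤-trans (s≤s z≤n) 2≤b) ⦄ (n≤1+n (e + f)) ⟩
        b ^ (suc e + f)       ∎) ∷ scaled ps

      dot-bound : ℤ.∣ ℤ.- dot (tail x) w ∣ ≤ b ^ (suc e + f)
      dot-bound = begin
        ℤ.∣ ℤ.- dot (tail x) w ∣  ≡⟨ ℤ.∣-i∣≡∣i∣ (dot (tail x) w) ⟩
        ℤ.∣ dot (tail x) w ∣      ≤⟨ ∣dot∣-≤ (tail≤ x≤) w≤ ⟩
        m * (b ^ e * b ^ f)       ≤⟨ *-monoˡ-≤ (b ^ e * b ^ f) (≤-trans (n≤1+n m) m<b) ⟩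
        b * (b ^ e * b ^ f)       ≡⟨ cong (b *_) (^-distribˡ-+-* b e f) ⟨
        b ^ (suc e + f)           ∎

  -- The product of these primes divides x.
  cover-largePrimes : ∀ b f → 2 ≤ b → ∀ x → x ≢ 0ℤ → ℤ.∣ x ∣ ≤ b ^ f →
    Cover (λ p → Prime p × b < p × (+ p) ℤ.∣ x) f
  cover-largePrimes b f 2≤b x x≢0 x≤ = cover large few λ (isPrime , b<p , p∣x) →
    ∈-filter⁺ (b <?_) (factorisationHasAllPrimeFactors isPrime
      (subst (_ ∣_) (PrimeFactorisation.isFactorisation factorisation) (ℤ.∣⇒∣ᵤ p∣x))
      (PrimeFactorisation.factorsPrime factorisation)) b<p
    where
    instance
      x-nonZero : NonZero ℤ.∣ x ∣
      x-nonZero = ≢-nonZero (x≢0 ∘ ℤ.∣i∣≡0⇒i≡0)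
    factorisation = factorise ℤ.∣ x ∣
    factors = PrimeFactorisation.factors factorisation
    large = filter (b <?_) factors

    power : ∀ ps → ListAll.All Prime ps → b ^ length (filter (b <?_) ps) ≤ product ps
    power []       ListAll.[] = ≤-refl
    power (p ∷ ps) (isPrime ListAll.∷ primes) with b <? p
    ... | yes b<p = subst (λ l → b ^ length l ≤ p * product ps) (sym (List.filter-accept (b <?_) b<p))
                      (*-mono-≤ (<⇒≤ b<p) (power ps primes))
    ... | no  b≮p = subst (λ l → b ^ length l ≤ p * product ps) (sym (List.filter-reject (b <?_) b≮p))
                      (≤-trans (power ps primes) (m≤n*m (product ps) p ⦃ prime⇒nonZero isPrime ⦄))

    few : length large ≤ f
    few = ≮⇒≥ λ f<length → <⇒≱ (^-monoʳ-< b 2≤b f<length)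
      (≤-trans (power factors (PrimeFactorisation.factorsPrime factorisation))
        (≤-trans (≤-reflexive (sym (PrimeFactorisation.isFactorisation factorisation))) x≤))

  -- The coordinate at the first nonzero entry of `w` is determined by the others.
  cover-hyperplane : ∀ b {m} (w : Vec ℤ (suc m)) → ¬ IsZero w → ∀ d →
    Cover (λ r → Box b r × dot r w ≡ d) ((2 * b) ^ m)
  cover-hyperplane b {m} (x ∷ w) ¬zero d with x ℤ.≟ 0ℤ
  cover-hyperplane b {m} (x ∷ w) ¬zero d | no x≢0 = cover-≤ (≤-reflexive (*-identityʳ _)) (cover-⊆
    (λ { {y ∷ r} (i ∷ is , eq) → (r , y) , (is , trans (identity (y ℤ.* x) (dot r w)) (cong (ℤ._- dot r w) eq)) , refl })
    (cover-map (λ (r , y) → y ∷ r) (cover-Σ (cover-vec m (cover-inBox b)) λ r → quotient (d ℤ.- dot r w))))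
    where
    identity : ∀ s t → s ≡ (s ℤ.+ t) ℤ.- t
    identity = ℤ.solve-∀
    instance
      x-nonZero : ℤ.NonZero x
      x-nonZero = ℤ.≢-nonZero x≢0
    quotient : ∀ e → Cover (λ y → y ℤ.* x ≡ e) 1
    quotient e with x ℤ.∣? e
    ... | yes (divides q e≡qx) = cover (q ∷ []) ≤-refl
            λ {y} eq → here (ℤ.*-cancelʳ-≡ y q x (trans eq e≡qx))
    ... | no  x∤e = cover [] z≤n λ {y} eq → contradiction (divides y (sym eq)) x∤e
  cover-hyperplane b {zero}  (x ∷ []) ¬zero d | yes x≡0 = contradiction (x≡0 ∷ []) ¬zero
  cover-hyperplane b {suc m} (x ∷ w)  ¬zero d | yes refl = cover-⊆
    (λ { {y ∷ r} (i ∷ is , eq) → (y , r) , (i , is , trans (sym (identity y (dot r w))) eq) , refl })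
    (cover-map (uncurry _∷_) (cover-× (cover-inBox b) (cover-hyperplane b w (λ zeros → ¬zero (refl ∷ zeros)) d)))
    where
    identity : ∀ y s → y ℤ.* 0ℤ ℤ.+ s ≡ s
    identity = ℤ.solve-∀

  LargeDeficient : ∀ {n m} → ℕ → Matrix n m → Set
  LargeDeficient b M = ∃[ p ] Prime p × b < p × Deficient p M

  comb-zip : ∀ {n m} (d u : Vec ℤ n) (A : Matrix n m) → comb d (zipWith _∷_ u A) ≡ dot d u ∷ comb d A
  comb-zip []      []      []      = refl
  comb-zip (d ∷ ds) (x ∷ u) (r ∷ A) = cong ((d ⊛ (x ∷ r)) ⊕_) (comb-zip ds u A)

  comb-⊕ : ∀ {n m} (c d : Vec ℤ n) (M : Matrix n m) → comb (c ⊕ d) M ≡ comb c M ⊕ comb d M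
  comb-⊕ {m = m} [] [] [] = zeros m
    where
    zeros : ∀ m → replicate m 0ℤ ≡ replicate m 0ℤ ⊕ replicate m 0ℤ
    zeros zero    = refl
    zeros (suc m) = cong (0ℤ ∷_) (zeros m)
  comb-⊕ (c ∷ cs) (d ∷ ds) (r ∷ rs) = trans (cong (((c ℤ.+ d) ⊛ r) ⊕_) (comb-⊕ cs ds rs))
    (distribute r (comb cs rs) (comb ds rs))
    where
    distribute : ∀ {m} (r v w : Vec ℤ m) → ((c ℤ.+ d) ⊛ r) ⊕ (v ⊕ w) ≡ (c ⊛ r ⊕ v) ⊕ (d ⊛ r ⊕ w)
    distribute []      []      []      = refl
    distribute (x ∷ r) (y ∷ v) (z ∷ w) = cong₂ _∷_ (identity c d x y z) (distribute r v w)
      where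
      identity : ∀ c d x y z → (c ℤ.+ d) ℤ.* x ℤ.+ (y ℤ.+ z) ≡ (c ℤ.* x ℤ.+ y) ℤ.+ (d ℤ.* x ℤ.+ z)
      identity = ℤ.solve-∀

  congruent-0⇒∣ : ∀ {q n} {v : Vec ℤ n} → CongruentVec q v (replicate n 0ℤ) → All ((+ q) ℤ.∣_) v
  congruent-0⇒∣ {v = []}    []                 = []
  congruent-0⇒∣ {v = x ∷ v} (congruent d ∷ ds) = subst (_ ℤ.∣_) (ℤ.+-identityʳ x) d ∷ congruent-0⇒∣ ds

  ¬∣monic : ∀ {p n} {d : Vec ℤ n} → Prime p → Monic d → ¬ All ((+ p) ℤ.∣_) d
  ¬∣monic isPrime one          (p∣1 ∷ _) = ∣1⇒⊥ isPrime p∣1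
  ¬∣monic isPrime (zero monic) (_ ∷ p∣d) = ¬∣monic isPrime monic p∣d

  zip-uncons : ∀ {n m} (M : Matrix n (suc m)) → M ≡ zipWith _∷_ (map head M) (map tail M)
  zip-uncons []            = refl
  zip-uncons ((x ∷ r) ∷ M) = cong ((x ∷ r) ∷_) (zip-uncons M)

  -- For p > b a deficient matrix M with first column u and remaining rows r, X satisfies one of:
  -- X is deficient modulo p; r · w = 0, where w is a null vector of X; or p is one of the few
  -- large prime factors of r · w, and u lies in one residue class modulo p determined by r and X.
  module LargeStep (n m b : ℕ) (n<m : n < suc m) (2≤b : 2 ≤ b) (m<b : suc m ≤ b) where

    L : ℕ
    L = 2 * b

    -- One of the two additional powers of `b` bounds an entry of `r`, the other the number `suc m`
    -- of summands in `dot r (w X)`.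
    exponent : ℕ
    exponent = suc (suc (nullExponent n 1))

    w : Matrix n (suc m) → Vec ℤ (suc m)
    w X = vector (nullVector n<m X)

    assemble : (Matrix n (suc m) × Vec ℤ (suc m)) × Vec ℤ (suc n) → Matrix (suc n) (suc (suc m))
    assemble ((X , r) , u) = zipWith _∷_ u (r ∷ X)

    Dependence : ℕ → Vec ℤ (suc m) → Matrix n (suc m) → Vec ℤ n → Set
    Dependence p r X c = All ((+ p) ℤ.∣_) (comb (1ℤ ∷ c) (r ∷ X))

    dependence? : ∀ p r X c → Dec (Dependence p r X c)
    dependence? p r X c = All.all? ((+ p) ℤ.∣?_) (comb (1ℤ ∷ c) (r ∷ X))

    -- Listing all reduced relations in a fixed order makes the first of them a choice that depends
    -- on `p`, `r` and `X` but not on the column `u`.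
    dependences : ℕ → Vec ℤ (suc m) → Matrix n (suc m) → List (Vec ℤ n)
    dependences p r X = filter (dependence? p r X) (vecs (residues p) n)

    bounded-dot : ∀ {X r} → All (Box b) X → Box b r → ℤ.∣ dot r (w X) ∣ ≤ b ^ exponent
    bounded-dot {X} {r} X∈ r∈ = begin
      ℤ.∣ dot r (w X) ∣                          ≤⟨ ∣dot∣-≤ (All.map entry r∈)
                                                      (bounded (nullVector n<m X) b 1 2≤b m<b
                                                        (All.map (All.map entry) X∈)) ⟩
      suc m * (b ^ 1 * b ^ nullExponent n 1)     ≤⟨ *-monoˡ-≤ (b ^ 1 * b ^ nullExponent n 1) m<b ⟩
      b * (b ^ 1 * b ^ nullExponent n 1)         ≡⟨ cong (λ t → b * (t * b ^ nullExponent n 1)) (*-identityʳ b) ⟩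
      b ^ exponent                               ∎
      where
      open ≤-Reasoning
      entry : ∀ {z} → InBox b z → ℤ.∣ z ∣ ≤ b ^ 1
      entry {z} (-b≤z , z<b) = subst (ℤ.∣ z ∣ ≤_) (sym (*-identityʳ b)) (go z -b≤z z<b)
        where
        go : ∀ z → ℤ.- (+ b) ℤ.≤ z → z ℤ.< + b → ℤ.∣ z ∣ ≤ b
        go (+ k)      _    z<b = <⇒≤ (ℤ.drop‿+<+ z<b)
        go -[1+ k ]   -b≤z _   = ℤ.drop‿+≤+ (subst (+ suc k ℤ.≤_) (ℤ.neg-involutive (+ b)) (ℤ.neg-mono-≤ -b≤z))

    Degenerate : Matrix n (suc m) × Vec ℤ (suc m) → Set
    Degenerate (X , r) = All (Box b) X × Box b r × dot r (w X) ≡ 0ℤ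

    -- The conditions on `X` and `r` are repeated here because the number of primes has to be
    -- bounded for every pair, including those outside the box or with vanishing scalar product.
    Candidate : (Matrix n (suc m) × Vec ℤ (suc m)) → ℕ → Set
    Candidate (X , r) p = (All (Box b) X × Box b r) × dot r (w X) ≢ 0ℤ × Prime p × b < p × (+ p) ℤ.∣ dot r (w X)

    InClass : (Matrix n (suc m) × Vec ℤ (suc m)) → ℕ → Vec ℤ (suc n) → Set
    InClass (X , r) p u = b < p × Box b u × ∃[ c ] ∃[ cs ] dependences p r X ≡ c ∷ cs × (+ p) ℤ.∣ dot (1ℤ ∷ c) u

    inBox? : ∀ z → Dec (InBox b z)
    inBox? z = (ℤ.- (+ b) ℤ.≤? z) ×-dec (z ℤ.<? + b)
      where open import Relation.Nullary.Decidable using (_×-dec_)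

    cover-candidate : ∀ Xr → Cover (Candidate Xr) exponent
    cover-candidate (X , r) with All.all? (All.all? inBox?) X | All.all? inBox? r | dot r (w X) ℤ.≟ 0ℤ
    ... | yes X∈ | yes r∈ | no ≢0 = cover-⊆ (λ (_ , _ , candidate) → candidate)
            (cover-largePrimes b exponent 2≤b (dot r (w X)) ≢0 (bounded-dot X∈ r∈))
    ... | no X∉  | _      | _      = cover-≤ z≤n (cover-∅ λ ((X∈ , _) , _) → X∉ X∈)
    ... | yes _  | no r∉  | _      = cover-≤ z≤n (cover-∅ λ ((_ , r∈) , _) → r∉ r∈)
    ... | yes _  | yes _  | yes ≡0 = cover-≤ z≤n (cover-∅ λ (_ , ≢0 , _) → ≢0 ≡0)

    -- The relation has leading coefficient 1, so it fixes the class modulo `p` of the first entry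
    -- of `u` in terms of the others; for `p > b` such a class meets the box at most twice.
    cover-inClass : ∀ Xr p → Cover (InClass Xr p) (L ^ n * 2)
    cover-inClass (X , r) p with b <? p | dependences p r X in eq
    ... | no b≮p  | _      = cover-≤ z≤n (cover-∅ λ (b<p , _) → b≮p b<p)
    ... | yes _   | []     = cover-≤ z≤n (cover-∅ λ { (_ , _ , _ , _ , () , _) })
    ... | yes b<p | c ∷ cs = cover-⊆
            (λ { {x ∷ u} (_ , i ∷ is , _ , _ , refl , p∣) → (u , x) , (is , i , congruent (subst ((+ p) ℤ.∣_) (identity x (dot c u)) p∣)) , refl })
            (cover-map (λ (u , x) → x ∷ u) (cover-Σ (cover-vec n (cover-inBox b))
              (λ u → cover-≤ (s≤s (≤-pred (m<n*o⇒m/o<n {2 * b} {2} {p} (*-monoʳ-< 2 b<p)))) (cover-class p b (ℤ.- dot c u)))))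
      where
      instance
        p-nonZero : NonZero p
        p-nonZero = >-nonZero (≤-<-trans z≤n b<p)
      identity : ∀ x s → 1ℤ ℤ.* x ℤ.+ s ≡ x ℤ.- (ℤ.- s)
      identity = ℤ.solve-∀

    Classified : (Matrix n (suc m) × Vec ℤ (suc m)) × Vec ℤ (suc n) → Set
    Classified ((X , r) , u) =
      (((All (Box b) X × LargeDeficient b X) × Box b r) × Box b u ⊎
      Degenerate (X , r) × Box b u) ⊎
      (All (Box b) X × Box b r) × ∃[ p ] Candidate (X , r) p × InClass (X , r) p u

    classify : ∀ X r u → All (Box b) X → Box b r → Box b u →
      LargeDeficient b (assemble ((X , r) , u)) → Classified ((X , r) , u)
    classify X r u X∈ r∈ u∈ (p , isPrime , b<p , deficient)
      with deficient⇒monic isPrime deficient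
    ... | d , (monic , reduced) , congr
      with subst (All ((+ p) ℤ.∣_)) (comb-zip d u (r ∷ X)) (congruent-0⇒∣ congr)
    ... | p∣dot ∷ p∣comb = cases d monic reduced p∣dot p∣comb
      where
      cases : ∀ d → Monic d → All (Residue p) d → (+ p) ℤ.∣ dot d u →
        All ((+ p) ℤ.∣_) (comb d (r ∷ X)) → Classified ((X , r) , u)
      cases (0ℤ ∷ d) (zero monic) _ _ p∣comb =
        inj₁ (inj₁ (((X∈ , p , isPrime , b<p , d , ¬∣monic isPrime monic ,
          subst (All _) (0⊛⊕ r (comb d X)) p∣comb) , r∈) , u∈))
      cases (1ℤ ∷ c) one (_ ∷ reduced) p∣dot p∣comb with dot r (w X) ℤ.≟ 0ℤ
      ... | yes ≡0 = inj₁ (inj₂ ((X∈ , r∈ , ≡0) , u∈))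
      ... | no  ≢0 = match (dependences p r X) refl
        where
        member : c ∈ dependences p r X
        member = ∈-filter⁺ (dependence? p r X) (∈-vecs⁺ reduced) p∣comb

        -- The vector `w X` annihilates the rows of `X`, so the scalar product with the relation
        -- retains only the contribution of `r`.
        p∣r·w : (+ p) ℤ.∣ dot r (w X)
        p∣r·w = subst ((+ p) ℤ.∣_)
          (trans (dot-comb′ (1ℤ ⊛ r) (comb c X) (dot-comb c X (w X) (kills (nullVector n<m X))))
            (trans (dot-⊛ˡ 1ℤ r (w X)) (ℤ.*-identityˡ _)))
          (∣-dot p∣comb (w X))
          where
          dot-comb′ : ∀ s t → dot t (w X) ≡ 0ℤ → dot (s ⊕ t) (w X) ≡ dot s (w X)
          dot-comb′ s t ≡0 = trans (dot-⊕ˡ s t (w X)) (trans (cong (λ e → dot s (w X) ℤ.+ e) ≡0) (ℤ.+-identityʳ _))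

        match : ∀ ds → dependences p r X ≡ ds → Classified ((X , r) , u)
        match []       eq = contradiction (subst (c ∈_) eq member) λ ()
        match (c′ ∷ cs) eq with ≡-dec ℤ._≟_ c c′
        ... | yes refl = inj₂ ((X∈ , r∈) , p , ((X∈ , r∈) , ≢0 , isPrime , b<p , p∣r·w) ,
                            (b<p , u∈ , c , cs , eq , p∣dot))
        -- In the difference of two relations with coefficient 1 at `r` that row drops out, and a
        -- relation between the rows of `X` remains. It is nontrivial because distinct reduced
        -- vectors are incongruent.
        ... | no  c≢c′ = inj₁ (inj₁ (((X∈ , p , isPrime , b<p , c ⊕ -1ℤ ⊛ c′ , distinct , divisible) , r∈) , u∈))
          where
          c′-properties : c′ ∈ vecs (residues p) n × Dependence p r X c′
          c′-properties = ∈-filter⁻ (dependence? p r X) {xs = vecs (residues p) n}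
            (subst (c′ ∈_) (sym eq) (here refl))

          residues-≡ : ∀ {k} {c c′ : Vec ℤ k} → All (Residue p) c → All (Residue p) c′ →
            All ((+ p) ℤ.∣_) (c ⊕ -1ℤ ⊛ c′) → c ≡ c′
          residues-≡ {c = []}    {[]}     []       []        []       = refl
          residues-≡ {c = x ∷ c} {y ∷ c′} (i ∷ is) (j ∷ js) (e ∷ es) = cong₂ _∷_ (same i j) (residues-≡ is js es)
            where
            identity : ∀ x y → x ℤ.+ -1ℤ ℤ.* y ≡ x ℤ.- y
            identity = ℤ.solve-∀
            same : Residue p x → Residue p y → x ≡ y
            same i j with interval-∈ 0ℤ p i | interval-∈ 0ℤ p j
            ... | k , k<p , refl | l , l<p , refl =
              cong +_ (congruent⇒≡ k<p l<p (congruent (subst ((+ p) ℤ.∣_) (identity (+ k) (+ l)) e)))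

          distinct : ¬ All ((+ p) ℤ.∣_) (c ⊕ -1ℤ ⊛ c′)
          distinct p∣ = c≢c′ (residues-≡ reduced (∈-vecs⁻ (residues p) (proj₁ c′-properties)) p∣)

          divisible : All ((+ p) ℤ.∣_) (comb (c ⊕ -1ℤ ⊛ c′) X)
          divisible = subst (All _) (sym (trans (comb-⊕ c (-1ℤ ⊛ c′) X) (cong (comb c X ⊕_) (comb-⊛ -1ℤ c′ X))))
            (subtract r p∣comb (proj₂ c′-properties))
            where
            identity : ∀ x y z → (1ℤ ℤ.* x ℤ.+ y) ℤ.- (1ℤ ℤ.* x ℤ.+ z) ≡ y ℤ.+ -1ℤ ℤ.* z
            identity = ℤ.solve-∀
            subtract : ∀ {k} {v v′ : Vec ℤ k} (r : Vec ℤ k) → All ((+ p) ℤ.∣_) (1ℤ ⊛ r ⊕ v) →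
              All ((+ p) ℤ.∣_) (1ℤ ⊛ r ⊕ v′) → All ((+ p) ℤ.∣_) (v ⊕ -1ℤ ⊛ v′)
            subtract {v = []}    {[]}     []      []       []       = []
            subtract {v = y ∷ v} {z ∷ v′} (x ∷ r) (e ∷ es) (f ∷ fs) =
              subst ((+ p) ℤ.∣_) (identity x y z) (ℤ.∣m∣n⇒∣m-n e f) ∷ subtract r es fs

    -- One summand for each of the three alternatives. The last two fall short of the number of all
    -- matrices by a factor of order `L`, and the first does so whenever `s` does.
    classifiedSize : ℕ → ℕ
    classifiedSize s = s * L ^ suc m * L ^ suc n + (L ^ suc m) ^ n * L ^ m * L ^ suc n +
      (L ^ suc m) ^ n * L ^ suc m * (exponent * (L ^ n * 2))

    cover-classified : ∀ {s} → Cover (λ (X : Matrix n (suc m)) → All (Box b) X × LargeDeficient b X) s →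
      Cover Classified (classifiedSize s)
    cover-classified c = cover-∪
      (cover-∪ (cover-× (cover-× c (cover-vec (suc m) (cover-inBox b))) boxᵘ)
        (cover-× (cover-Σ boxˣ (λ X → cover-hyperplane b (w X) (nonzero (nullVector n<m X)) 0ℤ)) boxᵘ))
      (cover-Σ (cover-× boxˣ (cover-vec (suc m) (cover-inBox b))) λ Xr →
        cover-⊆ (λ { {u} (p , candidate , inClass) → (p , u) , (candidate , inClass) , refl })
          (cover-map proj₂ (cover-Σ (cover-candidate Xr) (cover-inClass Xr))))
      where
      boxᵘ = cover-vec (suc n) (cover-inBox b)
      boxˣ = cover-vec n (cover-vec (suc m) (cover-inBox b))

    cover-step : ∀ {s} → Cover (λ (X : Matrix n (suc m)) → All (Box b) X × LargeDeficient b X) s →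
      Cover (λ (M : Matrix (suc n) (suc (suc m))) → All (Box b) M × LargeDeficient b M) (classifiedSize s)
    cover-step c = cover-⊆ decompose (cover-map assemble (cover-classified c))
      where
      heads : ∀ {k l} {M : Matrix k (suc l)} → All (Box b) M → Box b (map head M)
      heads []       = []
      heads (r ∷ rs) = All-head r ∷ heads rs
      tails : ∀ {k l} {M : Matrix k (suc l)} → All (Box b) M → All (Box b) (map tail M)
      tails []       = []
      tails (r ∷ rs) = All-tail r ∷ tails rs

      decompose : ∀ {M} → All (Box b) M × LargeDeficient b M → ∃[ x ] Classified x × M ≡ assemble x
      decompose {r ∷ X} (r∈ ∷ X∈ , large) = ((map tail X , tail r) , map head (r ∷ X)) ,
        classify (map tail X) (tail r) (map head (r ∷ X)) (tails X∈) (All-tail r∈) (heads (r∈ ∷ X∈))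
          (subst (LargeDeficient b) (zip-uncons (r ∷ X)) large) ,
        zip-uncons (r ∷ X)

    classifiedSize-≤ : ∀ {s c} → s * L ≤ c * (L ^ suc m) ^ n →
      classifiedSize s * L ≤ (c + 1 + 2 * exponent) * (L ^ suc (suc m)) ^ suc n
    classifiedSize-≤ {s} {c} bound = begin
      classifiedSize s * L
        ≡⟨ expand s L (L ^ m) (L ^ n) N exponent ⟩
      s * L * (Y * Z) + (1 + 2 * exponent) * (N * (Y * Z))
        ≤⟨ +-monoˡ-≤ _ (*-monoˡ-≤ (Y * Z) bound) ⟩
      c * N * (Y * Z) + (1 + 2 * exponent) * (N * (Y * Z))
        ≡⟨ collect c exponent N Y Z ⟩
      (c + 1 + 2 * exponent) * (Z * (Y * N))
        ≡⟨ cong ((c + 1 + 2 * exponent) *_) (^-distribʳ-* (suc n) L (L ^ suc m)) ⟨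
      (c + 1 + 2 * exponent) * (L ^ suc (suc m)) ^ suc n ∎
      where
      open ≤-Reasoning
      N = (L ^ suc m) ^ n
      Y = L ^ suc m
      Z = L ^ suc n
      expand : ∀ s L x y N e →
        (s * (L * x) * (L * y) + N * x * (L * y) + N * (L * x) * (e * (y * 2))) * L ≡
        s * L * ((L * x) * (L * y)) + (1 + 2 * e) * (N * ((L * x) * (L * y)))
      expand = solve-∀
      collect : ∀ c e N Y Z → c * N * (Y * Z) + (1 + 2 * e) * (N * (Y * Z)) ≡ (c + 1 + 2 * e) * (Z * (Y * N))
      collect = solve-∀

  largeConstant : ℕ → ℕ
  largeConstant zero    = 0
  largeConstant (suc n) = largeConstant n + 1 + 2 * suc (suc (nullExponent n 1))

  -- All primes above `b` are treated at once: the induction removes a row and a column, without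
  -- rows there is no relation, and every step adds a constant to the numerator of a proportion
  -- O(1/b).
  cover-largeDeficient : ∀ {n m} b → n < m → 2 ≤ b → m ≤ b →
    ∃[ s ] Cover (λ (M : Matrix n m) → All (Box b) M × LargeDeficient b M) s ×
      s * (2 * b) ≤ largeConstant n * ((2 * b) ^ m) ^ n
  cover-largeDeficient {zero} b n<m 2≤b m≤b =
    0 , cover-∅ (λ { (_ , _ , _ , _ , [] , ¬p∣c , _) → ¬p∣c [] }) , z≤n
  cover-largeDeficient {suc n} {suc (suc m)} b (s≤s n<m) 2≤b m≤b
    with cover-largeDeficient b n<m 2≤b (≤-trans (n≤1+n _) m≤b)
  ... | s , c , bound = classifiedSize s , cover-step c , classifiedSize-≤ {s} {largeConstant n} bound
    where open LargeStep n m b n<m 2≤b (≤-trans (n≤1+n _) m≤b)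
  cover-largeDeficient {suc n} {suc zero} b (s≤s ()) 2≤b m≤b

  -- The sieve

  unique-length : ∀ {A : Set} {xs ys : List A} → Unique xs → (∀ {x} → x ∈ xs → x ∈ ys) → length xs ≤ length ys
  unique-length {xs = []}     [] xs⊆ys = z≤n
  unique-length {xs = x ∷ xs} (x∉xs ∷ unique) xs⊆ys with ∈-∃++ (xs⊆ys (here refl))
  ... | as , bs , refl = begin
    suc (length xs)            ≤⟨ s≤s (unique-length unique remove) ⟩
    suc (length (as ++ bs))    ≡⟨ cong suc (List.length-++ as) ⟩
    suc (length as + length bs) ≡⟨ +-suc (length as) (length bs) ⟨
    length as + length (x ∷ bs) ≡⟨ List.length-++ as ⟨
    length (as ++ x ∷ bs)      ∎
    where
    open ≤-Reasoning
    remove : ∀ {y} → y ∈ xs → y ∈ as ++ bs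
    remove y∈xs with ∈-++⁻ as (xs⊆ys (there y∈xs))
    ... | inj₁ y∈as         = ∈-++⁺ˡ y∈as
    ... | inj₂ (here y≡x)   = contradiction (sym y≡x) (ListAll.lookup x∉xs y∈xs)
    ... | inj₂ (there y∈bs) = ∈-++⁺ʳ as y∈bs

  unique-interval : ∀ a l → Unique (interval a l)
  unique-interval a zero    = []
  unique-interval a (suc l) = ListAll.tabulate fresh ∷ unique-interval (a ℤ.+ 1ℤ) l
    where
    fresh : ∀ {z} → z ∈ interval (a ℤ.+ 1ℤ) l → a ≢ z
    fresh z∈ a≡z with interval-∈ (a ℤ.+ 1ℤ) l z∈
    ... | e , _ , refl = 1+n≢0 (ℤ.+-injective (trans (sym (identity a (+ suc e)))
            (trans (cong (ℤ._- a) (trans (sym (ℤ.+-assoc a 1ℤ (+ e))) (sym a≡z))) (ℤ.+-inverseʳ a))))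
      where
      identity : ∀ a x → (a ℤ.+ x) ℤ.- a ≡ x
      identity = ℤ.solve-∀

  unique-vecs : ∀ {A : Set} {xs : List A} n → Unique xs → Unique (vecs xs n)
  unique-vecs zero    unique = [] ∷ []
  unique-vecs (suc n) unique =
    Unique.cartesianProductWith⁺ _∷_ (λ { refl → refl , refl }) unique (unique-vecs n unique)

  boxMatrices : (n m b : ℕ) → List (Matrix n m)
  boxMatrices n m b = matrices (box b) n m

  unique-boxMatrices : ∀ n m b → Unique (boxMatrices n m b)
  unique-boxMatrices n m b = unique-vecs n (unique-vecs m (unique-interval (ℤ.- (+ b)) (2 * b)))

  ∈-boxMatrices⁺ : ∀ {n m b} {M : Matrix n m} → All (Box b) M → M ∈ boxMatrices n m b
  ∈-boxMatrices⁺ = ∈-vecs⁺ ∘ All.map (∈-vecs⁺ ∘ All.map inBox⇒∈box)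

  ∈-boxMatrices⁻ : ∀ {n m} b {M : Matrix n m} → M ∈ boxMatrices n m b → All (Box b) M
  ∈-boxMatrices⁻ {n} {m} b = All.map (All.map (∈box⇒inBox {b}) ∘ ∈-vecs⁻ (box b)) ∘ ∈-vecs⁻ (vecs (box b) m)

  boxCount : (q n m b : ℕ) → ℕ
  boxCount q n m b = ∑ (boxMatrices n m b) (λ M → 𝟙 (unimodularMod? q M))

  concat-injective : ∀ {A : Set} {n m} {M N : Vec (Vec A m) n} → concat M ≡ concat N → M ≡ N
  concat-injective {M = []}    {[]}    eq = refl
  concat-injective {M = r ∷ M} {s ∷ N} eq with ++-injective r s eq
  ... | r≡s , rest = cong₂ _∷_ r≡s (concat-injective rest)

  unimodular-cardinality : ∀ {n m} (n<m : n < m) b →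
    HasCardinality (Entrywise (RectangularUnimodular n<m) ∩ Box b) (boxCount 0 n m b)
  unimodular-cardinality {n} {m} n<m b =
    List.map concat unimodulars ,
    trans (List.length-map concat unimodulars) (length-filter (unimodularMod? 0) (boxMatrices n m b)) ,
    Unique.map⁺ concat-injective (Unique.filter⁺ (unimodularMod? 0) (unique-boxMatrices n m b)) ,
    λ v → mk⇔ to from
    where
    unimodulars = filter (unimodularMod? 0) (boxMatrices n m b)
    to : ∀ {v} → v ∈ List.map concat unimodulars → (Entrywise (RectangularUnimodular n<m) ∩ Box b) v
    to v∈ with ∈-map⁻ concat v∈
    ... | M , M∈ , refl with ∈-filter⁻ (unimodularMod? 0) {xs = boxMatrices n m b} M∈
    ...   | M∈box , unimodular =
      (M , refl , unimodular⇒rectangular n<m M unimodular) , All.concat⁺ (∈-boxMatrices⁻ b M∈box)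
    from : ∀ {v} → (Entrywise (RectangularUnimodular n<m) ∩ Box b) v → v ∈ List.map concat unimodulars
    from ((M , refl , rectangular) , v∈box) = ∈-map⁺ concat
      (∈-filter⁺ (unimodularMod? 0) (∈-boxMatrices⁺ (All.concat⁻ M v∈box)) (rectangular⇒unimodular n<m M rectangular))

  -- Every prime divides 0, so a relation modulo a prime divisor of `q` also obstructs unimodularity
  -- over the integers.
  unimodular-mod : ∀ {n m} q → n ≤ m → (M : Matrix n m) → UnimodularMod 0 M → UnimodularMod q M
  unimodular-mod q n≤m M unimodular with unimodular⊎deficient q n≤m M
  ... | inj₁ u = u
  ... | inj₂ (p , isPrime , _ , deficient) =
    contradiction deficient (unimodular⇒¬deficient M isPrime (p ∣0) unimodular)

  boxCount-≤ : ∀ q n m b → n ≤ m → boxCount 0 n m b ≤ boxCount q n m b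
  boxCount-≤ q n m b n≤m = ∑-mono (boxMatrices n m b) λ M → le (unimodularMod? 0 M) (unimodularMod? q M) (unimodular-mod q n≤m M)
    where
    le : ∀ {P Q : Set} (p : Dec P) (q : Dec Q) → (P → Q) → 𝟙 p ≤ 𝟙 q
    le (no _)  _       f = z≤n
    le (yes _) (yes _) f = ≤-refl
    le (yes p) (no ¬q) f = contradiction (f p) ¬q

  module _ (n m : ℕ) (n<m : suc n < m) (k b : ℕ) (2≤b : 2 ≤ b) (m≤b : m ≤ b) where

    private
      total = ((2 * b) ^ m) ^ suc n

      -- The index is the excess over `k`, and composite values are charged as if they were prime:
      -- the sum of all inverse squares is already small enough. The value at 0 never enters
      -- `sumTo`.
      mediumSize : ℕ → ℕ
      mediumSize zero    = 0
      mediumSize (suc i) = deficientSize n m b (k + suc i) ⦃ >-nonZero (≤-trans (s≤s z≤n) (m≤n+m (suc i) k)) ⦄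

      Medium : ℕ → Matrix (suc n) m → Set
      Medium i M = All (Box b) M × Prime (k + i) × Deficient (k + i) M

      cover-medium : ∀ i → Cover (Medium (suc i)) (mediumSize (suc i))
      cover-medium i with prime? (k + suc i)
      ... | yes isPrime = cover-⊆ (λ (M∈ , _ , deficient) → M∈ , deficient)
              (cover-deficient {k + suc i} ⦃ >-nonZero (≤-trans (s≤s z≤n) (m≤n+m (suc i) k)) ⦄ n m b isPrime)
      ... | no ¬prime = cover-≤ z≤n (cover-∅ λ (_ , isPrime , _) → ¬prime isPrime)

      Exceptional : Matrix (suc n) m → Set
      Exceptional M = (∃[ i ] i < b ∸ k × Medium (suc i) M) ⊎ (All (Box b) M × LargeDeficient b M)

      classify : ∀ {M} → All (Box b) M → UnimodularMod (k !) M → UnimodularMod 0 M ⊎ Exceptional M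
      classify {M} M∈ unimodular with unimodular⊎deficient 0 (<⇒≤ n<m) M
      ... | inj₁ u = inj₁ u
      ... | inj₂ (p , isPrime , _ , deficient) = inj₂ (place (p ≤? b))
        where
        -- A prime up to `k` divides `k !`, so a relation modulo it contradicts unimodularity modulo
        -- `k !`.
        k<p : k < p
        k<p = ≰⇒> λ p≤k → unimodular⇒¬deficient M isPrime
          (∣! k (>-nonZero⁻¹ p ⦃ prime⇒nonZero isPrime ⦄) p≤k) unimodular deficient
        place : Dec (p ≤ b) → Exceptional M
        place (no p≰b)  = inj₂ (M∈ , p , isPrime , ≰⇒> p≰b , deficient)
        place (yes p≤b) = inj₁ (p ∸ suc k , subst (_≤ b ∸ k) (+-∸-assoc 1 k<p) (∸-monoˡ-≤ k p≤b) ,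
          M∈ , subst Prime (sym eq) isPrime , subst (λ p → Deficient p M) (sym eq) deficient)
          where
          eq : k + suc (p ∸ suc k) ≡ p
          eq = trans (+-suc k (p ∸ suc k)) (m+[n∸m]≡n k<p)

    -- A union bound: the sieved matrices form a list without repetitions inside the exact ones
    -- followed by the exceptional cover, so overlaps and repetitions in the cover do no harm.
    sieve : ∃[ s ] ∃[ s′ ] boxCount (k !) (suc n) m b ≤ boxCount 0 (suc n) m b + (s + s′) ×
      k * s ≤ suc n * 2 ^ m * total × s′ * (2 * b) ≤ largeConstant (suc n) * total
    sieve with cover-largeDeficient {suc n} {m} b n<m 2≤b m≤b
    ... | s′ , large , s′≤ = sumTo mediumSize (b ∸ k) , s′ , counted ,
      sumTo-tail mediumSize (suc n * 2 ^ m * total) k (b ∸ k)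
        (λ i i<b∸k → deficientSize-≤ n m b (k + suc i) ⦃ >-nonZero (≤-trans (s≤s z≤n) (m≤n+m (suc i) k)) ⦄ n<m
          (≤-trans (k+i≤b i i<b∸k) (m≤m+n b (b + 0)))) ,
      s′≤
      where
      k+i≤b : ∀ i → i < b ∸ k → k + suc i ≤ b
      k+i≤b i i<b∸k = ≤-trans (+-monoʳ-≤ k i<b∸k) (≤-reflexive (m+[n∸m]≡n {k} (<⇒≤ (m∸n≢0⇒n<m (λ eq → n≮0 (subst (i <_) eq i<b∸k))))))

      exceptional : Cover Exceptional (sumTo mediumSize (b ∸ k) + s′)
      exceptional = cover-∪ (cover-⋃ {P = Medium} (b ∸ k) cover-medium) large

      sieved = filter (unimodularMod? (k !)) (boxMatrices (suc n) m b)
      exact = filter (unimodularMod? 0) (boxMatrices (suc n) m b)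

      included : ∀ {M} → M ∈ sieved → M ∈ exact ++ list exceptional
      included {M} M∈ with ∈-filter⁻ (unimodularMod? (k !)) {xs = boxMatrices (suc n) m b} M∈
      ... | M∈box , unimodular with classify (∈-boxMatrices⁻ b M∈box) unimodular
      ...   | inj₁ u = ∈-++⁺ˡ (∈-filter⁺ (unimodularMod? 0) M∈box u)
      ...   | inj₂ e = ∈-++⁺ʳ exact (complete exceptional e)

      open ≤-Reasoning
      counted : boxCount (k !) (suc n) m b ≤ boxCount 0 (suc n) m b + (sumTo mediumSize (b ∸ k) + s′)
      counted = begin
        boxCount (k !) (suc n) m b
          ≡⟨ length-filter (unimodularMod? (k !)) (boxMatrices (suc n) m b) ⟨
        length sieved
          ≤⟨ unique-length (Unique.filter⁺ (unimodularMod? (k !)) (unique-boxMatrices (suc n) m b)) included ⟩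
        length (exact ++ list exceptional)
          ≡⟨ List.length-++ exact ⟩
        length exact + length (list exceptional)
          ≤⟨ +-mono-≤ (≤-reflexive (length-filter (unimodularMod? 0) (boxMatrices (suc n) m b))) (length≤ exceptional) ⟩
        boxCount 0 (suc n) m b + (sumTo mediumSize (b ∸ k) + s′) ∎

  -- Comparison of the box with whole periods

  -- This is 2^n - 1, the constant in (1 + 1/t)^n ≤ 1 + (2^n - 1)/t for t ≥ 1, which `^-growth`
  -- states without denominators.
  growth : ℕ → ℕ
  growth zero    = 0
  growth (suc n) = suc (2 * growth n)

  ^-growth : ∀ t n → 1 ≤ t → t * suc t ^ n ≤ (t + growth n) * t ^ n
  ^-growth t zero    1≤t = ≤-reflexive (cong (_* 1) (sym (+-identityʳ t)))
  ^-growth t (suc n) 1≤t = begin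
    t * (suc t * suc t ^ n)                ≡⟨ swap t (suc t) (suc t ^ n) ⟩
    suc t * (t * suc t ^ n)                ≤⟨ *-monoʳ-≤ (suc t) (^-growth t n 1≤t) ⟩
    suc t * ((t + e) * t ^ n)              ≡⟨ expand t e (t ^ n) ⟩
    (t * t + t * e + t + e) * t ^ n        ≤⟨ *-monoˡ-≤ (t ^ n) (+-monoʳ-≤ (t * t + t * e + t) (m≤n*m e t ⦃ >-nonZero 1≤t ⦄)) ⟩
    (t * t + t * e + t + t * e) * t ^ n    ≡⟨ collect t e (t ^ n) ⟩
    (t + suc (2 * e)) * (t * t ^ n)        ∎
    where
    open ≤-Reasoning
    e = growth n
    swap : ∀ a b c → a * (b * c) ≡ b * (a * c)
    swap = solve-∀
    expand : ∀ t e x → (1 + t) * ((t + e) * x) ≡ (t * t + t * e + t + e) * x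
    expand = solve-∀
    collect : ∀ t e x → (t * t + t * e + t + t * e) * x ≡ (t + (1 + 2 * e)) * (t * x)
    collect = solve-∀

  ^^-growth : ∀ t m n → 1 ≤ t → t * (suc t ^ m) ^ n ≤ (t + growth (m * n)) * (t ^ m) ^ n
  ^^-growth t m n 1≤t = subst₂ (λ x y → t * x ≤ (t + growth (m * n)) * y)
    (sym (^-*-assoc (suc t) m n)) (sym (^-*-assoc t m n)) (^-growth t (m * n) 1≤t)

  ^^-distribʳ-* : ∀ m n a b → ((a * b) ^ m) ^ n ≡ (a ^ m) ^ n * (b ^ m) ^ n
  ^^-distribʳ-* m n a b = trans (cong (_^ n) (^-distribʳ-* m a b)) (^-distribʳ-* n (a ^ m) (b ^ m))

  ^^-monoˡ-≤ : ∀ m n {a b} → a ≤ b → (a ^ m) ^ n ≤ (b ^ m) ^ n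
  ^^-monoˡ-≤ m n a≤b = ^-monoˡ-≤ n (^-monoˡ-≤ m a≤b)

  unimodularCount-≤ : ∀ p q n m → unimodularCount p q n m ≤ (q ^ m) ^ n
  unimodularCount-≤ p q n m = begin
    unimodularCount p q n m                          ≤⟨ ∑-mono all (λ M → 𝟙≤1 (unimodularMod? p M)) ⟩
    ∑ all (λ _ → 1)                                  ≡⟨ trans (∑-const all 1) (*-identityʳ (length all)) ⟩
    length all                                       ≡⟨ length-vecs (vecs (residues q) m) n ⟩
    length (vecs (residues q) m) ^ n                 ≡⟨ cong (_^ n) (trans (length-vecs (residues q) m)
                                                          (cong (_^ m) (length-interval ℤ.0ℤ q))) ⟩
    (q ^ m) ^ n                                      ∎
    where
    open ≤-Reasoning
    all = matrices (residues q) n m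

  module Estimate (n m : ℕ) (n<m : suc n < m) (μ : ℕ) where

    -- The precision aimed at is 1/μ. Taking `k` at least `μ * medium` makes the primes from `k` to
    -- `b` cost at most 1/μ. Having at least `threshold` periods in each side of the box does the
    -- same for its boundary and the primes above `b` together; the successor ensures at least one
    -- period.
    medium growth′ large threshold : ℕ
    medium    = suc n * 2 ^ m
    growth′   = growth (m * suc n)
    large     = largeConstant (suc n)
    threshold = suc (μ * (growth′ + large))

    module _ (k b : ℕ) (k-large : μ * medium ≤ k) (2≤b : 2 ≤ b) (m≤b : m ≤ b)
      (b-large : threshold * (k ! * k !) ≤ 2 * b) where

      private
        q F G D c sieved t : ℕ
        q = k ! * k !
        F = unimodularCount (k !) q (suc n) m
        G = (q ^ m) ^ suc n
        D = ((2 * b) ^ m) ^ suc n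
        c = boxCount 0 (suc n) m b
        sieved = boxCount (k !) (suc n) m b
        instance
          q-nonZero : NonZero q
          q-nonZero = m*n≢0 (k !) (k !) ⦃ k !≢0 ⦄ ⦃ k !≢0 ⦄
        t = 2 * b / q

        threshold≤t : threshold ≤ t
        threshold≤t = subst (_≤ t) (m*n/n≡m threshold q) (/-monoˡ-≤ q b-large)
        1≤t : 1 ≤ t
        1≤t = ≤-trans (s≤s z≤n) threshold≤t
        instance
          t-nonZero : NonZero t
          t-nonZero = >-nonZero 1≤t
        errors≤t : μ * (growth′ + large) ≤ t
        errors≤t = ≤-trans (n≤1+n _) threshold≤t

        tq≤2b : t * q ≤ 2 * b
        tq≤2b = m/n*n≤m (2 * b) q
        2b≤[1+t]q : 2 * b ≤ suc t * q
        2b≤[1+t]q = ≤-trans (≤-reflexive (m≡m%n+[m/n]*n (2 * b) q)) (+-monoˡ-≤ (t * q) (<⇒≤ (m%n<n (2 * b) q)))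
        t≤2b : t ≤ 2 * b
        t≤2b = ≤-trans (m≤m*n t q) tq≤2b

        U V : ℕ
        U = (suc t ^ m) ^ suc n
        V = (t ^ m) ^ suc n

        VG≤D : V * G ≤ D
        VG≤D = ≤-trans (≤-reflexive (sym (^^-distribʳ-* m (suc n) t q))) (^^-monoˡ-≤ m (suc n) tq≤2b)
        D≤UG : D ≤ U * G
        D≤UG = ≤-trans (^^-monoˡ-≤ m (suc n) 2b≤[1+t]q) (≤-reflexive (^^-distribʳ-* m (suc n) (suc t) q))
        sieved≤ : sieved ≤ U * F
        sieved≤ = unimodular-interval-≤ (m∣m*n (k !)) (<⇒≤ n<m) (ℤ.- (ℤ.+ b)) (suc t) (2 * b) 2b≤[1+t]q
        ≤sieved : V * F ≤ sieved
        ≤sieved = unimodular-interval-≥ (m∣m*n (k !)) (<⇒≤ n<m) (ℤ.- (ℤ.+ b)) t (2 * b) tq≤2b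
        tU≤ : t * U ≤ (t + growth′) * V
        tU≤ = ^^-growth t m (suc n) 1≤t
        F≤G : F ≤ G
        F≤G = unimodularCount-≤ (k !) q (suc n) m

        -- After division by `t * μ * G * D`: sieved/D exceeds F/G by at most growth′/t. The box
        -- contains at least `t` and at most `suc t` periods in each direction, and `^^-growth`
        -- compares the two volumes.
        sieved-upper : t * (μ * (sieved * G)) ≤ t * (μ * (F * D)) + μ * growth′ * (G * D)
        sieved-upper = begin
          t * (μ * (sieved * G))             ≤⟨ *-monoʳ-≤ t (*-monoʳ-≤ μ (*-monoˡ-≤ G sieved≤)) ⟩
          t * (μ * (U * F * G))              ≡⟨ regroup t μ U F G ⟩
          t * U * (μ * F * G)                ≤⟨ *-monoˡ-≤ (μ * F * G) tU≤ ⟩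
          (t + growth′) * V * (μ * F * G)    ≡⟨ regroup′ t growth′ V μ F G ⟩
          t * (μ * (F * (V * G))) + μ * growth′ * (F * (V * G))
            ≤⟨ +-mono-≤ (*-monoʳ-≤ t (*-monoʳ-≤ μ (*-monoʳ-≤ F VG≤D))) (*-monoʳ-≤ (μ * growth′) (*-mono-≤ F≤G VG≤D)) ⟩
          t * (μ * (F * D)) + μ * growth′ * (G * D) ∎
          where
          open ≤-Reasoning
          regroup : ∀ t u U F G → t * (u * (U * F * G)) ≡ t * U * (u * F * G)
          regroup = solve-∀
          regroup′ : ∀ t e V u F G → (t + e) * V * (u * F * G) ≡ t * (u * (F * (V * G))) + u * e * (F * (V * G))
          regroup′ = solve-∀

        sieved-lower : t * (μ * (F * D)) ≤ t * (μ * (sieved * G)) + μ * growth′ * (G * D)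
        sieved-lower = begin
          t * (μ * (F * D))                  ≤⟨ *-monoʳ-≤ t (*-monoʳ-≤ μ (*-monoʳ-≤ F D≤UG)) ⟩
          t * (μ * (F * (U * G)))            ≡⟨ regroup t μ U F G ⟩
          t * U * (μ * F * G)                ≤⟨ *-monoˡ-≤ (μ * F * G) tU≤ ⟩
          (t + growth′) * V * (μ * F * G)    ≡⟨ regroup′ t growth′ V μ F G ⟩
          t * (μ * (V * F * G)) + μ * growth′ * (F * (V * G))
            ≤⟨ +-mono-≤ (*-monoʳ-≤ t (*-monoʳ-≤ μ (*-monoˡ-≤ G ≤sieved))) (*-monoʳ-≤ (μ * growth′) (*-mono-≤ F≤G VG≤D)) ⟩
          t * (μ * (sieved * G)) + μ * growth′ * (G * D) ∎
          where
          open ≤-Reasoning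
          regroup : ∀ t u U F G → t * (u * (F * (U * G))) ≡ t * U * (u * F * G)
          regroup = solve-∀
          regroup′ : ∀ t e V u F G → (t + e) * V * (u * F * G) ≡ t * (u * (V * F * G)) + u * e * (F * (V * G))
          regroup′ = solve-∀

      boxCount-upper : μ * (c * G) ≤ μ * (F * D) + G * D
      boxCount-upper = *-cancelˡ-≤ t (begin
        t * (μ * (c * G))                  ≤⟨ *-monoʳ-≤ t (*-monoʳ-≤ μ (*-monoˡ-≤ G (boxCount-≤ (k !) (suc n) m b (<⇒≤ n<m)))) ⟩
        t * (μ * (sieved * G))             ≤⟨ sieved-upper ⟩
        t * (μ * (F * D)) + μ * growth′ * (G * D)
          ≤⟨ +-monoʳ-≤ (t * (μ * (F * D))) (*-monoˡ-≤ (G * D) (≤-trans (*-monoʳ-≤ μ (m≤m+n growth′ large)) errors≤t)) ⟩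
        t * (μ * (F * D)) + t * (G * D)    ≡⟨ *-distribˡ-+ t (μ * (F * D)) (G * D) ⟨
        t * (μ * (F * D) + G * D)          ∎)
        where open ≤-Reasoning

      -- As proportions, F/G ≤ c/D + 2/μ. One unit 1/μ pays for the primes between `k` and `b`, the
      -- other for the boundary of the box and the primes above `b`, whose share of order 1/(2b) is
      -- at most of order 1/t.
      boxCount-lower : μ * (F * D) ≤ μ * (c * G) + 2 * (G * D)
      boxCount-lower with sieve n m n<m k b 2≤b m≤b
      ... | s , s′ , sieved≤c , ks≤ , s′b≤ = *-cancelˡ-≤ t (begin
        t * (μ * (F * D))
          ≤⟨ sieved-lower ⟩
        t * (μ * (sieved * G)) + μ * growth′ * (G * D)
          ≤⟨ +-monoˡ-≤ _ (*-monoʳ-≤ t (*-monoʳ-≤ μ (*-monoˡ-≤ G sieved≤c))) ⟩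
        t * (μ * ((c + (s + s′)) * G)) + μ * growth′ * (G * D)
          ≡⟨ expand t μ c s s′ G growth′ D ⟩
        t * (μ * (c * G)) + t * (μ * s) * G + μ * (s′ * t) * G + μ * growth′ * (G * D)
          ≤⟨ +-monoˡ-≤ _ (+-mono-≤ (+-monoʳ-≤ (t * (μ * (c * G))) (*-monoˡ-≤ G (*-monoʳ-≤ t μs≤D)))
               (*-monoˡ-≤ G (*-monoʳ-≤ μ (≤-trans (*-monoʳ-≤ s′ t≤2b) s′b≤)))) ⟩
        t * (μ * (c * G)) + t * D * G + μ * (large * D) * G + μ * growth′ * (G * D)
          ≡⟨ collect t μ c G D large growth′ ⟩
        t * (μ * (c * G)) + t * (G * D) + μ * (growth′ + large) * (G * D)
          ≤⟨ +-monoʳ-≤ (t * (μ * (c * G)) + t * (G * D)) (*-monoˡ-≤ (G * D) errors≤t) ⟩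
        t * (μ * (c * G)) + t * (G * D) + t * (G * D)
          ≡⟨ factor t (μ * (c * G)) (G * D) ⟩
        t * (μ * (c * G) + 2 * (G * D)) ∎)
        where
        open ≤-Reasoning
        instance
          medium-nonZero : NonZero medium
          medium-nonZero = m*n≢0 (suc n) (2 ^ m) ⦃ _ ⦄ ⦃ m^n≢0 2 m ⦄
        μs≤D : μ * s ≤ D
        μs≤D = *-cancelˡ-≤ medium (≤-trans (≤-reflexive (swap medium μ s)) (≤-trans (*-monoˡ-≤ s k-large) ks≤))
          where
          swap : ∀ a b c → a * (b * c) ≡ b * a * c
          swap = solve-∀
        expand : ∀ t u c s s′ G e D → t * (u * ((c + (s + s′)) * G)) + u * e * (G * D) ≡
          t * (u * (c * G)) + t * (u * s) * G + u * (s′ * t) * G + u * e * (G * D)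
        expand = solve-∀
        collect : ∀ t u c G D l e → t * (u * (c * G)) + t * D * G + u * (l * D) * G + u * e * (G * D) ≡
          t * (u * (c * G)) + t * (G * D) + u * (e + l) * (G * D)
        collect = solve-∀
        factor : ∀ t x y → t * x + t * y + t * y ≡ t * (x + 2 * y)
        factor = solve-∀

open Counting

-- From counts to rational proportions

module Density where

  open import Data.Fin.Base using (Fin; zero; suc; toℕ)
  open import Data.Integer.Base using (-[1+_])
  open import Data.Nat.Base as ℕ using (ℕ; zero; suc; _∸_; _^_; _!; z≤n; s≤s; NonZero)
  import Data.Nat.Divisibility as ℕ
  import Data.Nat.Properties as ℕ
  import Data.Nat.Tactic.RingSolver as ℕ
  open import Data.Rational.Base
    using (ℚ; mkℚ; 0ℚ; 1ℚ; _+_; _*_; _-_; -_; _≤_; _<_; _/_; ∣_∣; *<*; toℚᵘ; nonNegative; positive; ≢-nonZero; 1/_)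
  open import Data.Rational.Properties
  import Data.Rational.Solver as ℚ
  import Data.Rational.Unnormalised.Base as ℚᵘ
  import Data.Rational.Unnormalised.Properties as ℚᵘ

  frac : ℕ → (d : ℕ) → .⦃ _ : NonZero d ⦄ → ℚ
  frac a d = + a / d

  toℚᵘ-frac : ∀ a d → toℚᵘ (frac a (suc d)) ℚᵘ.≃ ℚᵘ.mkℚᵘ (+ a) d
  toℚᵘ-frac a d = toℚᵘ-fromℚᵘ (ℚᵘ.mkℚᵘ (+ a) d)

  frac-≤ : ∀ a b d e .⦃ _ : NonZero d ⦄ .⦃ _ : NonZero e ⦄ → a ℕ.* e ℕ.≤ b ℕ.* d → frac a d ≤ frac b e
  frac-≤ a b (suc d) (suc e) le = toℚᵘ-cancel-≤ (begin
    toℚᵘ (frac a (suc d))   ≃⟨ toℚᵘ-frac a d ⟩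
    ℚᵘ.mkℚᵘ (+ a) d         ≤⟨ ℚᵘ.*≤* (subst₂ ℤ._≤_ (ℤ.pos-* a (suc e)) (ℤ.pos-* b (suc d)) (ℤ.+≤+ le)) ⟩
    ℚᵘ.mkℚᵘ (+ b) e         ≃⟨ ℚᵘ.≃-sym (toℚᵘ-frac b e) ⟩
    toℚᵘ (frac b (suc e))   ∎)
    where open ℚᵘ.≤-Reasoning

  frac-≡ : ∀ a b d e .⦃ _ : NonZero d ⦄ .⦃ _ : NonZero e ⦄ → a ℕ.* e ≡ b ℕ.* d → frac a d ≡ frac b e
  frac-≡ a b d e eq = ≤-antisym (frac-≤ a b d e (ℕ.≤-reflexive eq)) (frac-≤ b a e d (ℕ.≤-reflexive (sym eq)))

  frac-+ : ∀ a b d e .⦃ _ : NonZero d ⦄ .⦃ _ : NonZero e ⦄ .⦃ _ : NonZero (d ℕ.* e) ⦄ →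
    frac a d + frac b e ≡ frac (a ℕ.* e ℕ.+ b ℕ.* d) (d ℕ.* e)
  frac-+ a b (suc d) (suc e) = toℚᵘ-injective (begin
    toℚᵘ (frac a (suc d) + frac b (suc e))
      ≈⟨ toℚᵘ-homo-+ (frac a (suc d)) (frac b (suc e)) ⟩
    toℚᵘ (frac a (suc d)) ℚᵘ.+ toℚᵘ (frac b (suc e))
      ≈⟨ ℚᵘ.+-cong (toℚᵘ-frac a d) (toℚᵘ-frac b e) ⟩
    ℚᵘ.mkℚᵘ (+ a) d ℚᵘ.+ ℚᵘ.mkℚᵘ (+ b) e
      ≡⟨ cong (λ x → ℚᵘ.mkℚᵘ x (e ℕ.+ d ℕ.* suc e)) (sym (trans (ℤ.pos-+ (a ℕ.* suc e) (b ℕ.* suc d))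
           (cong₂ ℤ._+_ (ℤ.pos-* a (suc e)) (ℤ.pos-* b (suc d))))) ⟩
    ℚᵘ.mkℚᵘ (+ (a ℕ.* suc e ℕ.+ b ℕ.* suc d)) (e ℕ.+ d ℕ.* suc e)
      ≈⟨ ℚᵘ.≃-sym (toℚᵘ-frac (a ℕ.* suc e ℕ.+ b ℕ.* suc d) (e ℕ.+ d ℕ.* suc e)) ⟩
    toℚᵘ (frac (a ℕ.* suc e ℕ.+ b ℕ.* suc d) (suc d ℕ.* suc e)) ∎)
    where open import Relation.Binary.Reasoning.Setoid ℚᵘ.≃-setoid

  frac-* : ∀ a b d e .⦃ _ : NonZero d ⦄ .⦃ _ : NonZero e ⦄ .⦃ _ : NonZero (d ℕ.* e) ⦄ →
    frac a d * frac b e ≡ frac (a ℕ.* b) (d ℕ.* e)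
  frac-* a b (suc d) (suc e) = toℚᵘ-injective (begin
    toℚᵘ (frac a (suc d) * frac b (suc e))
      ≈⟨ toℚᵘ-homo-* (frac a (suc d)) (frac b (suc e)) ⟩
    toℚᵘ (frac a (suc d)) ℚᵘ.* toℚᵘ (frac b (suc e))
      ≈⟨ ℚᵘ.*-cong (toℚᵘ-frac a d) (toℚᵘ-frac b e) ⟩
    ℚᵘ.mkℚᵘ (+ a) d ℚᵘ.* ℚᵘ.mkℚᵘ (+ b) e
      ≡⟨ cong (λ x → ℚᵘ.mkℚᵘ x (e ℕ.+ d ℕ.* suc e)) (sym (ℤ.pos-* a b)) ⟩
    ℚᵘ.mkℚᵘ (+ (a ℕ.* b)) (e ℕ.+ d ℕ.* suc e)
      ≈⟨ ℚᵘ.≃-sym (toℚᵘ-frac (a ℕ.* b) (e ℕ.+ d ℕ.* suc e)) ⟩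
    toℚᵘ (frac (a ℕ.* b) (suc d ℕ.* suc e)) ∎)
    where open import Relation.Binary.Reasoning.Setoid ℚᵘ.≃-setoid

  frac-+-same : ∀ a b d .⦃ _ : NonZero d ⦄ → frac a d + frac b d ≡ frac (a ℕ.+ b) d
  frac-+-same a b d@(suc _) = trans (frac-+ a b d d) (frac-≡ (a ℕ.* d ℕ.+ b ℕ.* d) (a ℕ.+ b) (d ℕ.* d) d (identity a b d))
    where
    identity : ∀ a b d → (a ℕ.* d ℕ.+ b ℕ.* d) ℕ.* d ≡ (a ℕ.+ b) ℕ.* (d ℕ.* d)
    identity = ℕ.solve-∀

  0≤frac : ∀ a d .⦃ _ : NonZero d ⦄ → 0ℚ ≤ frac a d
  0≤frac a d = frac-≤ 0 a 1 d z≤n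

  frac≤1 : ∀ {a} d .⦃ _ : NonZero d ⦄ → a ℕ.≤ d → frac a d ≤ 1ℚ
  frac≤1 {a} d a≤d = frac-≤ a 1 d 1 (subst₂ ℕ._≤_ (sym (ℕ.*-identityʳ a)) (sym (ℕ.*-identityˡ d)) a≤d)

  0<frac : ∀ a d .⦃ _ : NonZero a ⦄ .⦃ _ : NonZero d ⦄ → 0ℚ < frac a d
  0<frac (suc a) d = positive⁻¹ (frac (suc a) d) ⦃ normalize-pos (suc a) d ⦄

  archimedean : ∀ a ε → 0ℚ < ε → ∃[ d ] frac a (suc d) ≤ ε
  archimedean a (mkℚ (+ zero) d _)   0<ε        = contradiction (drop-*<* 0<ε) (ℤ.<-irrefl refl)
  archimedean a (mkℚ -[1+ n ] d _)   (*<* ())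
  archimedean a ε@(mkℚ (+ suc n) d _) 0<ε = a ℕ.* suc d , toℚᵘ-cancel-≤ (begin
    toℚᵘ (frac a (suc (a ℕ.* suc d)))   ≃⟨ toℚᵘ-frac a (a ℕ.* suc d) ⟩
    ℚᵘ.mkℚᵘ (+ a) (a ℕ.* suc d)         ≤⟨ ℚᵘ.*≤* (subst (ℤ._≤ + (suc n ℕ.* suc (a ℕ.* suc d)))
                                             (ℤ.pos-* a (suc d)) (ℤ.+≤+ cross)) ⟩
    toℚᵘ ε                              ∎)
    where
    open ℚᵘ.≤-Reasoning
    cross : a ℕ.* suc d ℕ.≤ suc n ℕ.* suc (a ℕ.* suc d)
    cross = ℕ.≤-trans (ℕ.n≤1+n _) (ℕ.m≤m+n (suc (a ℕ.* suc d)) (n ℕ.* suc (a ℕ.* suc d)))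

  *-mono-≤-nonNeg : ∀ {p q r s} → 0ℚ ≤ r → 0ℚ ≤ q → p ≤ q → r ≤ s → p * r ≤ q * s
  *-mono-≤-nonNeg {p} {q} {r} {s} 0≤r 0≤q p≤q r≤s = ≤-trans
    (*-monoʳ-≤-nonNeg r ⦃ nonNegative 0≤r ⦄ p≤q)
    (*-monoˡ-≤-nonNeg q ⦃ nonNegative 0≤q ⦄ r≤s)

  0≤* : ∀ {p q} → 0ℚ ≤ p → 0ℚ ≤ q → 0ℚ ≤ p * q
  0≤* {p} {q} 0≤p 0≤q = *-mono-≤-nonNeg {0ℚ} {p} {0ℚ} {q} ≤-refl 0≤p 0≤p 0≤q

  p≤p+q : ∀ {p q} → 0ℚ ≤ q → p ≤ p + q
  p≤p+q {p} {q} 0≤q = subst (_≤ p + q) (+-identityʳ p) (+-monoʳ-≤ p 0≤q)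

  ∣p-q∣≤ : ∀ {p q e} → p ≤ q + e → q ≤ p + e → ∣ p - q ∣ ≤ e
  ∣p-q∣≤ {p} {q} {e} p≤ q≤ with ∣p∣≡p∨∣p∣≡-p (p - q)
  ... | inj₁ eq = subst (_≤ e) (sym eq) (subst (p - q ≤_) (identity q e) (+-monoˡ-≤ (- q) p≤))
    where
    open ℚ.+-*-Solver
    identity : ∀ q e → q + e - q ≡ e
    identity = solve 2 (λ q e → q :+ e :- q := e) refl
  ... | inj₂ eq = subst (_≤ e) (sym (trans eq (identity p q))) (subst (q - p ≤_) (identity′ p e) (+-monoˡ-≤ (- p) q≤))
    where
    open ℚ.+-*-Solver
    identity : ∀ p q → - (p - q) ≡ q - p
    identity = solve 2 (λ p q → :- (p :- q) := q :- p) refl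
    identity′ : ∀ p e → p + e - p ≡ e
    identity′ = solve 2 (λ p e → p :+ e :- p := e) refl

  reciprocal-inverseˡ : ∀ p → 0ℚ < p → reciprocal p * p ≡ 1ℚ
  reciprocal-inverseˡ p 0<p with p ≟ 0ℚ
  ... | yes p≡0 = contradiction (sym p≡0) (<⇒≢ 0<p)
  ... | no  p≢0 = *-inverseˡ p ⦃ ≢-nonZero p≢0 ⦄

  0≤reciprocal : ∀ p → 0ℚ < p → 0ℚ ≤ reciprocal p
  0≤reciprocal p 0<p with p ≟ 0ℚ
  ... | yes _   = ≤-refl
  ... | no  p≢0 = <⇒≤ (positive⁻¹ ((1/ p) ⦃ ≢-nonZero p≢0 ⦄) ⦃ 1/pos⇒pos p ⦃ positive 0<p ⦄ ⦄)

  1≤ζ-partial : ∀ s k → 1ℚ ≤ ζ-partial s (suc k)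
  1≤ζ-partial s zero = ≤-reflexive (sym (trans (+-identityˡ (ζ-term s 0))
    (frac-≡ 1 1 (1 ^ s) 1 ⦃ ℕ.m^n≢0 1 s ⦄ (trans (ℕ.*-identityˡ 1) (sym (trans (ℕ.*-identityˡ (1 ^ s)) (ℕ.^-zeroˡ s)))))))
  1≤ζ-partial s (suc k) = ≤-trans (1≤ζ-partial s k) (p≤p+q (0≤frac 1 (suc (suc k) ^ s) ⦃ ℕ.m^n≢0 (suc (suc k)) s ⦄))

  -- The basic identity is P / qˢ · ζ_k(s) = 1 − e / qˢ, where P counts the primitive vectors modulo q
  -- and e the vectors whose gcd with q exceeds k.
  module ZetaFactor (k m : ℕ) (1≤m : 1 ℕ.≤ m) (1≤k : 1 ℕ.≤ k) where

    open PrimitiveCount (k !) m ⦃ k ℕ.!≢0 ⦄ public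

    s P : ℕ
    s = suc m
    P = primitiveCount (k !) q m

    instance
      q-nonZero′ : NonZero q
      q-nonZero′ = ℕ.m*n≢0 (k !) (k !) ⦃ k ℕ.!≢0 ⦄ ⦃ k ℕ.!≢0 ⦄
      qˢ-nonZero : NonZero (q ^ s)
      qˢ-nonZero = ℕ.m^n≢0 q s
      k-nonZero : NonZero k
      k-nonZero = ℕ.>-nonZero 1≤k

    factor : ℚ
    factor = frac P (q ^ s)

    ζ-inverse : ℚ
    ζ-inverse = reciprocal (ζ-partial s k)

    -- Every d ≤ k divides `k !`, so `withGcd-divisor` makes the proportion of vectors with gcd d
    -- equal to `factor` times 1/d^s.
    withGcd-ζ : ∀ j → j ℕ.≤ k → frac (sumTo withGcd j) (q ^ s) ≡ factor * ζ-partial s j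
    withGcd-ζ zero    j≤k = trans (frac-≡ 0 0 (q ^ s) 1 refl) (sym (*-zeroʳ factor))
    withGcd-ζ (suc j) j≤k = begin
      frac (sumTo withGcd j ℕ.+ withGcd d) (q ^ s)
        ≡⟨ frac-+-same (sumTo withGcd j) (withGcd d) (q ^ s) ⟨
      frac (sumTo withGcd j) (q ^ s) + frac (withGcd d) (q ^ s)
        ≡⟨ cong₂ _+_ (withGcd-ζ j (ℕ.≤-trans (ℕ.n≤1+n j) j≤k)) term ⟩
      factor * ζ-partial s j + factor * ζ-term s j
        ≡⟨ *-distribˡ-+ factor (ζ-partial s j) (ζ-term s j) ⟨
      factor * ζ-partial s (suc j) ∎
      where
      open ≡-Reasoning
      d = suc j
      instance
        dˢ-nonZero : NonZero (d ^ s)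
        dˢ-nonZero = ℕ.m^n≢0 d s
        product-nonZero : NonZero (q ^ s ℕ.* d ^ s)
        product-nonZero = ℕ.m*n≢0 (q ^ s) (d ^ s)
      identity : ∀ w x y → w ℕ.* (x ℕ.* y) ≡ (y ℕ.* w) ℕ.* 1 ℕ.* x
      identity = ℕ.solve-∀
      term : frac (withGcd d) (q ^ s) ≡ factor * ζ-term s j
      term = sym (trans (frac-* P 1 (q ^ s) (d ^ s))
        (frac-≡ (P ℕ.* 1) (withGcd d) (q ^ s ℕ.* d ^ s) (q ^ s) (sym (trans (identity (withGcd d) (q ^ s) (d ^ s))
          (cong (λ t → t ℕ.* 1 ℕ.* q ^ s) (withGcd-divisor d (∣! k (s≤s z≤n) j≤k)))))))

    private
      split = sumTo-withGcd-split k k≤k! 1≤m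
        where
        k≤k! : k ℕ.≤ k !
        k≤k! = ℕ.∣⇒≤ ⦃ k ℕ.!≢0 ⦄ (∣! k 1≤k ℕ.≤-refl)
      e = proj₁ split
      u = frac e (q ^ s)

      factor-ζ : factor * ζ-partial s k + u ≡ 1ℚ
      factor-ζ = trans (cong (_+ u) (sym (withGcd-ζ k ℕ.≤-refl)))
        (trans (frac-+-same (sumTo withGcd k) e (q ^ s))
          (frac-≡ (sumTo withGcd k ℕ.+ e) 1 (q ^ s) 1 (trans (ℕ.*-identityʳ (sumTo withGcd k ℕ.+ e)) (trans (sym (proj₁ (proj₂ split))) (sym (ℕ.*-identityˡ (q ^ s)))))))

      u≤1/k : u ≤ frac 1 k
      u≤1/k = frac-≤ e 1 (q ^ s) k (subst₂ ℕ._≤_ (ℕ.*-comm k e) (sym (ℕ.*-identityˡ (q ^ s))) (proj₂ (proj₂ split)))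

      1≤ζ : 1ℚ ≤ ζ-partial s k
      1≤ζ = subst (λ k → 1ℚ ≤ ζ-partial s k) (ℕ.suc-pred k) (1≤ζ-partial s (ℕ.pred k))
      0<ζ : 0ℚ < ζ-partial s k
      0<ζ = <-≤-trans (positive⁻¹ 1ℚ) 1≤ζ

    0≤ζ-inverse : 0ℚ ≤ ζ-inverse
    0≤ζ-inverse = 0≤reciprocal (ζ-partial s k) 0<ζ

    ζ-inverse≤1 : ζ-inverse ≤ 1ℚ
    ζ-inverse≤1 = begin
      ζ-inverse                   ≡⟨ *-identityʳ ζ-inverse ⟨
      ζ-inverse * 1ℚ              ≤⟨ *-monoˡ-≤-nonNeg ζ-inverse ⦃ nonNegative 0≤ζ-inverse ⦄ 1≤ζ ⟩
      ζ-inverse * ζ-partial s k   ≡⟨ reciprocal-inverseˡ (ζ-partial s k) 0<ζ ⟩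
      1ℚ                          ∎
      where open ≤-Reasoning

    private
      -- The basic identity multiplied by `ζ-inverse`: the deviation from `factor` becomes explicit,
      -- lying between 0 and `u`.
      ζ-inverse≡ : ζ-inverse ≡ factor + ζ-inverse * u
      ζ-inverse≡ = begin
        ζ-inverse                                               ≡⟨ *-identityʳ ζ-inverse ⟨
        ζ-inverse * 1ℚ                                          ≡⟨ cong (ζ-inverse *_) factor-ζ ⟨
        ζ-inverse * (factor * ζ-partial s k + u)                ≡⟨ identity ζ-inverse factor (ζ-partial s k) u ⟩
        factor * (ζ-inverse * ζ-partial s k) + ζ-inverse * u    ≡⟨ cong (λ t → factor * t + ζ-inverse * u) (reciprocal-inverseˡ (ζ-partial s k) 0<ζ) ⟩
        factor * 1ℚ + ζ-inverse * u                             ≡⟨ cong (_+ ζ-inverse * u) (*-identityʳ factor) ⟩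
        factor + ζ-inverse * u                                  ∎
        where
        open ≡-Reasoning
        open ℚ.+-*-Solver
        identity : ∀ r x z u → r * (x * z + u) ≡ x * (r * z) + r * u
        identity = solve 4 (λ r x z u → r :* (x :* z :+ u) := x :* (r :* z) :+ r :* u) refl

    factor≤ζ-inverse : factor ≤ ζ-inverse
    factor≤ζ-inverse = subst (factor ≤_) (sym ζ-inverse≡) (p≤p+q (0≤* 0≤ζ-inverse (0≤frac e (q ^ s))))

    ζ-inverse≤factor : ζ-inverse ≤ factor + frac 1 k
    ζ-inverse≤factor = subst (_≤ factor + frac 1 k) (sym ζ-inverse≡) (+-monoʳ-≤ factor
      (subst (ζ-inverse * u ≤_) (*-identityˡ (frac 1 k))
        (*-mono-≤-nonNeg (0≤frac e (q ^ s)) (<⇒≤ (positive⁻¹ 1ℚ)) ζ-inverse≤1 u≤1/k)))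

  -- Convergence to a real given by approximants

  -- The order of quantifiers separates the two limits: `k` is fixed from the precision and from the
  -- Cauchy tail of `ρ`, and only then does `b` become large.
  converges : (x : ℕ → ℚ) (ρ : ℝ) (R : ℕ → ℚ) → (∀ k → approx ρ k ≡ R k) →
    (∀ μ k₀ → ∃[ k ] k₀ ℕ.≤ k × ∃[ b₀ ] (∀ b → b₀ ℕ.≤ b → ∣ x b - R k ∣ ≤ frac 3 (suc μ))) →
    (λ b → fromℚ (x b)) ⟶ ρ
  converges x ρ R approx≡R close ε 0<ε =
    -- Of the five units 1/μ, three come from `close`, one from the Cauchy tail of `ρ`, and one is
    -- the positive gap that `_<ℝ_` demands.
    let μ-1 , 5/μ≤ε = archimedean 5 ε 0<ε
        μ = suc μ-1
        k₀ , tail = cauchy ρ (frac 1 μ) (0<frac 1 μ)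
        k , k₀≤k , b₀ , x≈R = close μ-1 k₀
    in b₀ , λ b b₀≤b → frac 1 μ , 0<frac 1 μ , k , λ j k≤j → begin
      ∣ x b - approx ρ j ∣ + frac 1 μ
        ≡⟨ cong (λ t → ∣ t ∣ + frac 1 μ) (identity (x b) (approx ρ k) (approx ρ j)) ⟩
      ∣ (x b - approx ρ k) + (approx ρ k - approx ρ j) ∣ + frac 1 μ
        ≤⟨ +-monoˡ-≤ (frac 1 μ) (∣p+q∣≤∣p∣+∣q∣ (x b - approx ρ k) (approx ρ k - approx ρ j)) ⟩
      (∣ x b - approx ρ k ∣ + ∣ approx ρ k - approx ρ j ∣) + frac 1 μ
        ≤⟨ +-monoˡ-≤ (frac 1 μ) (+-mono-≤
             (subst (λ t → ∣ x b - t ∣ ≤ frac 3 μ) (sym (approx≡R k)) (x≈R b b₀≤b))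
             (<⇒≤ (tail k j k₀≤k (ℕ.≤-trans k₀≤k k≤j)))) ⟩
      (frac 3 μ + frac 1 μ) + frac 1 μ
        ≡⟨ trans (cong (_+ frac 1 μ) (frac-+-same 3 1 μ)) (frac-+-same 4 1 μ) ⟩
      frac 5 μ
        ≤⟨ 5/μ≤ε ⟩
      ε ∎
    where
    open ≤-Reasoning
    open ℚ.+-*-Solver
    identity : ∀ x y z → x - z ≡ (x - y) + (y - z)
    identity = solve 3 (λ x y z → x :- z := (x :- y) :+ (y :- z)) refl

  -- Products of inverse zeta values and unimodular ratios

  inverseZetas : (k n m : ℕ) → ℚ
  inverseZetas k zero    m       = 1ℚ
  -- A default value, never reached while `n ≤ m`.
  inverseZetas k (suc n) zero    = 1ℚ
  inverseZetas k (suc n) (suc m) = reciprocal (ζ-partial (suc m) k) * inverseZetas k n m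

  approx-∏-suc : ∀ {n} (f : Fin (suc n) → ℝ) k →
    approx (∏ f) k ≡ approx (f zero) k * approx (∏ (λ i → f (suc i))) k
  approx-∏-suc f k = refl

  approx-∏ : ∀ k n m → n ℕ.≤ m → (f : Fin n → ℝ) →
    (∀ i → approx (f i) k ≡ reciprocal (ζ-partial (m ∸ toℕ i) k)) → approx (∏ f) k ≡ inverseZetas k n m
  approx-∏ k zero    m       n≤m       f eq = refl
  approx-∏ k (suc n) (suc m) (s≤s n≤m) f eq = trans (approx-∏-suc f k)
    (cong₂ _*_ (eq zero) (approx-∏ k n m n≤m (λ i → f (suc i)) (λ i → eq (suc i))))

  approx-1/ζ : ∀ s (1<s : 1 ℕ.< s) k → approx (1/ζ s 1<s) k ≡ reciprocal (ζ-partial s k)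
  approx-1/ζ s 1<s k = refl

  -- The factors are replaced one at a time. Since `r` and `Φ` are at most 1, each replacement costs
  -- no more than its own error, and the errors add up.
  product-bounds : ∀ {r x u R Φ v} → 0ℚ ≤ r → r ≤ 1ℚ → x ≤ r → r ≤ x + u →
    0ℚ ≤ Φ → Φ ≤ 1ℚ → 0ℚ ≤ R → Φ ≤ R → R ≤ Φ + v → 0ℚ ≤ u → 0ℚ ≤ v →
    0ℚ ≤ r * R × x * Φ ≤ r * R × r * R ≤ x * Φ + (u + v)
  product-bounds {r} {x} {u} {R} {Φ} {v} 0≤r r≤1 x≤r r≤x+u 0≤Φ Φ≤1 0≤R Φ≤R R≤Φ+v 0≤u 0≤v =
    0≤* 0≤r 0≤R , *-mono-≤-nonNeg 0≤Φ 0≤r x≤r Φ≤R , (begin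
      r * R                           ≤⟨ *-monoˡ-≤-nonNeg r ⦃ nonNegative 0≤r ⦄ R≤Φ+v ⟩
      r * (Φ + v)                     ≡⟨ *-distribˡ-+ r Φ v ⟩
      r * Φ + r * v                   ≤⟨ +-mono-≤ (*-monoʳ-≤-nonNeg Φ ⦃ nonNegative 0≤Φ ⦄ r≤x+u)
                                           (*-monoʳ-≤-nonNeg v ⦃ nonNegative 0≤v ⦄ r≤1) ⟩
      (x + u) * Φ + 1ℚ * v            ≡⟨ cong₂ _+_ (*-distribʳ-+ Φ x u) (*-identityˡ v) ⟩
      (x * Φ + u * Φ) + v             ≤⟨ +-monoˡ-≤ v (+-monoʳ-≤ (x * Φ) (*-monoˡ-≤-nonNeg u ⦃ nonNegative 0≤u ⦄ Φ≤1)) ⟩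
      (x * Φ + u * 1ℚ) + v            ≡⟨ cong (λ t → x * Φ + t + v) (*-identityʳ u) ⟩
      (x * Φ + u) + v                 ≡⟨ +-assoc (x * Φ) u v ⟩
      x * Φ + (u + v)                 ∎)
    where open ≤-Reasoning

  module _ (k : ℕ) (1≤k : 1 ℕ.≤ k) where

    private
      q = k ! ℕ.* k !
      instance
        q-nonZero : NonZero q
        q-nonZero = ℕ.m*n≢0 (k !) (k !) ⦃ k ℕ.!≢0 ⦄ ⦃ k ℕ.!≢0 ⦄
        k-nonZero : NonZero k
        k-nonZero = ℕ.>-nonZero 1≤k

    unimodularRatio : (n m : ℕ) → ℚ
    unimodularRatio n m = frac (unimodularCount (k !) q n m) ((q ^ m) ^ n)
      ⦃ ℕ.m^n≢0 (q ^ m) n ⦃ ℕ.m^n≢0 q m ⦄ ⦄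

    unimodularRatio-suc : ∀ n m → n ℕ.≤ m → unimodularRatio (suc n) (suc m) ≡
      frac (primitiveCount (k !) q m) (q ^ suc m) ⦃ ℕ.m^n≢0 q (suc m) ⦄ * unimodularRatio n m
    unimodularRatio-suc n m n≤m = sym (trans (frac-* P F (q ^ suc m) ((q ^ m) ^ n))
      (frac-≡ (P ℕ.* F) (unimodularCount (k !) q (suc n) (suc m)) (q ^ suc m ℕ.* (q ^ m) ^ n) ((q ^ suc m) ^ suc n)
        (trans (cong (λ t → P ℕ.* F ℕ.* (q ^ suc m ℕ.* t)) (^-distribʳ-* n q (q ^ m)))
          (trans (identity P F (q ^ suc m) (q ^ n) ((q ^ m) ^ n))
            (cong (ℕ._* (q ^ suc m ℕ.* (q ^ m) ^ n)) (sym (unimodularCount-suc {k !} {q} n m (ℕ.m∣m*n (k !)) n≤m)))))))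
      where
      P = primitiveCount (k !) q m
      F = unimodularCount (k !) q n m
      instance
        row-nonZero : NonZero (q ^ suc m)
        row-nonZero = ℕ.m^n≢0 q (suc m)
        rest-nonZero : NonZero ((q ^ m) ^ n)
        rest-nonZero = ℕ.m^n≢0 (q ^ m) n ⦃ ℕ.m^n≢0 q m ⦄
        product-nonZero : NonZero (q ^ suc m ℕ.* (q ^ m) ^ n)
        product-nonZero = ℕ.m*n≢0 (q ^ suc m) ((q ^ m) ^ n)
        all-nonZero : NonZero ((q ^ suc m) ^ suc n)
        all-nonZero = ℕ.m^n≢0 (q ^ suc m) (suc n)
      identity : ∀ P F x y z → P ℕ.* F ℕ.* (x ℕ.* (y ℕ.* z)) ≡ P ℕ.* (y ℕ.* F) ℕ.* (x ℕ.* z)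
      identity = ℕ.solve-∀

    0≤unimodularRatio : ∀ n m → 0ℚ ≤ unimodularRatio n m
    0≤unimodularRatio n m = 0≤frac (unimodularCount (k !) q n m) ((q ^ m) ^ n) ⦃ ℕ.m^n≢0 (q ^ m) n ⦃ ℕ.m^n≢0 q m ⦄ ⦄

    unimodularRatio≤1 : ∀ n m → unimodularRatio n m ≤ 1ℚ
    unimodularRatio≤1 n m = frac≤1 ((q ^ m) ^ n) ⦃ ℕ.m^n≢0 (q ^ m) n ⦃ ℕ.m^n≢0 q m ⦄ ⦄ (unimodularCount-≤ (k !) q n m)

    -- Each row contributes one factor, approximated within 1/k by `ZetaFactor`; `product-bounds`
    -- adds these errors up to n/k.
    unimodularRatio-bounds : ∀ n m → n ℕ.< m →
      0ℚ ≤ inverseZetas k n m × unimodularRatio n m ≤ inverseZetas k n m ×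
      inverseZetas k n m ≤ unimodularRatio n m + frac n k
    unimodularRatio-bounds zero m n<m = <⇒≤ (positive⁻¹ 1ℚ) , unimodularRatio≤1 0 m ,
      ≤-trans (≤-reflexive (frac-≡ 1 1 1 1 refl)) (p≤p+q (0≤frac 0 k))
    unimodularRatio-bounds (suc n) (suc m) (s≤s n<m) =
      let 0≤R , Φ≤R , R≤Φ = unimodularRatio-bounds n m n<m
          0≤rR , xΦ≤rR , rR≤xΦ = product-bounds 0≤ζ-inverse ζ-inverse≤1 factor≤ζ-inverse ζ-inverse≤factor
            (0≤unimodularRatio n m) (unimodularRatio≤1 n m) 0≤R Φ≤R R≤Φ (0≤frac 1 k) (0≤frac n k)
      in 0≤rR ,
        subst (_≤ inverseZetas k (suc n) (suc m)) (sym Φ-suc) xΦ≤rR ,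
        subst₂ (λ x y → inverseZetas k (suc n) (suc m) ≤ x + y) (sym Φ-suc) (frac-+-same 1 n k) rR≤xΦ
      where
      -- Here `n < m` makes the dimension `suc m` of the current row at least 2.
      open ZetaFactor k m (ℕ.≤-trans (s≤s z≤n) n<m) 1≤k
        using (factor; 0≤ζ-inverse; ζ-inverse≤1; factor≤ζ-inverse; ζ-inverse≤factor)
      Φ-suc : unimodularRatio (suc n) (suc m) ≡ factor * unimodularRatio n m
      Φ-suc = unimodularRatio-suc n m (ℕ.<⇒≤ n<m)

  frac-close : ∀ a c F G D μ .⦃ _ : NonZero G ⦄ .⦃ _ : NonZero D ⦄ .⦃ _ : NonZero μ ⦄ →
    μ ℕ.* (c ℕ.* G) ℕ.≤ μ ℕ.* (F ℕ.* D) ℕ.+ a ℕ.* (G ℕ.* D) → frac c D ≤ frac F G + frac a μ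
  frac-close a c F G D μ le = subst (frac c D ≤_) (sym (frac-+ F a G μ))
    (frac-≤ c (F ℕ.* μ ℕ.+ a ℕ.* G) D (G ℕ.* μ) (subst₂ ℕ._≤_ (identity₁ μ c G) (identity₂ μ F D a G) le))
    where
    instance
      product-nonZero : NonZero (G ℕ.* μ)
      product-nonZero = ℕ.m*n≢0 G μ
    identity₁ : ∀ u c G → u ℕ.* (c ℕ.* G) ≡ c ℕ.* (G ℕ.* u)
    identity₁ = ℕ.solve-∀
    identity₂ : ∀ u F D a G → u ℕ.* (F ℕ.* D) ℕ.+ a ℕ.* (G ℕ.* D) ≡ (F ℕ.* u ℕ.+ a ℕ.* G) ℕ.* D
    identity₂ = ℕ.solve-∀

  -- Convergence of the proportions in the box

  module _ (n m : ℕ) (n<m : suc n ℕ.< m) where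

    private
      boxRatio : ℕ → ℚ
      boxRatio = proportion (suc n ℕ.* m) (λ b → boxCount 0 (suc n) m b)

    module _ (μ : ℕ) .⦃ _ : NonZero μ ⦄ (k : ℕ) (1≤k : 1 ℕ.≤ k) where

      open Estimate n m n<m μ

      -- The summands provide in turn the periods required by `threshold`, the bound `m ≤ b`, and
      -- `2 ≤ b`.
      startingPoint : ℕ
      startingPoint = threshold ℕ.* (k ! ℕ.* k !) ℕ.+ (m ℕ.+ 2)

      boxRatio-inverseZetas : μ ℕ.* medium ℕ.≤ k → suc n ℕ.* μ ℕ.≤ k → ∀ b → startingPoint ℕ.≤ b →
        ∣ boxRatio b - inverseZetas k (suc n) m ∣ ≤ frac 3 μ
      boxRatio-inverseZetas medium≤k nμ≤k b start≤b = ∣p-q∣≤ upper lower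
        where
        open ≤-Reasoning
        B = suc b
        q = k ! ℕ.* k !
        G = (q ^ m) ^ suc n
        D = ((2 ℕ.* B) ^ m) ^ suc n
        F = unimodularCount (k !) q (suc n) m
        c = boxCount 0 (suc n) m B
        instance
          k-nonZero : NonZero k
          k-nonZero = ℕ.>-nonZero 1≤k
          G-nonZero : NonZero G
          G-nonZero = ℕ.m^n≢0 (q ^ m) (suc n) ⦃ ℕ.m^n≢0 q m ⦃ ℕ.m*n≢0 (k !) (k !) ⦃ k ℕ.!≢0 ⦄ ⦃ k ℕ.!≢0 ⦄ ⦄ ⦄
          D-nonZero : NonZero D
          D-nonZero = ℕ.m^n≢0 ((2 ℕ.* B) ^ m) (suc n) ⦃ ℕ.m^n≢0 (2 ℕ.* B) m ⦄
          volume-nonZero : NonZero ((2 ℕ.* B) ^ (suc n ℕ.* m))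
          volume-nonZero = ℕ.m^n≢0 (2 ℕ.* B) (suc n ℕ.* m)

        m+2≤B : m ℕ.+ 2 ℕ.≤ B
        m+2≤B = ℕ.≤-trans (ℕ.m≤n+m (m ℕ.+ 2) (threshold ℕ.* q)) (ℕ.≤-trans start≤b (ℕ.n≤1+n b))
        2≤B : 2 ℕ.≤ B
        2≤B = ℕ.≤-trans (ℕ.m≤n+m 2 m) m+2≤B
        m≤B : m ℕ.≤ B
        m≤B = ℕ.≤-trans (ℕ.m≤m+n m 2) m+2≤B
        threshold≤2B : threshold ℕ.* q ℕ.≤ 2 ℕ.* B
        threshold≤2B = ℕ.≤-trans (ℕ.m≤m+n (threshold ℕ.* q) (m ℕ.+ 2))
          (ℕ.≤-trans start≤b (ℕ.≤-trans (ℕ.n≤1+n b) (ℕ.m≤m+n B (B ℕ.+ 0))))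

        volume : (2 ℕ.* B) ^ (suc n ℕ.* m) ≡ D
        volume = trans (cong ((2 ℕ.* B) ^_) (ℕ.*-comm (suc n) m)) (sym (ℕ.^-*-assoc (2 ℕ.* B) m (suc n)))

        ratio : boxRatio b ≡ frac c D
        ratio = frac-≡ c c ((2 ℕ.* B) ^ (suc n ℕ.* m)) D (cong (c ℕ.*_) (sym volume))

        Φ = unimodularRatio k 1≤k (suc n) m
        R = inverseZetas k (suc n) m
        bounds = unimodularRatio-bounds k 1≤k (suc n) m n<m

        upper : boxRatio b ≤ R + frac 3 μ
        upper = begin
          boxRatio b          ≡⟨ ratio ⟩
          frac c D            ≤⟨ frac-close 1 c F G D μ (subst (λ t → μ ℕ.* (c ℕ.* G) ℕ.≤ μ ℕ.* (F ℕ.* D) ℕ.+ t)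
                                   (sym (ℕ.*-identityˡ (G ℕ.* D)))
                                   (boxCount-upper k B medium≤k 2≤B m≤B threshold≤2B)) ⟩
          Φ + frac 1 μ        ≤⟨ +-mono-≤ (proj₁ (proj₂ bounds)) (frac-≤ 1 3 μ μ (ℕ.*-monoˡ-≤ μ {1} {3} (s≤s z≤n))) ⟩
          R + frac 3 μ        ∎

        lower : R ≤ boxRatio b + frac 3 μ
        lower = begin
          R                                    ≤⟨ proj₂ (proj₂ bounds) ⟩
          -- Two units 1/μ come from `boxCount-lower`; the third bounds the error `frac (suc n) k`
          -- of the zeta factors, by the choice of `k`.
          Φ + frac (suc n) k                   ≤⟨ +-mono-≤ (frac-close 2 F c D G μ (subst (λ t → μ ℕ.* (F ℕ.* D) ℕ.≤ μ ℕ.* (c ℕ.* G) ℕ.+ 2 ℕ.* t)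
                                                    (ℕ.*-comm G D)
                                                    (boxCount-lower k B medium≤k 2≤B m≤B threshold≤2B)))
                                                  (frac-≤ (suc n) 1 k μ (ℕ.≤-trans nμ≤k (ℕ.≤-reflexive (sym (ℕ.*-identityˡ k))))) ⟩
          (frac c D + frac 2 μ) + frac 1 μ     ≡⟨ +-assoc (frac c D) (frac 2 μ) (frac 1 μ) ⟩
          frac c D + (frac 2 μ + frac 1 μ)     ≡⟨ cong₂ _+_ (sym ratio) (frac-+-same 2 1 μ) ⟩
          boxRatio b + frac 3 μ                ∎

    boxRatio-converges : (λ b → fromℚ (boxRatio b)) ⟶ ∏ {suc n} (λ i → 1/ζ (m ∸ toℕ i) (1<m∸i n<m i))
    boxRatio-converges = converges boxRatio (∏ {suc n} (λ i → 1/ζ (m ∸ toℕ i) (1<m∸i n<m i)))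
      (λ k → inverseZetas k (suc n) m)
      (λ k → approx-∏ k (suc n) m (ℕ.<⇒≤ n<m) (λ i → 1/ζ (m ∸ toℕ i) (1<m∸i n<m i))
        (λ i → approx-1/ζ (m ∸ toℕ i) (1<m∸i n<m i) k))
      λ μ k₀ → k μ k₀ , ℕ.≤-trans (ℕ.m≤m+n k₀ _) (ℕ.n≤1+n _) , startingPoint (suc μ) (k μ k₀) (s≤s z≤n) ,
        boxRatio-inverseZetas (suc μ) (k μ k₀) (s≤s z≤n)
          (ℕ.≤-trans (ℕ.m≤m+n _ _) (ℕ.≤-trans (ℕ.m≤n+m _ k₀) (ℕ.n≤1+n _)))
          (ℕ.≤-trans (ℕ.m≤n+m _ (suc μ ℕ.* (suc n ℕ.* 2 ^ m))) (ℕ.≤-trans (ℕ.m≤n+m _ k₀) (ℕ.n≤1+n _)))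
      where
      k : ℕ → ℕ → ℕ
      -- The sum exceeds each of its requirements: the given `k₀`, the sieve bound for the primes up
      -- to `b`, the error of the zeta factors, and positivity.
      k μ k₀ = suc (k₀ ℕ.+ (suc μ ℕ.* (suc n ℕ.* 2 ^ m) ℕ.+ suc n ℕ.* suc μ))

open Density

open import Data.Fin.Base using (toℕ)
open import Data.Nat.Base using (ℕ; suc; _<_; _∸_)

corollary17 : ∀ (n m : ℕ) → 0 < n → (n<m : n < m) →
    HasDensity (Entrywise (RectangularUnimodular n<m))
    (∏ {n} (λ i → 1/ζ (m ∸ toℕ i) (1<m∸i n<m i)))
corollary17 (suc n) m 0<n n<m =
  boxCount 0 (suc n) m , (λ b → unimodular-cardinality n<m (suc b)) , boxRatio-converges n m n<m
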